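{- Let $\mathcal{P}_n\subset\mathbb{R}^n$ be the convex hull of all parking functions of length $n$. For $s$ from $0$ to $n$, let $f_{n-s}$ be the number of $(n-s)$-dimensional faces of $\mathcal{P}_n$. Then $$f_{n-s}=\sum_{\substack{0\le m\le s\\ m\neq 1}}\binom{n}{m}\cdot (s-m)!\cdot S(n-m+1,\,s-m+1),$$ where $S(a,b)$ denotes the Stirling number of the second kind.
   Context: Here $n$ is a positive integer. A sequence $\alpha=(a_1,\dots,a_n)$ with $a_i\in\{1,\dots,n\}$ is a parking function of length $n$ if its weakly increasing rearrangement $b_1\le b_2\le\dots\le b_n$ satisfies $b_i\le i$ for all $i\in\{1,\dots,n\}$. A face of a polytope $\mathcal{P}\subset\mathbb{R}^n$ is a set of the form $\mathcal{P}\cap\{x: c\cdot x=d\}$ where $c\in\mathbb{R}^n$, $d\in\mathbb{R}$ are such that $c\cdot x\le d$ for all $x\in\mathcal{P}$. In particular ($c=0$, $d=0$) $\mathcal{P}$ itself is a face. The Stirling number of the second kind $S(a,b)$ is the number of partitions of an $a$-element set into $b$ nonempty unlabeled blocks.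
   Formalization: The case n = 1, s = 0 is excluded: there the polytope is the single point 1, so f_1 = 0, while the formula gives 1. The real numbers are replaced by an arbitrary ordered field with decidable order, of which the reals are classically an instance. -}

module Defs where

open import Algebra.Bundles using (CommutativeRing)
import Algebra.Definitions.RawMonoid as RawMonoidDefs
open import Data.Bool.Base using (true; false)
open import Data.Fin.Base as Fin using (Fin; toℕ)
open import Data.Fin.Subset as Subset using (Subset; Nonempty; Empty)
open import Data.Fin.Subset.Properties using (nonempty?; _∈?_)
open import Data.Fin.Properties using (all?)
open import Data.List.Base using (List; []; _∷_; _++_; map; filter; length)
open import Data.List.Relation.Unary.All as All using (All)
open import Data.List.Relation.Unary.Any as Any using (Any)
open import Data.List.Relation.Unary.AllPairs as AllPairs using (AllPairs)
open import Data.Nat.Base as ℕ using (ℕ; zero; suc)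
open import Data.Product.Base using (Σ; ∃-syntax; _×_; proj₁)
open import Data.Vec.Base using ([]; _∷_)
open import Data.Vec.Functional using (Vector)
open import Data.Vec.Functional.Relation.Binary.Permutation using (_↭_)
open import Function.Bundles using (Bijection)
open import Level using (Level; _⊔_) renaming (suc to lsuc)
open import Relation.Binary.Bundles using (Setoid)
open import Relation.Binary.Core using (Rel)
import Relation.Binary.Construct.On as On
open import Relation.Binary.PropositionalEquality using (_≡_; setoid)
open import Relation.Binary.Structures using (IsDecTotalOrder)
open import Relation.Nullary.Decidable using (Dec; ¬?; _×-dec_)
open import Relation.Nullary.Negation using (¬_)
open import Relation.Unary using (Pred; _∩_; _≐_)
open import Relation.Unary.Relation.Binary.Equality using (≐-setoid)

------------------------------------------------------------------------
-- Stirling numbers of the second kind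

allSubsets : ∀ a → List (Subset a)
allSubsets zero    = [] ∷ []
allSubsets (suc a) = map (true ∷_) (allSubsets a) ++ map (false ∷_) (allSubsets a)

-- Sublists of length k, by position; they are pairwise distinct when
-- the entries of the list are, so for allSubsets this lists every
-- k-element set of subsets exactly once.
sublists : ∀ {A : Set} → ℕ → List A → List (List A)
sublists zero    _        = [] ∷ []
sublists (suc k) []       = []
sublists (suc k) (x ∷ xs) = map (x ∷_) (sublists k xs) ++ sublists (suc k) xs

IsPartition : ∀ {a} → List (Subset a) → Set
IsPartition {a} blocks =
    All Nonempty blocks
  × AllPairs (λ p q → Empty (p Subset.∩ q)) blocks
  × (∀ (x : Fin a) → Any (x Subset.∈_) blocks)

isPartition? : ∀ {a} (blocks : List (Subset a)) → Dec (IsPartition blocks)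
isPartition? {a} blocks =
        All.all? nonempty? blocks
  ×-dec AllPairs.allPairs? (λ (p q : Subset a) → ¬? (nonempty? (p Subset.∩ q))) blocks
  ×-dec all? (λ x → Any.any? (x ∈?_) blocks)

stirling₂ : ℕ → ℕ → ℕ
stirling₂ a b = length (filter isPartition? (sublists b (allSubsets a)))

------------------------------------------------------------------------
-- Parking functions

record IsParkingFunction {n} (α : Vector ℕ n) : Set where
  field
    range  : ∀ i → 1 ℕ.≤ α i × α i ℕ.≤ n
    -- Fin n counts from 0, so the i-th entry (from 1) sits at i ∸ 1.
    sorted : Σ (Vector ℕ n) λ β → β ↭ α
               × (∀ i j → i Fin.≤ j → β i ℕ.≤ β j)
               × (∀ i → β i ℕ.≤ suc (toℕ i))

------------------------------------------------------------------------
-- The scalars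

-- ℝ is used only through its structure of an ordered field, so the
-- geometry is developed over an arbitrary one.  Order and equality are
-- decidable, as they are for ℝ in classical mathematics.
record OrderedField c ℓ₁ ℓ₂ : Set (lsuc (c ⊔ ℓ₁ ⊔ ℓ₂)) where
  infix 4 _≤_
  field
    commutativeRing : CommutativeRing c ℓ₁
  open CommutativeRing commutativeRing public
    renaming (_+_ to _+ᴷ_; _*_ to _*ᴷ_)
  field
    0≉1             : ¬ (0# ≈ 1#)
    inverse         : ∀ x → ¬ (x ≈ 0#) → ∃[ y ] x *ᴷ y ≈ 1#
    _≤_             : Rel Carrier ℓ₂
    isDecTotalOrder : IsDecTotalOrder _≈_ _≤_
    +-monoʳ-≤       : ∀ z {x y} → x ≤ y → z +ᴷ x ≤ z +ᴷ y
    *-nonneg        : ∀ {x y} → 0# ≤ x → 0# ≤ y → 0# ≤ x *ᴷ y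

------------------------------------------------------------------------
-- Cardinality of a set with an equivalence relation as its equality

HasCardinality : ∀ {a ℓ} → Setoid a ℓ → ℕ → Set (a ⊔ ℓ)
HasCardinality S N = Bijection (setoid (Fin N)) S

------------------------------------------------------------------------
-- Polytopes and their faces

module Geometry {c ℓ₁ ℓ₂} (K : OrderedField c ℓ₁ ℓ₂) where

  open OrderedField K
  open RawMonoidDefs +-rawMonoid public using () renaming (sum to ∑; _×_ to _×ᴷ_)

  Point : ℕ → Set c
  Point n = Vector Carrier n

  _≋_ : ∀ {n} → Rel (Point n) ℓ₁
  x ≋ y = ∀ j → x j ≈ y j

  _·_ : ∀ {n} → Point n → Point n → Carrier
  x · y = ∑ (λ j → x j *ᴷ y j)

  combination : ∀ {n m} → Vector Carrier m → Vector (Point n) m → Point n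
  combination t p j = ∑ (λ i → t i *ᴷ p i j)

  affineHull : ∀ {n s} → Pred (Point n) s → Pred (Point n) (c ⊔ ℓ₁ ⊔ s)
  affineHull {n} S x =
    Σ ℕ λ m → Σ (Vector (Point n) m) λ p → Σ (Vector Carrier m) λ t →
      (∀ i → S (p i)) × ∑ t ≈ 1# × x ≋ combination t p

  convexHull : ∀ {n s} → Pred (Point n) s → Pred (Point n) (c ⊔ ℓ₁ ⊔ ℓ₂ ⊔ s)
  convexHull {n} S x =
    Σ ℕ λ m → Σ (Vector (Point n) m) λ p → Σ (Vector Carrier m) λ t →
      (∀ i → S (p i)) × (∀ i → 0# ≤ t i) × ∑ t ≈ 1# × x ≋ combination t p

  AffinelyIndependent : ∀ {n m} → Vector (Point n) m → Set (c ⊔ ℓ₁)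
  AffinelyIndependent p =
    ∀ t → ∑ t ≈ 0# → combination t p ≋ (λ _ → 0#) → ∀ i → t i ≈ 0#

  Range : ∀ {n m} → Vector (Point n) m → Pred (Point n) ℓ₁
  Range p x = ∃[ i ] x ≋ p i

  -- The affine hull of F has an affine basis of k + 1 points.  The
  -- empty set has no dimension in this sense (it would be -1).
  HasDimension : ∀ {n f} → Pred (Point n) f → ℕ → Set (c ⊔ ℓ₁ ⊔ f)
  HasDimension {n} F k =
    Σ (Vector (Point n) (suc k)) λ b →
      AffinelyIndependent b × affineHull F ≐ affineHull (Range b)

  IsFace : ∀ {n p f} → Pred (Point n) p → Pred (Point n) f →
           Set (c ⊔ ℓ₁ ⊔ ℓ₂ ⊔ p ⊔ f)
  IsFace {n} P F =
    Σ (Point n) λ a → Σ Carrier λ d →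
      (∀ x → P x → a · x ≤ d) × F ≐ (P ∩ (λ x → a · x ≈ d))

  -- Faces are compared as sets of points.
  Faces : ∀ {n p} → Pred (Point n) p → ℕ →
          Setoid (c ⊔ ℓ₁ ⊔ ℓ₂ ⊔ lsuc p) (c ⊔ p)
  Faces {n} {p} P k =
    On.setoid {B = Σ (Pred (Point n) p) λ F → IsFace P F × HasDimension F k}
              (≐-setoid (Point n) p) proj₁

  ParkingPoint : ∀ n → Pred (Point n) ℓ₁
  ParkingPoint n x =
    Σ (Vector ℕ n) λ α → IsParkingFunction α × x ≋ (λ i → α i ×ᴷ 1#)

  parkingPolytope : ∀ n → Pred (Point n) (c ⊔ ℓ₁ ⊔ ℓ₂)
  parkingPolytope n = convexHull (ParkingPoint n)

-- A linear functional a attains its maximum on the parking polytope where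
-- x i = 1 for all i with a i < 0 and where, for every positive value v of a,
-- the sum of the x i with a i ≥ v is as large as it can be: the functional is a
-- combination, with positive coefficients, of these inequalities, and they are
-- simultaneously tight at a greedy parking function.  So a face depends only on the
-- set Z where a is negative, the set R where a vanishes and the ordered partition of
-- the rest into r level sets.  If Z ∪ R is not a singleton, then its codimension
-- is |Z| + r and it determines these data; a singleton Z ∪ R gives the same
-- face as turning it into a lowest level set.  It remains to count: for |Z| = m
-- the data are m chosen coordinates and a partition of the others and an
-- additional element of R into r + 1 blocks, of which r are ordered.

module Submission where

open import Defs
open import Algebra.Properties.Semiring.Sum as Sum using ()
import Algebra.Properties.CommutativeSemigroup as CommutativeSemigroupProperties
import Algebra.Properties.Monoid.Mult as Mult
import Algebra.Properties.Ring as RingProperties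
open import Data.Bool.Base using (true; false; if_then_else_)
open import Data.Fin.Base as Fin using (Fin; zero; suc; toℕ; fromℕ<; punchIn; punchOut)
open import Data.Fin.Permutation as Perm using (Permutation; permutation; _⟨$⟩ʳ_; _⟨$⟩ˡ_; _∘ₚ_)
open import Data.Fin.Properties using
  (toℕ<n; toℕ-injective; toℕ-fromℕ<; any?; punchIn-punchOut; punchOut-injective; injective⇒≤; +↔⊎; *↔×; 0↔⊥; 1↔⊤)
  renaming (_≟_ to _≟F_; suc-injective to sucF-injective)
open import Data.Fin.Subset as Subset using (Subset; Nonempty; Empty)
open import Data.Fin.Subset.Properties using (nonempty?; x∈p∩q⁺; x∈p∩q⁻; ∩-comm; drop-there)
open import Data.List.Base using (List; []; _∷_; _++_; map; filter; upTo; length)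
open import Data.List.Membership.Propositional using (_∈_; find)
open import Data.List.Membership.Propositional.Properties using (∈-filter⁻; ∈-filter⁺; ∈-upTo⁻; ∈-upTo⁺)
open import Data.List.Properties using (map-++; map-∘; map-cong)
open import Data.List.Relation.Binary.Permutation.Propositional using (_↭_; prep; swap; ↭-refl; ↭-sym; ↭-trans; ↭⇒↭ₛ)
import Data.List.Relation.Binary.Permutation.Propositional.Properties as ↭
import Data.List.Relation.Binary.Permutation.Setoid.Properties as ↭ₛ
open import Data.List.Relation.Unary.All as All using (All; []; _∷_)
open import Data.List.Relation.Unary.All.Properties using (map⁺; map⁻; ++⁻ʳ)
open import Data.List.Relation.Unary.AllPairs as AllPairs using (AllPairs; []; _∷_)
import Data.List.Relation.Unary.AllPairs.Properties as AllPairs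
open import Data.List.Relation.Unary.Any as Any using (Any; here; there)
import Data.List.Relation.Unary.Any.Properties as Any
open import Data.List.Relation.Unary.Any.Properties using (∷↔; ⊥↔Any[])
open import Data.List.Relation.Unary.Unique.Propositional using (Unique)
open import Data.List.Relation.Unary.Unique.Propositional.Properties using (upTo⁺; filter⁺)
open import Data.Nat.Base
open import Data.Nat.Combinatorics using (_C_; k>n⇒nCk≡0; nCk+nC[k+1]≡[n+1]C[k+1])
open import Data.Nat.Induction using (<-rec)
open import Data.Nat.ListAction using (sum)
open import Data.Nat.ListAction.Properties using (sum-++)
open import Data.Nat.Properties
open import Data.Nat.Solver using (module +-*-Solver)
open import Data.Product.Base using (_×_; _,_; proj₁; proj₂; ∃-syntax; Σ)
open import Data.Product.Function.NonDependent.Propositional using (_×-↔_)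
open import Data.Sum.Base using (_⊎_; inj₁; inj₂)
open import Data.Sum.Function.Propositional using (_⊎-↔_)
open import Data.Unit.Base using (tt)
open import Data.Vec.Base using ([]; _∷_; here; there)
open import Data.Vec.Functional using (Vector)
open import Function.Base using (_∘_)
open import Function.Bundles using (Inverse; _↔_; mk↔ₛ′)
open import Function.Construct.Composition using (_↔-∘_)
open import Function.Construct.Identity using (↔-id)
open import Function.Definitions using (Injective)
open import Level using (Level)
open import Relation.Binary.Definitions using (Tri; tri<; tri≈; tri>)
open import Relation.Binary.PropositionalEquality
import Relation.Binary.Reasoning.Setoid as SetoidReasoning
open import Relation.Binary.Structures using (IsDecTotalOrder)
open import Relation.Nullary.Decidable using (Dec; yes; no; does; ¬?; _×-dec_)
open import Relation.Nullary.Negation using (¬_; contradiction)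
open import Relation.Unary using (Pred; Decidable; _∩_; _≐_; _⊆_)

-- The singleton case comes from the smallest entry of a parking function, which is always 1. A
-- coordinate of R can be raised from 1 to 2 inside the face exactly when Z ∪ R has a second
-- element, where another entry 1 remains. If Z ∪ R = {i}, then x i = 1 on the whole face, whether a
-- i is zero or negative. Three kinds of parking functions therefore do all the work: the greedy
-- one, the greedy one with a coordinate of R raised, and the greedy one with two values exchanged.
-- They separate distinct words, and they span the affine hull of the face: coordinates in Z are
-- constant, each level equation eliminates one coordinate of its level set, and every other
-- coordinate can be varied on its own. The sum excludes |Z| = 1, whereas the uniqueness argument
-- excludes |Z ∪ R| = 1. Shifting labels by one matches the two families, except for n = 1 and s =
-- 0: there the polytope is a point, without a face of dimension 1, while the sum is 1. This is the
-- case excluded in the formal statement.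

open Sum +-*-semiring using () renaming
  ( sum to ∑ℕ; sum-cong-≗ to ∑ℕ-cong; *-distribˡ-sum to *-distribˡ-∑ℕ
  ; ∑-distrib-+ to ∑ℕ-distrib-+; ∑-comm to ∑ℕ-comm; sum-permute to ∑ℕ-permute )

-- Stirling numbers of the second kind

module SetPartitions where

  open ≡-Reasoning
  open +-*-Solver using (solve; _:+_; _:*_; _:=_; con)

  ind : ∀ {p} {P : Set p} → Dec P → ℕ
  ind d = if does d then 1 else 0

  ind-yes : ∀ {p} {P : Set p} (d : Dec P) → P → ind d ≡ 1
  ind-yes (yes _) _ = refl
  ind-yes (no ¬p) p = contradiction p ¬p

  ind-no : ∀ {p} {P : Set p} (d : Dec P) → ¬ P → ind d ≡ 0
  ind-no (yes p) ¬p = contradiction p ¬p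
  ind-no (no _)  _  = refl

  ind-cong : ∀ {p q} {P : Set p} {Q : Set q} (d : Dec P) (e : Dec Q) →
             (P → Q) → (Q → P) → ind d ≡ ind e
  ind-cong (yes p) e to from = sym (ind-yes e (to p))
  ind-cong (no ¬p) e to from = sym (ind-no e (¬p ∘ from))

  module _ {A : Set} where

    length-filter : ∀ {P : A → Set} (P? : Decidable P) xs →
                    length (filter P? xs) ≡ sum (map (ind ∘ P?) xs)
    length-filter P? []       = refl
    length-filter P? (x ∷ xs) with P? x
    ... | yes _ = cong suc (length-filter P? xs)
    ... | no  _ = length-filter P? xs

    sum-zero : ∀ (f : A → ℕ) → (∀ x → f x ≡ 0) → ∀ xs → sum (map f xs) ≡ 0
    sum-zero f f≡0 []       = refl
    sum-zero f f≡0 (x ∷ xs) = cong₂ _+_ (f≡0 x) (sum-zero f f≡0 xs)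

    sum-map-+ : ∀ (f g : A → ℕ) xs →
                sum (map (λ x → f x + g x) xs) ≡ sum (map f xs) + sum (map g xs)
    sum-map-+ f g []       = refl
    sum-map-+ f g (x ∷ xs) = trans (cong (f x + g x +_) (sum-map-+ f g xs))
      (solve 4 (λ a b c d → (a :+ b) :+ (c :+ d) := (a :+ c) :+ (b :+ d)) refl
         (f x) (g x) (sum (map f xs)) (sum (map g xs)))

    sum-map-* : ∀ (f : A → ℕ) c xs → sum (map (λ x → f x * c) xs) ≡ sum (map f xs) * c
    sum-map-* f c []       = refl
    sum-map-* f c (x ∷ xs) = trans (cong (f x * c +_) (sum-map-* f c xs))
                                   (sym (*-distribʳ-+ c (f x) _))

  module _ {A : Set} where

    sumSublists : (List A → ℕ) → ℕ → List A → ℕ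
    sumSublists f k xs = sum (map f (sublists k xs))

    sumSublists-∷ : ∀ f k x xs → sumSublists f (suc k) (x ∷ xs) ≡
                    sumSublists (f ∘ (x ∷_)) k xs + sumSublists f (suc k) xs
    sumSublists-∷ f k x xs = begin
      sum (map f (map (x ∷_) (sublists k xs) ++ sublists (suc k) xs))
        ≡⟨ cong sum (map-++ f (map (x ∷_) (sublists k xs)) _) ⟩
      sum (map f (map (x ∷_) (sublists k xs)) ++ map f (sublists (suc k) xs))
        ≡⟨ sum-++ (map f (map (x ∷_) (sublists k xs))) _ ⟩
      sum (map f (map (x ∷_) (sublists k xs))) + sumSublists f (suc k) xs
        ≡⟨ cong (λ l → sum l + sumSublists f (suc k) xs) (sym (map-∘ (sublists k xs))) ⟩
      sumSublists (f ∘ (x ∷_)) k xs + sumSublists f (suc k) xs ∎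

    sumSublists-cong : ∀ {f g} → (∀ l → f l ≡ g l) → ∀ k xs →
                       sumSublists f k xs ≡ sumSublists g k xs
    sumSublists-cong f≗g k xs = cong sum (map-cong f≗g (sublists k xs))

    -- Double counting: a (k+1)-element sublist arises from k+1 choices of
    -- a distinguished entry.
    sumSublists-choose : ∀ (f : List A → ℕ) → (∀ {xs ys} → xs ↭ ys → f xs ≡ f ys) →
      (∀ x xs → f (x ∷ x ∷ xs) ≡ 0) → ∀ k xs →
      sum (map (λ x → sumSublists (f ∘ (x ∷_)) k xs) xs) ≡ suc k * sumSublists f (suc k) xs
    sumSublists-choose f f-↭ f-dup k       []       = sym (*-zeroʳ k)
    sumSublists-choose f f-↭ f-dup zero    (y ∷ ys) = begin
      sumSublists (f ∘ (y ∷_)) 0 ys + sum (map (λ x → sumSublists (f ∘ (x ∷_)) 0 ys) ys)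
        ≡⟨ cong (sumSublists (f ∘ (y ∷_)) 0 ys +_) (sumSublists-choose f f-↭ f-dup 0 ys) ⟩
      sumSublists (f ∘ (y ∷_)) 0 ys + 1 * sumSublists f 1 ys
        ≡⟨ cong (sumSublists (f ∘ (y ∷_)) 0 ys +_) (*-identityˡ _) ⟩
      sumSublists (f ∘ (y ∷_)) 0 ys + sumSublists f 1 ys
        ≡⟨ sym (sumSublists-∷ f 0 y ys) ⟩
      sumSublists f 1 (y ∷ ys)
        ≡⟨ sym (*-identityˡ _) ⟩
      1 * sumSublists f 1 (y ∷ ys) ∎
    sumSublists-choose f f-↭ f-dup (suc k) (y ∷ ys) = begin
      sumSublists (f ∘ (y ∷_)) (suc k) (y ∷ ys)
        + sum (map (λ x → sumSublists (f ∘ (x ∷_)) (suc k) (y ∷ ys)) ys)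
        ≡⟨ cong₂ _+_ (sumSublists-∷ (f ∘ (y ∷_)) k y ys)
                     (cong sum (map-cong (λ x → sumSublists-∷ (f ∘ (x ∷_)) k y ys) ys)) ⟩
      sumSublists (f ∘ (y ∷_) ∘ (y ∷_)) k ys + u
        + sum (map (λ x → sumSublists (f ∘ (x ∷_) ∘ (y ∷_)) k ys + sumSublists (f ∘ (x ∷_)) (suc k) ys) ys)
        ≡⟨ cong₂ _+_ (cong (_+ u) (sum-zero _ (f-dup y) (sublists k ys)))
                     (sum-map-+ (λ x → sumSublists (f ∘ (x ∷_) ∘ (y ∷_)) k ys) _ ys) ⟩
      u + (sum (map (λ x → sumSublists (f ∘ (x ∷_) ∘ (y ∷_)) k ys) ys)
           + sum (map (λ x → sumSublists (f ∘ (x ∷_)) (suc k) ys) ys))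
        ≡⟨ cong (u +_) (cong₂ _+_
             (trans (cong sum (map-cong (λ x → sumSublists-cong (λ l → f-↭ (swap x y ↭-refl)) k ys) ys))
                    (sumSublists-choose (f ∘ (y ∷_)) (f-↭ ∘ prep y) dup k ys))
             (sumSublists-choose f f-↭ f-dup (suc k) ys)) ⟩
      u + (suc k * u + suc (suc k) * v)
        ≡⟨ solve 3 (λ c d k′ → c :+ ((con 1 :+ k′) :* c :+ (con 2 :+ k′) :* d)
                               := (con 2 :+ k′) :* (c :+ d)) refl u v k ⟩
      suc (suc k) * (u + v)
        ≡⟨ cong (suc (suc k) *_) (sym (sumSublists-∷ f (suc k) y ys)) ⟩
      suc (suc k) * sumSublists f (suc (suc k)) (y ∷ ys) ∎
      where
      u = sumSublists (f ∘ (y ∷_)) (suc k) ys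
      v = sumSublists f (suc (suc k)) ys
      dup : ∀ x xs → f (y ∷ x ∷ x ∷ xs) ≡ 0
      dup x xs = trans (f-↭ (↭-trans (swap y x ↭-refl) (prep x (swap y x ↭-refl)))) (f-dup x (y ∷ xs))

  module _ {A B : Set} (t : B → A) where

    private
      Vanishing : (List A → ℕ) → Set
      Vanishing f = ∀ x {l₁ l₂} → f (l₁ ++ t x ∷ l₂) ≡ 0

    sumSublists-map : ∀ f k xs → sumSublists f k (map t xs) ≡ sumSublists (f ∘ map t) k xs
    sumSublists-map f zero    xs       = refl
    sumSublists-map f (suc k) []       = refl
    sumSublists-map f (suc k) (x ∷ xs) = begin
      sumSublists f (suc k) (t x ∷ map t xs)
        ≡⟨ sumSublists-∷ f k (t x) (map t xs) ⟩
      sumSublists (f ∘ (t x ∷_)) k (map t xs) + sumSublists f (suc k) (map t xs)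
        ≡⟨ cong₂ _+_ (sumSublists-map (f ∘ (t x ∷_)) k xs) (sumSublists-map f (suc k) xs) ⟩
      sumSublists (f ∘ map t ∘ (x ∷_)) k xs + sumSublists (f ∘ map t) (suc k) xs
        ≡⟨ sym (sumSublists-∷ (f ∘ map t) k x xs) ⟩
      sumSublists (f ∘ map t) (suc k) (x ∷ xs) ∎

    sumSublists-none : ∀ f → Vanishing f → ∀ k xs ys →
                       sumSublists f k (map t xs ++ ys) ≡ sumSublists f k ys
    sumSublists-none f f≡0 zero    xs       ys = refl
    sumSublists-none f f≡0 (suc k) []       ys = refl
    sumSublists-none f f≡0 (suc k) (x ∷ xs) ys = begin
      sumSublists f (suc k) (t x ∷ map t xs ++ ys)
        ≡⟨ sumSublists-∷ f k (t x) (map t xs ++ ys) ⟩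
      sumSublists (f ∘ (t x ∷_)) k (map t xs ++ ys) + sumSublists f (suc k) (map t xs ++ ys)
        ≡⟨ cong₂ _+_ (sum-zero (f ∘ (t x ∷_)) (λ _ → f≡0 x {[]}) (sublists k (map t xs ++ ys)))
                     (sumSublists-none f f≡0 (suc k) xs ys) ⟩
      sumSublists f (suc k) ys ∎

    -- Applied to the blocks that contain `zero`: two of them meet, so a sublist of nonzero weight
    -- has at most one, and it stands first because those subsets come first in `allSubsets`.
    sumSublists-once : ∀ f → (∀ x → Vanishing (f ∘ (t x ∷_))) → ∀ k xs ys →
      sumSublists f (suc k) (map t xs ++ ys) ≡
      sum (map (λ x → sumSublists (f ∘ (t x ∷_)) k ys) xs) + sumSublists f (suc k) ys
    sumSublists-once f f≡0 k []       ys = refl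
    sumSublists-once f f≡0 k (x ∷ xs) ys = begin
      sumSublists f (suc k) (t x ∷ map t xs ++ ys)
        ≡⟨ sumSublists-∷ f k (t x) (map t xs ++ ys) ⟩
      sumSublists (f ∘ (t x ∷_)) k (map t xs ++ ys) + sumSublists f (suc k) (map t xs ++ ys)
        ≡⟨ cong₂ _+_ (sumSublists-none _ (f≡0 x) k xs ys) (sumSublists-once f f≡0 k xs ys) ⟩
      a + (b + c)
        ≡⟨ sym (+-assoc a b c) ⟩
      a + b + c ∎
      where
      a = sumSublists (f ∘ (t x ∷_)) k ys
      b = sum (map (λ x → sumSublists (f ∘ (t x ∷_)) k ys) xs)
      c = sumSublists f (suc k) ys

  Disjoint : ∀ {a} → Subset a → Subset a → Set
  Disjoint p q = Empty (p Subset.∩ q)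

  disjoint-sym : ∀ {a} {p q : Subset a} → Disjoint p q → Disjoint q p
  disjoint-sym {p = p} {q} = subst Empty (∩-comm p q)

  isPartition-↭ : ∀ {a} {xs ys : List (Subset a)} → xs ↭ ys → IsPartition xs → IsPartition ys
  isPartition-↭ xs↭ys (ne , dis , cov) =
    ↭.All-resp-↭ xs↭ys ne ,
    ↭ₛ.AllPairs-resp-↭ (setoid _) disjoint-sym (resp₂ Disjoint) (↭⇒↭ₛ xs↭ys) dis ,
    ↭.Any-resp-↭ xs↭ys ∘ cov

  partitionWeight : ∀ {a} → List (Subset a) → ℕ
  partitionWeight l = ind (isPartition? l)

  partitionWeight-↭ : ∀ {a} {xs ys : List (Subset a)} → xs ↭ ys →
                      partitionWeight xs ≡ partitionWeight ys
  partitionWeight-↭ {xs = xs} {ys} xs↭ys = ind-cong (isPartition? xs) (isPartition? ys)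
    (isPartition-↭ xs↭ys) (isPartition-↭ (↭-sym xs↭ys))

  partitionWeight-duplicate : ∀ {a} (x : Subset a) xs → partitionWeight (x ∷ x ∷ xs) ≡ 0
  partitionWeight-duplicate x xs = ind-no (isPartition? (x ∷ x ∷ xs))
    λ { (((i , i∈x) ∷ _) , ((x∩x ∷ _) ∷ _) , _) → x∩x (i , x∈p∩q⁺ (i∈x , i∈x)) }

  -- Removing zero from the block that contains it either leaves a partition
  -- or empties that block.

  module _ {a} (x : Subset a) (l : List (Subset a)) where

    private
      L : List (Subset (suc a))
      L = (true ∷ x) ∷ map (false ∷_) l

    cons-empty : Empty x → IsPartition l → IsPartition L
    cons-empty e (ne , dis , cov) =
      ((zero , here) ∷ map⁺ (All.map (λ { (i , i∈p) → suc i , there i∈p }) ne)) ,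
      (map⁺ (All.universal (λ p → λ { (suc i , there i∈) → e (i , proj₁ (x∈p∩q⁻ x p i∈)) }) l)
       ∷ AllPairs.map⁺ (AllPairs.map (λ d → λ { (suc i , there i∈) → d (i , i∈) }) dis)) ,
      λ { zero → here here ; (suc i) → there (Any.map⁺ (Any.map there (cov i))) }

    cons-nonempty : IsPartition (x ∷ l) → IsPartition L
    cons-nonempty ((_ ∷ ne) , (dx ∷ dis) , cov) =
      ((zero , here) ∷ map⁺ (All.map (λ { (i , i∈p) → suc i , there i∈p }) ne)) ,
      (map⁺ (All.map (λ d → λ { (suc i , there i∈) → d (i , i∈) }) dx)
       ∷ AllPairs.map⁺ (AllPairs.map (λ d → λ { (suc i , there i∈) → d (i , i∈) }) dis)) ,
      λ { zero → here here
        ; (suc i) → case-cov (cov i) }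
      where
      case-cov : ∀ {i} → Any (i Subset.∈_) (x ∷ l) → Any (suc i Subset.∈_) L
      case-cov (here i∈x) = here (there i∈x)
      case-cov (there i∈) = there (Any.map⁺ (Any.map there i∈))

    uncons : IsPartition L → All Nonempty l × AllPairs Disjoint l × (∀ i → Any (i Subset.∈_) (x ∷ l))
                             × All (Disjoint x) l
    uncons ((_ ∷ ne) , (dx ∷ dis) , cov) =
      All.map (λ { (suc i , there i∈p) → i , i∈p }) (map⁻ ne) ,
      AllPairs.map (λ d → λ { (i , i∈) → d (suc i , there i∈) }) (AllPairs.map⁻ dis) ,
      (λ i → case-cov (cov (suc i))) ,
      All.map (λ d → λ { (i , i∈) → d (suc i , there i∈) }) (map⁻ dx)
      where
      case-cov : ∀ {i} → Any (suc i Subset.∈_) L → Any (i Subset.∈_) (x ∷ l)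
      case-cov (here (there i∈x)) = here i∈x
      case-cov (there i∈) = there (Any.map drop-there (Any.map⁻ i∈))

    partitionWeight-cons : partitionWeight L ≡
      ind (¬? (nonempty? x)) * partitionWeight l + partitionWeight (x ∷ l)
    partitionWeight-cons = go (nonempty? x)
      where
      drop : Empty x → ∀ {i} → Any (i Subset.∈_) (x ∷ l) → Any (i Subset.∈_) l
      drop e (here i∈x) = contradiction (_ , i∈x) e
      drop e (there i∈) = i∈
      go : (d : Dec (Nonempty x)) →
           partitionWeight L ≡ ind (¬? d) * partitionWeight l + partitionWeight (x ∷ l)
      go (yes ne) = ind-cong (isPartition? L) (isPartition? (x ∷ l))
        (λ p → let (nes , dis , cov , dx) = uncons p in ne ∷ nes , dx ∷ dis , cov) cons-nonempty
      go (no e) = begin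
        partitionWeight L
          ≡⟨ ind-cong (isPartition? L) (isPartition? l)
               (λ p → let (nes , dis , cov , dx) = uncons p in nes , dis , drop e ∘ cov) (cons-empty e) ⟩
        partitionWeight l
          ≡⟨ sym (+-identityʳ _) ⟩
        partitionWeight l + 0
          ≡⟨ sym (+-identityʳ _) ⟩
        partitionWeight l + 0 + 0
          ≡⟨ cong (partitionWeight l + 0 +_)
               (sym (ind-no (isPartition? (x ∷ l)) λ { ((ne ∷ _) , _) → e ne })) ⟩
        partitionWeight l + 0 + partitionWeight (x ∷ l) ∎

  count-empty : ∀ a → sum (map (λ x → ind (¬? (nonempty? x))) (allSubsets a)) ≡ 1
  count-empty zero    = refl
  count-empty (suc a) = begin
    sum (map E (map (true ∷_) (allSubsets a) ++ map (false ∷_) (allSubsets a)))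
      ≡⟨ cong sum (map-++ E (map (true ∷_) (allSubsets a)) _) ⟩
    sum (map E (map (true ∷_) (allSubsets a)) ++ map E (map (false ∷_) (allSubsets a)))
      ≡⟨ sum-++ (map E (map (true ∷_) (allSubsets a))) _ ⟩
    sum (map E (map (true ∷_) (allSubsets a))) + sum (map E (map (false ∷_) (allSubsets a)))
      ≡⟨ cong₂ (λ u v → sum u + sum v) (sym (map-∘ (allSubsets a))) (sym (map-∘ (allSubsets a))) ⟩
    sum (map (E ∘ (true ∷_)) (allSubsets a)) + sum (map (E ∘ (false ∷_)) (allSubsets a))
      ≡⟨ cong₂ _+_
           (sum-zero (E ∘ (true ∷_)) (λ x → ind-no (¬? (nonempty? (true ∷ x))) λ e → e (zero , here)) (allSubsets a))
           (cong sum (map-cong (λ x → ind-cong (¬? (nonempty? (false ∷ x))) (¬? (nonempty? x))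
              (λ e → λ { (i , i∈) → e (suc i , there i∈) })
              (λ e → λ { (suc i , there i∈) → e (i , i∈) })) (allSubsets a))) ⟩
    sum (map E (allSubsets a))
      ≡⟨ count-empty a ⟩
    1 ∎
    where
    E : ∀ {a} → Subset a → ℕ
    E x = ind (¬? (nonempty? x))

  stirling₂-sum : ∀ a b → stirling₂ a b ≡ sumSublists partitionWeight b (allSubsets a)
  stirling₂-sum a b = length-filter isPartition? (sublists b (allSubsets a))

  -- Remove `zero` from its block `true ∷ x`. If `x` is empty, a partition into `b` blocks is left.
  -- Otherwise a partition into `suc b` blocks with a marked block `x` is left, and
  -- `sumSublists-choose` turns the mark into the factor `suc b`.
  stirling₂-suc-suc : ∀ a b →
    stirling₂ (suc a) (suc b) ≡ stirling₂ a b + suc b * stirling₂ a (suc b)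
  stirling₂-suc-suc a b = begin
    stirling₂ (suc a) (suc b)
      ≡⟨ stirling₂-sum (suc a) (suc b) ⟩
    sumSublists W (suc b) (map (true ∷_) S ++ map (false ∷_) S)
      ≡⟨ sumSublists-once (true ∷_) W twice b S (map (false ∷_) S) ⟩
    sum (map (λ x → sumSublists (W ∘ ((true ∷ x) ∷_)) b (map (false ∷_) S)) S)
      + sumSublists W (suc b) (map (false ∷_) S)
      ≡⟨ cong₂ _+_
           (cong sum (map-cong (λ x → trans
             (sumSublists-map (false ∷_) (W ∘ ((true ∷ x) ∷_)) b S)
             (sumSublists-cong (partitionWeight-cons x) b S)) S))
           (trans (sumSublists-map (false ∷_) W (suc b) S)
                  (sum-zero (W ∘ map (false ∷_)) uncovered (sublists (suc b) S))) ⟩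
    sum (map (λ x → sumSublists (λ l → ind (¬? (nonempty? x)) * W l + W (x ∷ l)) b S) S) + 0
      ≡⟨ +-identityʳ _ ⟩
    sum (map (λ x → sumSublists (λ l → ind (¬? (nonempty? x)) * W l + W (x ∷ l)) b S) S)
      ≡⟨ cong sum (map-cong (λ x → trans (sum-map-+ _ (W ∘ (x ∷_)) (sublists b S))
           (cong (_+ sumSublists (W ∘ (x ∷_)) b S) (trans
             (sumSublists-cong (λ l → *-comm (ind (¬? (nonempty? x))) (W l)) b S)
             (trans (sum-map-* W _ (sublists b S)) (*-comm _ (ind (¬? (nonempty? x)))))))) S) ⟩
    sum (map (λ x → ind (¬? (nonempty? x)) * sumSublists W b S + sumSublists (W ∘ (x ∷_)) b S) S)
      ≡⟨ sum-map-+ _ (λ x → sumSublists (W ∘ (x ∷_)) b S) S ⟩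
    sum (map (λ x → ind (¬? (nonempty? x)) * sumSublists W b S) S)
      + sum (map (λ x → sumSublists (W ∘ (x ∷_)) b S) S)
      ≡⟨ cong₂ _+_
           (trans (sum-map-* (λ x → ind (¬? (nonempty? x))) _ S)
                  (trans (cong (_* sumSublists W b S) (count-empty a)) (*-identityˡ _)))
           (sumSublists-choose W partitionWeight-↭ partitionWeight-duplicate b S) ⟩
    sumSublists W b S + suc b * sumSublists W (suc b) S
      ≡⟨ sym (cong₂ (λ u v → u + suc b * v) (stirling₂-sum a b) (stirling₂-sum a (suc b))) ⟩
    stirling₂ a b + suc b * stirling₂ a (suc b) ∎
    where
    S = allSubsets a
    W : ∀ {a} → List (Subset a) → ℕ
    W = partitionWeight
    twice : ∀ x y {l₁ l₂} → W ((true ∷ x) ∷ l₁ ++ (true ∷ y) ∷ l₂) ≡ 0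
    twice x y {l₁} {l₂} = ind-no (isPartition? ((true ∷ x) ∷ l₁ ++ (true ∷ y) ∷ l₂))
      λ { (_ , (d ∷ _) , _) → All.head (++⁻ʳ l₁ d) (zero , here) }
    uncovered : ∀ l → W (map (false ∷_) l) ≡ 0
    uncovered l = ind-no (isPartition? (map (false ∷_) l))
      λ { (_ , _ , cov) → case (Any.map⁻ (cov zero)) }
      where
      case : ∀ {l} → ¬ Any (λ x → zero Subset.∈ (false ∷ x)) l
      case (here ())
      case (there z) = case z

  stirling₂-zero-suc : ∀ b → stirling₂ 0 (suc b) ≡ 0
  stirling₂-zero-suc zero    = refl
  stirling₂-zero-suc (suc b) = refl

  stirling₂-suc-zero : ∀ a → stirling₂ (suc a) 0 ≡ 0
  stirling₂-suc-zero a = refl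

open SetPartitions

-- Words and their number

count : ∀ {n p} {P : Pred (Fin n) p} → Decidable P → ℕ
count P? = ∑ℕ (λ i → ind (P? i))

count-cong : ∀ {n p q} {P : Pred (Fin n) p} {Q : Pred (Fin n) q}
             (P? : Decidable P) (Q? : Decidable Q) →
             (∀ i → P i → Q i) → (∀ i → Q i → P i) → count P? ≡ count Q?
count-cong P? Q? to from = ∑ℕ-cong (λ i → ind-cong (P? i) (Q? i) (to i) (from i))

-- A vector of labels describes a functional: label 0 stands for negative
-- coefficients, label 1 for zero, and labels 2, …, r + 1 for the
-- positive values in increasing order.
record IsWord {n} (m r : ℕ) (w : Vector ℕ n) : Set where
  field
    bounded : ∀ i → w i ≤ suc r
    hits    : ∀ j → j < r → ∃[ i ] w i ≡ 2 + j
    zeros   : count (λ i → w i ≟ 0) ≡ m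

open IsWord public

-- Makes room for a letter that forms a level set of its own: the label `2 + j` becomes vacant.
raise : ℕ → ℕ → ℕ
raise j x with x ≤? suc j
... | yes _ = x
... | no  _ = suc x

raise-≤ : ∀ {j x} → x ≤ suc j → raise j x ≡ x
raise-≤ {j} {x} x≤ with x ≤? suc j
... | yes _ = refl
... | no x≰ = contradiction x≤ x≰

raise-> : ∀ {j x} → suc j < x → raise j x ≡ suc x
raise-> {j} {x} x> with x ≤? suc j
... | yes x≤ = contradiction x≤ (<⇒≱ x>)
... | no  _  = refl

raise-≢ : ∀ j x → raise j x ≢ 2 + j
raise-≢ j x eq with x ≤? suc j
... | yes x≤ = <-irrefl eq (s≤s x≤)
... | no x≰  = x≰ (≤-reflexive (suc-injective eq))

raise-injective : ∀ j {x y} → raise j x ≡ raise j y → x ≡ y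
raise-injective j {x} {y} eq with x ≤? suc j | y ≤? suc j
... | yes _  | yes _  = eq
... | yes x≤ | no y≰  = contradiction (≤-trans (n≤1+n y) (subst (_≤ suc j) eq x≤)) y≰
... | no x≰  | yes y≤ = contradiction (≤-trans (n≤1+n x) (subst (_≤ suc j) (sym eq) y≤)) x≰
... | no _   | no _   = suc-injective eq

raise-bound : ∀ j {x b} → x ≤ b → raise j x ≤ suc b
raise-bound j {x} x≤b with x ≤? suc j
... | yes _ = m≤n⇒m≤1+n x≤b
... | no  _ = s≤s x≤b

raise-zero : ∀ j {x} → raise j x ≡ 0 → x ≡ 0
raise-zero j {x} eq with x ≤? suc j
... | yes _ = eq
raise-zero j {x} () | no _

lower : ℕ → ℕ → ℕ
lower j x with x ≤? suc j
... | yes _ = x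
... | no  _ = pred x

raise-lower : ∀ j {x} → x ≢ 2 + j → raise j (lower j x) ≡ x
raise-lower j {x} x≢ with x ≤? suc j
... | yes x≤ = raise-≤ x≤
raise-lower j {zero}  x≢ | no x≰ = contradiction z≤n x≰
raise-lower j {suc x} x≢ | no x≰ = raise-> (≤∧≢⇒< (≤-pred (≰⇒> x≰)) (λ eq → x≢ (cong suc (sym eq))))

-- Words by their first letter. Each word has exactly one code, so the number of words satisfies a
-- recurrence with one summand per constructor.
data Code : ℕ → ℕ → ℕ → Set where
  nil : Code 0 0 0
  neg : ∀ {n m r} → Code n m r → Code (suc n) (suc m) r
  -- The first letter is 1 + j; if positive it also occurs later.
  old : ∀ {n m r} → Fin (suc r) → Code n m r → Code (suc n) m r
  -- The first letter is 2 + j and does not occur again.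
  new : ∀ {n m r} → Fin (suc r) → Code n m r → Code (suc n) m (suc r)

decode : ∀ {n m r} → Code n m r → Vector ℕ n
decode (neg c)   zero    = 0
decode (neg c)   (suc i) = decode c i
decode (old j c) zero    = suc (toℕ j)
decode (old j c) (suc i) = decode c i
decode (new j c) zero    = 2 + toℕ j
decode (new j c) (suc i) = raise (toℕ j) (decode c i)

decode-isWord : ∀ {n m r} (c : Code n m r) → IsWord m r (decode c)
decode-isWord nil = record { bounded = λ () ; hits = λ _ () ; zeros = refl }
decode-isWord (neg c) = record
  { bounded = λ { zero → z≤n ; (suc i) → bounded w i }
  ; hits    = λ j j<r → let (i , eq) = hits w j j<r in suc i , eq
  ; zeros   = cong suc (zeros w)
  } where w = decode-isWord c
decode-isWord (old j c) = record
  { bounded = λ { zero → toℕ<n j ; (suc i) → bounded w i }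
  ; hits    = λ j j<r → let (i , eq) = hits w j j<r in suc i , eq
  ; zeros   = zeros w
  } where w = decode-isWord c
decode-isWord {r = suc r} (new j c) = record
  { bounded = λ { zero → s≤s (toℕ<n j) ; (suc i) → raise-bound (toℕ j) (bounded w i) }
  ; hits    = hit
  ; zeros   = trans (count-cong (λ i → raise (toℕ j) (decode c i) ≟ 0) (λ i → decode c i ≟ 0)
                      (λ i → raise-zero (toℕ j) {decode c i})
                      (λ i eq → cong (raise (toℕ j)) eq))
                    (zeros w)
  }
  where
  w = decode-isWord c
  hit : ∀ k → k < suc r → ∃[ i ] decode (new j c) i ≡ 2 + k
  hit k k<r with <-cmp k (toℕ j)
  ... | tri≈ _ eq _ = zero , cong (2 +_) (sym eq)
  ... | tri< k<j _ _ =
    let (i , eq) = hits w k (<-≤-trans k<j (≤-pred (toℕ<n j))) in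
    suc i , trans (cong (raise (toℕ j)) eq) (raise-≤ (s≤s k<j))
  hit (suc k) k<r | tri> _ _ j<k =
    let (i , eq) = hits w k (≤-pred k<r) in
    suc i , trans (cong (raise (toℕ j)) eq) (raise-> (s≤s j<k))

decode-injective : ∀ {n m r} (c d : Code n m r) → decode c ≗ decode d → c ≡ d
decode-injective nil       nil       eq = refl
decode-injective (neg c)   (neg d)   eq = cong neg (decode-injective c d (eq ∘ suc))
decode-injective (neg c)   (old k d) eq = contradiction (eq zero) λ ()
decode-injective (neg c)   (new k d) eq = contradiction (eq zero) λ ()
decode-injective (old j c) (neg d)   eq = contradiction (eq zero) λ ()
decode-injective (old j c) (old k d) eq =
  cong₂ old (toℕ-injective (suc-injective (eq zero))) (decode-injective c d (eq ∘ suc))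
decode-injective (old j c) (new k d) eq =
  -- After an `old` letter the tail still attains every level, hence also `2 + toℕ k`, the one label
  -- that `raise (toℕ k)` avoids.
  let (i , ci) = hits (decode-isWord c) (toℕ k) (toℕ<n k) in
  contradiction (trans (sym (eq (suc i))) ci) (raise-≢ (toℕ k) (decode d i))
decode-injective (new j c) (neg d)   eq = contradiction (eq zero) λ ()
decode-injective (new j c) (old k d) eq =
  let (i , di) = hits (decode-isWord d) (toℕ j) (toℕ<n j) in
  contradiction (trans (eq (suc i)) di) (raise-≢ (toℕ j) (decode c i))
decode-injective (new j c) (new k d) eq with toℕ-injective (suc-injective (suc-injective (eq zero)))
... | refl = cong (new j) (decode-injective c d (raise-injective (toℕ j) ∘ eq ∘ suc))

encode : ∀ {n m r} (w : Vector ℕ n) → IsWord m r w → ∃[ c ] decode {n} {m} {r} c ≗ w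
encode {zero} {r = zero}  w record { zeros = refl } = nil , λ ()
encode {zero} {r = suc r} w W with () ← proj₁ (hits W 0 z<s)
encode {suc n} w W = head (w zero) refl W
  where
  w′ : Vector ℕ n
  w′ = w ∘ suc

  zeros′ : ∀ {m r x} → w zero ≡ x → IsWord m r w → ind (x ≟ 0) + count (λ i → w′ i ≟ 0) ≡ m
  zeros′ refl W = zeros W

  tailWord : ∀ {m r m′} → IsWord m r w → (∀ j → w zero ≡ 2 + j → ∃[ i ] w′ i ≡ 2 + j) →
             count (λ i → w′ i ≟ 0) ≡ m′ → IsWord m′ r w′
  tailWord {r = r} W again z = record
    { bounded = bounded W ∘ suc
    ; hits    = λ j j<r → relocate j (hits W j j<r)
    ; zeros   = z
    } where
    relocate : ∀ j → ∃[ i ] w i ≡ 2 + j → ∃[ i ] w′ i ≡ 2 + j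
    relocate j (zero  , eq) = again j eq
    relocate j (suc i , eq) = i , eq

  head : ∀ {m r} x → w zero ≡ x → IsWord m r w → ∃[ c ] decode {suc n} {m} {r} c ≗ w
  head zero eq W with zeros′ eq W
  ... | refl =
    let (c , ceq) = encode w′ (tailWord W (λ { j e → contradiction (trans (sym eq) e) λ () }) refl) in
    neg c , λ { zero → sym eq ; (suc i) → ceq i }
  head (suc zero) eq W =
    let (c , ceq) = encode w′ (tailWord W (λ { j e → contradiction (trans (sym eq) e) λ () }) (zeros′ eq W)) in
    old zero c , λ { zero → sym eq ; (suc i) → ceq i }
  head {m} {r} (suc (suc j)) eq W =
    -- Whether the first label recurs decides between `old` and `new`.
    body (any? (λ i → w′ i ≟ 2 + j)) W (≤-pred (subst (_≤ suc r) eq (bounded W zero)))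
    where
    body : ∀ {r} → Dec (∃[ i ] w′ i ≡ 2 + j) → IsWord m r w → j < r →
           ∃[ c ] decode {suc n} {m} {r} c ≗ w
    body (yes (i , w′i)) W j<r =
      let (c , ceq) = encode w′ (tailWord W (λ k e → i , trans w′i (trans (sym eq) e)) (zeros′ eq W)) in
      old (fromℕ< (s≤s j<r)) c ,
      λ { zero → trans (cong suc (toℕ-fromℕ< (s≤s j<r))) (sym eq) ; (suc i) → ceq i }
    -- The tail lacks the label `2 + j`; `lower` closes this gap and leaves a word with one level
    -- less.
    body {suc r} (no absent) W j<r =
      let (c , ceq) = encode w″ word″ in
      new (fromℕ< j<r) c ,
      λ { zero    → trans (cong (2 +_) (toℕ-fromℕ< j<r)) (sym eq)
        ; (suc i) → trans (cong₂ raise (toℕ-fromℕ< j<r) (ceq i)) (rl i) }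
      where
      w″ : Vector ℕ n
      w″ i = lower j (w′ i)
      rl : ∀ i → raise j (w″ i) ≡ w′ i
      rl i = raise-lower j (λ e → absent (i , e))
      lower-bound : ∀ {x} → x ≤ suc (suc r) → lower j x ≤ suc r
      lower-bound {x} x≤ with x ≤? suc j
      ... | yes x≤j = ≤-trans x≤j j<r
      ... | no  _   = pred-mono-≤ x≤
      hit : ∀ k → k < r → ∃[ i ] w″ i ≡ 2 + k
      hit k k<r with k <? j
      ... | yes k<j = below (hits W k (m<n⇒m<1+n k<r))
        where
        below : ∃[ i ] w i ≡ 2 + k → ∃[ i ] w″ i ≡ 2 + k
        below (zero  , e) = contradiction (suc-injective (suc-injective (trans (sym e) eq))) (<⇒≢ k<j)
        below (suc i , e) = i , raise-injective j (trans (rl i) (trans e (sym (raise-≤ (s≤s k<j)))))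
      ... | no k≮j = above (hits W (suc k) (s≤s k<r))
        where
        above : ∃[ i ] w i ≡ 3 + k → ∃[ i ] w″ i ≡ 2 + k
        above (zero  , e) =
          contradiction (suc-injective (suc-injective (trans (sym eq) e))) (<⇒≢ (s≤s (≮⇒≥ k≮j)))
        above (suc i , e) =
          i , raise-injective j (trans (rl i) (trans e (sym (raise-> (s≤s (s≤s (≮⇒≥ k≮j)))))))
      word″ : IsWord m r w″
      word″ = record
        { bounded = λ i → lower-bound (bounded W (suc i))
        ; hits    = hit
        ; zeros   = trans (count-cong (λ i → w″ i ≟ 0) (λ i → w′ i ≟ 0)
                       (λ i e → trans (sym (rl i)) (cong (raise j) e))
                       (λ i e → raise-zero j (trans (rl i) e))) (zeros′ eq W)
        }

-- One summand per constructor of `Code`; the two helpers supply 0 where `m` or `r` has no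
-- predecessor.
card : ℕ → ℕ → ℕ → ℕ
cardNeg : ℕ → ℕ → ℕ → ℕ
cardNew : ℕ → ℕ → ℕ → ℕ
card zero    zero    zero    = 1
card zero    zero    (suc r) = 0
card zero    (suc m) r       = 0
card (suc n) m       r       = cardNeg n m r + (suc r * card n m r + cardNew n m r)
cardNeg n zero    r = 0
cardNeg n (suc m) r = card n m r
cardNew n m zero    = 0
cardNew n m (suc r) = suc r * card n m r

Fin↔Code : ∀ n m r → Fin (card n m r) ↔ Code n m r
Fin↔Code zero zero zero =
  mk↔ₛ′ (λ _ → nil) (λ { nil → tt }) (λ { nil → refl }) (λ _ → refl) ↔-∘ 1↔⊤
Fin↔Code zero zero (suc r) = mk↔ₛ′ (λ ()) (λ ()) (λ ()) (λ ()) ↔-∘ 0↔⊥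
Fin↔Code zero (suc m) r = mk↔ₛ′ (λ ()) (λ ()) (λ ()) (λ ()) ↔-∘ 0↔⊥
Fin↔Code (suc n) m r =
  mk↔ₛ′ to from to-from from-to
    ↔-∘ ((neg↔ m ⊎-↔ (((↔-id _ ×-↔ Fin↔Code n m r) ↔-∘ *↔×) ⊎-↔ new↔ r))
    ↔-∘ ((↔-id _ ⊎-↔ +↔⊎) ↔-∘ +↔⊎))
  where
  -- `Neg` and `New` absorb the case distinctions on `m` and `r`, so that the translation to `Code`
  -- is uniform in both.
  data Neg : ℕ → Set where
    neg : ∀ {m} → Code n m r → Neg (suc m)
  data New : ℕ → Set where
    new : ∀ {r} → Fin (suc r) × Code n m r → New (suc r)
  neg↔ : ∀ m → Fin (cardNeg n m r) ↔ Neg m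
  neg↔ zero    = mk↔ₛ′ (λ ()) (λ ()) (λ ()) (λ ())
  neg↔ (suc m) = mk↔ₛ′ neg (λ { (neg c) → c }) (λ { (neg c) → refl }) (λ _ → refl) ↔-∘ Fin↔Code n m r
  new↔ : ∀ r → Fin (cardNew n m r) ↔ New r
  new↔ zero    = mk↔ₛ′ (λ ()) (λ ()) (λ ()) (λ ())
  new↔ (suc r) = mk↔ₛ′ new (λ { (new c) → c }) (λ { (new c) → refl }) (λ _ → refl)
                 ↔-∘ ((↔-id _ ×-↔ Fin↔Code n m r) ↔-∘ *↔×)
  to : Neg m ⊎ (Fin (suc r) × Code n m r ⊎ New r) → Code (suc n) m r
  to (inj₁ (neg c)) = neg c
  to (inj₂ (inj₁ (j , c))) = old j c
  to (inj₂ (inj₂ (new (j , c)))) = new j c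
  from : Code (suc n) m r → Neg m ⊎ (Fin (suc r) × Code n m r ⊎ New r)
  from (neg c) = inj₁ (neg c)
  from (old j c) = inj₂ (inj₁ (j , c))
  from (new j c) = inj₂ (inj₂ (new (j , c)))
  to-from : ∀ c → to (from c) ≡ c
  to-from (neg c) = refl
  to-from (old j c) = refl
  to-from (new j c) = refl
  from-to : ∀ c → from (to c) ≡ c
  from-to (inj₁ (neg c)) = refl
  from-to (inj₂ (inj₁ (j , c))) = refl
  from-to (inj₂ (inj₂ (new (j , c)))) = refl

-- Opaque, since the enumeration of partitions would otherwise be unfolded
-- during conversion checking.
opaque

  S₂ : ℕ → ℕ → ℕ
  S₂ = stirling₂

  S₂-stirling₂ : ∀ a b → S₂ a b ≡ stirling₂ a b
  S₂-stirling₂ a b = refl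

  S₂-suc-suc : ∀ a b → S₂ (suc a) (suc b) ≡ S₂ a b + suc b * S₂ a (suc b)
  S₂-suc-suc = stirling₂-suc-suc

  S₂-zero-suc : ∀ b → S₂ 0 (suc b) ≡ 0
  S₂-zero-suc = stirling₂-zero-suc

  S₂-suc-zero : ∀ a → S₂ (suc a) 0 ≡ 0
  S₂-suc-zero = stirling₂-suc-zero

  S₂-zero-zero : S₂ 0 0 ≡ 1
  S₂-zero-zero = refl

-- The number of words of length n without label 0 and with highest label r + 1.
surjections : ℕ → ℕ → ℕ
surjections n r = r ! * S₂ (n + 1) (r + 1)

surjectionsNew : ℕ → ℕ → ℕ
surjectionsNew n zero    = 0
surjectionsNew n (suc r) = suc r * surjections n r

surjections-zero : ∀ r → surjections 0 (suc r) ≡ 0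
surjections-zero r = begin
  suc r ! * S₂ 1 (suc (r + 1))
    ≡⟨ cong (λ k → suc r ! * S₂ 1 (suc k)) (+-comm r 1) ⟩
  suc r ! * S₂ 1 (suc (suc r))
    ≡⟨ cong (suc r ! *_) (trans (S₂-suc-suc 0 (suc r))
         (cong₂ (λ u v → u + suc (suc r) * v) (S₂-zero-suc r) (S₂-zero-suc (suc r)))) ⟩
  suc r ! * (suc (suc r) * 0)
    ≡⟨ cong (suc r ! *_) (*-zeroʳ (suc (suc r))) ⟩
  suc r ! * 0
    ≡⟨ *-zeroʳ (suc r !) ⟩
  0 ∎
  where open ≡-Reasoning

-- This is the Stirling recurrence multiplied by `r !`; in its first term, the largest factor of the
-- factorial is split off.
surjections-suc : ∀ n r →
  surjections (suc n) r ≡ suc r * surjections n r + surjectionsNew n r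
surjections-suc n zero = begin
  1 * S₂ (suc (n + 1)) 1
    ≡⟨ cong (1 *_) (S₂-suc-suc (n + 1) 0) ⟩
  1 * (S₂ (n + 1) 0 + 1 * S₂ (n + 1) 1)
    ≡⟨ cong (λ z → 1 * (z + 1 * S₂ (n + 1) 1)) (trans (cong (λ k → S₂ k 0) (+-comm n 1)) (S₂-suc-zero n)) ⟩
  1 * (1 * S₂ (n + 1) 1)
    ≡⟨ sym (+-identityʳ _) ⟩
  1 * (1 * S₂ (n + 1) 1) + 0 ∎
  where open ≡-Reasoning
surjections-suc n (suc r) = begin
  suc r ! * S₂ (suc (n + 1)) (suc (r + 1))
    ≡⟨ cong (suc r ! *_) (S₂-suc-suc (n + 1) (r + 1)) ⟩
  suc r ! * (x + suc (r + 1) * y)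
    ≡⟨ cong (λ k → suc r ! * (x + suc k * y)) (+-comm r 1) ⟩
  suc r ! * (x + suc (suc r) * y)
    ≡⟨ solve 4 (λ k f x y → ((con 1 :+ k) :* f) :* (x :+ (con 2 :+ k) :* y)
         := (con 2 :+ k) :* (((con 1 :+ k) :* f) :* y) :+ (con 1 :+ k) :* (f :* x)) refl r (r !) x y ⟩
  suc (suc r) * (suc r ! * y) + suc r * (r ! * x) ∎
  where
  open ≡-Reasoning
  open +-*-Solver
  x = S₂ (n + 1) (r + 1)
  y = S₂ (n + 1) (suc (r + 1))

S₂-one-one : S₂ 1 1 ≡ 1
S₂-one-one = trans (S₂-suc-suc 0 0) (cong₂ (λ u v → u + 1 * v) S₂-zero-zero (S₂-zero-suc 0))

-- Pascal's rule accounts for the places of the letters 0; the remaining letters follow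
-- `surjections-suc`.
card-formula : ∀ n m r → card n m r ≡ (n C m) * surjections (n ∸ m) r
cardNew-formula : ∀ n m r → cardNew n m r ≡ (n C m) * surjectionsNew (n ∸ m) r

card-formula zero zero    zero    = sym (cong (λ x → 1 * (1 * x)) S₂-one-one)
card-formula zero zero    (suc r) = sym (trans (+-identityʳ _) (surjections-zero r))
card-formula zero (suc m) r       = refl
card-formula (suc n) zero r = begin
  suc r * card n 0 r + cardNew n 0 r
    ≡⟨ cong₂ (λ u v → suc r * u + v) (card-formula n 0 r) (cardNew-formula n 0 r) ⟩
  suc r * (1 * surjections n r) + 1 * surjectionsNew n r
    ≡⟨ cong₂ (λ u v → suc r * u + v) (*-identityˡ (surjections n r)) (*-identityˡ (surjectionsNew n r)) ⟩
  suc r * surjections n r + surjectionsNew n r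
    ≡⟨ sym (surjections-suc n r) ⟩
  surjections (suc n) r
    ≡⟨ sym (*-identityˡ _) ⟩
  1 * surjections (suc n) r ∎
  where open ≡-Reasoning
card-formula (suc n) (suc m) r = begin
  card n m r + (suc r * card n (suc m) r + cardNew n (suc m) r)
    ≡⟨ cong₂ _+_ (card-formula n m r)
         (cong₂ (λ u v → suc r * u + v) (card-formula n (suc m) r) (cardNew-formula n (suc m) r)) ⟩
  (n C m) * f (n ∸ m) + (suc r * ((n C suc m) * f (n ∸ suc m)) + (n C suc m) * surjectionsNew (n ∸ suc m) r)
    ≡⟨ cong ((n C m) * f (n ∸ m) +_) (solve 4 (λ k c u v → k :* (c :* u) :+ c :* v := c :* (k :* u :+ v)) refl
         (suc r) (n C suc m) (f (n ∸ suc m)) (surjectionsNew (n ∸ suc m) r)) ⟩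
  (n C m) * f (n ∸ m) + (n C suc m) * (suc r * f (n ∸ suc m) + surjectionsNew (n ∸ suc m) r)
    ≡⟨ cong (λ z → (n C m) * f (n ∸ m) + (n C suc m) * z) (sym (surjections-suc (n ∸ suc m) r)) ⟩
  (n C m) * f (n ∸ m) + (n C suc m) * f (suc (n ∸ suc m))
    ≡⟨ cong ((n C m) * f (n ∸ m) +_) (last (suc m ≤? n)) ⟩
  (n C m) * f (n ∸ m) + (n C suc m) * f (n ∸ m)
    ≡⟨ sym (*-distribʳ-+ (f (n ∸ m)) (n C m) (n C suc m)) ⟩
  (n C m + n C suc m) * f (n ∸ m)
    ≡⟨ cong (_* f (n ∸ m)) (nCk+nC[k+1]≡[n+1]C[k+1] n m) ⟩
  (suc n C suc m) * f (n ∸ m) ∎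
  where
  open ≡-Reasoning
  open +-*-Solver
  f : ℕ → ℕ
  f k = surjections k r
  -- Subtraction is truncated, so the two arguments of `f` agree only for `m < n`; otherwise the
  -- binomial coefficient is 0.
  last : Dec (suc m ≤ n) → (n C suc m) * f (suc (n ∸ suc m)) ≡ (n C suc m) * f (n ∸ m)
  last (yes m<n) = cong (λ k → (n C suc m) * f k) (sym (+-∸-assoc 1 m<n))
  last (no  m≮n) = trans (cong (_* f (suc (n ∸ suc m))) C≡0) (cong (_* f (n ∸ m)) (sym C≡0))
    where
    C≡0 : n C suc m ≡ 0
    C≡0 = k>n⇒nCk≡0 (≰⇒> m≮n)
cardNew-formula n m zero    = sym (*-zeroʳ (n C m))
cardNew-formula n m (suc r) = begin
  suc r * card n m r                             ≡⟨ cong (suc r *_) (card-formula n m r) ⟩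
  suc r * ((n C m) * surjections (n ∸ m) r)        ≡⟨ solve 3 (λ a b c → a :* (b :* c) := b :* (a :* c)) refl (suc r) (n C m) _ ⟩
  (n C m) * (suc r * surjections (n ∸ m) r)        ∎
  where
  open ≡-Reasoning
  open +-*-Solver

-- `Any P xs` is the disjoint union of the `P x` over the positions of `xs`, so its cardinality is a
-- sum over the list.
Fin↔Any : ∀ {A : Set} {P : A → Set} (f : A → ℕ) → (∀ x → Fin (f x) ↔ P x) →
          ∀ xs → Fin (sum (map f xs)) ↔ Any P xs
Fin↔Any         f e []       = ⊥↔Any[] ↔-∘ 0↔⊥
Fin↔Any {P = P} f e (x ∷ xs) = ∷↔ P ↔-∘ ((e x ⊎-↔ Fin↔Any f e xs) ↔-∘ +↔⊎)

Fin↔Codes : ∀ n s xs →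
  Fin (sum (map (λ m → (n C m) * (s ∸ m) ! * stirling₂ (n ∸ m + 1) (s ∸ m + 1)) xs)) ↔
  Any (λ m → Code n m (s ∸ m)) xs
Fin↔Codes n s = Fin↔Any _ λ m →
  subst (λ k → Fin k ↔ Code n m (s ∸ m))
    (trans (card-formula n m (s ∸ m)) (trans (sym (*-assoc (n C m) ((s ∸ m) !) _))
      (cong ((n C m) * (s ∸ m) ! *_) (S₂-stirling₂ (n ∸ m + 1) (s ∸ m + 1)))))
    (Fin↔Code n m (s ∸ m))

-- Ranks and parking functions

ind≤1 : ∀ {p} {P : Set p} (d : Dec P) → ind d ≤ 1
ind≤1 (yes _) = ≤-refl
ind≤1 (no  _) = z≤n

ind-mono : ∀ {p q} {P : Set p} {Q : Set q} (d : Dec P) (e : Dec Q) → (P → Q) → ind d ≤ ind e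
ind-mono (yes p) e P⇒Q = ≤-reflexive (sym (ind-yes e (P⇒Q p)))
ind-mono (no ¬p) e P⇒Q = z≤n

ind-*-cong : ∀ {p} {P : Set p} (d : Dec P) {x y} → (P → x ≡ y) → ind d * x ≡ ind d * y
ind-*-cong (yes p) x≡y = cong (1 *_) (x≡y p)
ind-*-cong (no _)  x≡y = refl

ind-¬ : ∀ {p} {P : Set p} (d : Dec P) → ind d + ind (¬? d) ≡ 1
ind-¬ (yes _) = refl
ind-¬ (no _)  = refl

∑ℕ-mono : ∀ {n} {f g : Fin n → ℕ} → (∀ i → f i ≤ g i) → ∑ℕ f ≤ ∑ℕ g
∑ℕ-mono {zero}  f≤g = z≤n
∑ℕ-mono {suc n} f≤g = +-mono-≤ (f≤g zero) (∑ℕ-mono (f≤g ∘ suc))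

∑ℕ-mono-< : ∀ {n} {f g : Fin n → ℕ} → (∀ i → f i ≤ g i) → ∀ i → f i < g i → ∑ℕ f < ∑ℕ g
∑ℕ-mono-< f≤g zero    f<g = +-mono-<-≤ f<g (∑ℕ-mono (f≤g ∘ suc))
∑ℕ-mono-< f≤g (suc i) f<g = +-mono-≤-< (f≤g zero) (∑ℕ-mono-< (f≤g ∘ suc) i f<g)

∑ℕ-ones : ∀ n → ∑ℕ {n} (λ _ → 1) ≡ n
∑ℕ-ones zero    = refl
∑ℕ-ones (suc n) = cong suc (∑ℕ-ones n)

module _ {n p q} {P : Pred (Fin n) p} {Q : Pred (Fin n) q} (P? : Decidable P) (Q? : Decidable Q) where

  count-mono : (∀ i → P i → Q i) → count P? ≤ count Q?
  count-mono P⇒Q = ∑ℕ-mono (λ i → ind-mono (P? i) (Q? i) (P⇒Q i))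

  count-mono-< : (∀ i → P i → Q i) → ∀ i → ¬ P i → Q i → count P? < count Q?
  count-mono-< P⇒Q i ¬Pi Qi = ∑ℕ-mono-< (λ i → ind-mono (P? i) (Q? i) (P⇒Q i)) i
    (≤-reflexive (trans (cong suc (ind-no (P? i) ¬Pi)) (sym (ind-yes (Q? i) Qi))))

module _ {n p} {P : Pred (Fin n) p} (P? : Decidable P) where

  count<n : ∀ i → ¬ P i → count P? < n
  count<n i ¬Pi = subst (count P? <_) (∑ℕ-ones n)
    (∑ℕ-mono-< (λ i → ind≤1 (P? i)) i (s≤s (≤-reflexive (ind-no (P? i) ¬Pi))))

  count>0 : ∀ i → P i → 0 < count P?
  count>0 i Pi = ≤-<-trans z≤n (∑ℕ-mono-< {f = λ _ → 0} (λ _ → z≤n) i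
    (≤-reflexive (sym (ind-yes (P? i) Pi))))

  count≡0 : (∀ i → ¬ P i) → count P? ≡ 0
  count≡0 ¬P = n≤0⇒n≡0 (≮⇒≥ λ pos → empty P? ¬P pos)
    where
    empty : ∀ {n} {P : Pred (Fin n) p} (P? : Decidable P) → (∀ i → ¬ P i) → ¬ 0 < count P?
    empty {zero}  P? ¬P ()
    empty {suc n} P? ¬P pos with P? zero
    ... | yes Pz = ¬P zero Pz
    ... | no  _  = empty (P? ∘ suc) (¬P ∘ suc) pos

count-≡ : ∀ {n} (k : Fin n) → count (_≟F k) ≡ 1
count-≡ {suc n} zero = cong suc (count≡0 (λ (i : Fin n) → suc i ≟F zero) λ _ ())
count-≡ {suc n} (suc k) = trans
  (count-cong (λ (i : Fin n) → suc i ≟F suc k) (_≟F k) (λ { _ refl → refl }) (λ { _ refl → refl }))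
  (count-≡ k)

count≢1 : ∀ {n p} {P : Pred (Fin n) p} (P? : Decidable P) → count P? ≢ 1 →
          ∀ k → P k → ∃[ i ] i ≢ k × P i
count≢1 P? ≢1 k Pk with any? (λ i → ¬? (i ≟F k) ×-dec P? i)
... | yes other = other
... | no  none  = contradiction
  (trans (count-cong P? (_≟F k) (λ i Pi → only i Pi (i ≟F k)) (λ { _ refl → Pk })) (count-≡ k)) ≢1
  where
  only : ∀ i → _ → Dec (i ≡ k) → i ≡ k
  only i Pi (yes i≡k) = i≡k
  only i Pi (no i≢k)  = contradiction (i , i≢k , Pi) none

injective⇒permutation : ∀ {n} (f : Fin n → Fin n) → Injective _≡_ _≡_ f →
                        ∃[ π ] ∀ i → Perm._⟨$⟩ʳ_ {n} {n} π i ≡ f i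
injective⇒permutation {n} f f-inj =
  permutation f (proj₁ ∘ preimage f f-inj)
    (λ k → proj₂ (preimage f f-inj k)) (λ i → f-inj (proj₂ (preimage f f-inj (f i)))) ,
  λ i → refl
  where
  preimage : ∀ {n} (f : Fin n → Fin n) → Injective _≡_ _≡_ f → ∀ k → ∃[ i ] f i ≡ k
  preimage {suc n} f f-inj k with any? (λ i → f i ≟F k)
  ... | yes found = found
  -- Punching out a missed value `k` would give an injection from `Fin (suc n)` into `Fin n`.
  ... | no  none  = contradiction
    (injective⇒≤ {f = λ i → punchOut {i = k} {f i} (λ e → none (i , sym e))}
       (λ {i} {j} e → f-inj (punchOut-injective (λ e → none (i , sym e)) (λ e → none (j , sym e)) e)))
    1+n≰n

rank : ∀ {n} → (Fin n → ℕ) → Fin n → ℕ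
rank κ i = count (λ j → κ j <? κ i)

module _ {n} (κ : Fin n → ℕ) where

  rank-mono-< : ∀ {i j} → κ i < κ j → rank κ i < rank κ j
  rank-mono-< {i} {j} κi<κj = count-mono-< (λ k → κ k <? κ i) (λ k → κ k <? κ j)
    (λ k κk<κi → <-trans κk<κi κi<κj) i (<-irrefl refl) κi<κj

  rank<n : ∀ i → rank κ i < n
  rank<n i = count<n (λ j → κ j <? κ i) i (<-irrefl refl)

  rank-injective : Injective _≡_ _≡_ κ → Injective _≡_ _≡_ (rank κ)
  rank-injective κ-inj {i} {j} eq with <-cmp (κ i) (κ j)
  ... | tri< lt _ _ = contradiction eq (<⇒≢ (rank-mono-< lt))
  ... | tri≈ _ e _  = κ-inj e
  ... | tri> _ _ gt = contradiction (sym eq) (<⇒≢ (rank-mono-< gt))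

  rankPermutation : Injective _≡_ _≡_ κ → ∃[ π ] ∀ i → toℕ (Perm._⟨$⟩ʳ_ {n} {n} π i) ≡ rank κ i
  rankPermutation κ-inj =
    let (π , eq) = injective⇒permutation (λ i → fromℕ< (rank<n i))
          (λ {i} {j} e → rank-injective κ-inj (trans (sym (toℕ-fromℕ< (rank<n i)))
                           (trans (cong toℕ e) (toℕ-fromℕ< (rank<n j)))))
    in π , λ i → trans (cong toℕ (eq i)) (toℕ-fromℕ< (rank<n i))

count-toℕ< : ∀ {n} m → m ≤ n → count {n} (λ i → toℕ i <? m) ≡ m
count-toℕ< {n}     zero    m≤n       = count≡0 (λ (i : Fin n) → toℕ i <? 0) λ _ ()
count-toℕ< {suc n} (suc m) (s≤s m≤n) = cong suc (trans
  (count-cong (λ (i : Fin n) → toℕ (suc i) <? suc m) (λ i → toℕ i <? m) (λ _ → ≤-pred) (λ _ → s≤s))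
  (count-toℕ< m m≤n))

rank-permutation : ∀ {n} (π : Permutation n n) i → rank (λ j → toℕ (π ⟨$⟩ʳ j)) i ≡ toℕ (π ⟨$⟩ʳ i)
rank-permutation π i = trans
  (sym (∑ℕ-permute (λ k → ind (toℕ k <? toℕ (π ⟨$⟩ʳ i))) π))
  (count-toℕ< (toℕ (π ⟨$⟩ʳ i)) (<⇒≤ (toℕ<n (π ⟨$⟩ʳ i))))

-- A sum of ranks over a set S counts the pairs i ∈ S, j with j below i.
-- The pairs inside S contribute |S| (|S| - 1) / 2 for every ordering, and
-- the others are most numerous when S lies on top.

module _ {n p} {S : Pred (Fin n) p} (S? : Decidable S) where

  private
    s s̄ : Fin n → ℕ
    s i = ind (S? i)
    s̄ i = ind (¬? (S? i))

    inner outer : (Fin n → ℕ) → ℕ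
    inner κ = ∑ℕ λ i → ∑ℕ λ j → s i * (s j * ind (κ j <? κ i))
    outer κ = ∑ℕ λ i → ∑ℕ λ j → s i * (s̄ j * ind (κ j <? κ i))

    open ≡-Reasoning
    open +-*-Solver

    split : ∀ κ → ∑ℕ (λ i → s i * rank κ i) ≡ inner κ + outer κ
    split κ = trans (∑ℕ-cong λ i → begin
        s i * rank κ i
          ≡⟨ *-distribˡ-∑ℕ (s i) (λ j → ind (κ j <? κ i)) ⟩
        ∑ℕ (λ j → s i * ind (κ j <? κ i))
          ≡⟨ ∑ℕ-cong (λ j → trans (cong (s i *_) (sym (trans (cong (_* ind (κ j <? κ i)) (ind-¬ (S? j))) (*-identityˡ _))))
               (solve 4 (λ a b c d → a :* ((b :+ c) :* d) := a :* (b :* d) :+ a :* (c :* d)) refl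
                  (s i) (s j) (s̄ j) (ind (κ j <? κ i)))) ⟩
        ∑ℕ (λ j → s i * (s j * ind (κ j <? κ i)) + s i * (s̄ j * ind (κ j <? κ i)))
          ≡⟨ ∑ℕ-distrib-+ (λ j → s i * (s j * ind (κ j <? κ i))) _ ⟩
        ∑ℕ (λ j → s i * (s j * ind (κ j <? κ i))) + ∑ℕ (λ j → s i * (s̄ j * ind (κ j <? κ i))) ∎)
      (∑ℕ-distrib-+ (λ i → ∑ℕ λ j → s i * (s j * ind (κ j <? κ i))) _)

    comparable : ∀ (κ : Fin n → ℕ) → Injective _≡_ _≡_ κ → ∀ i j →
                 ind (κ j <? κ i) + ind (κ i <? κ j) ≡ ind (¬? (i ≟F j))
    comparable κ κ-inj i j with <-cmp (κ i) (κ j)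
    ... | tri< lt _ ngt = trans (cong₂ _+_ (ind-no (κ j <? κ i) ngt) (ind-yes (κ i <? κ j) lt))
                            (sym (ind-yes (¬? (i ≟F j)) (<⇒≢ lt ∘ cong κ)))
    ... | tri≈ nlt e ngt = trans (cong₂ _+_ (ind-no (κ j <? κ i) ngt) (ind-no (κ i <? κ j) nlt))
                            (sym (ind-no (¬? (i ≟F j)) (λ ≢ → ≢ (κ-inj e))))
    ... | tri> nlt _ gt = trans (cong₂ _+_ (ind-yes (κ j <? κ i) gt) (ind-no (κ i <? κ j) nlt))
                            (sym (ind-yes (¬? (i ≟F j)) (<⇒≢ gt ∘ cong κ ∘ sym)))

    -- Adding the sum with `i` and `j` exchanged counts each ordered pair of distinct elements of S
    -- once, whatever `κ` is. Doubling takes the place of the division by 2.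
    inner-double : ∀ κ → Injective _≡_ _≡_ κ →
                   inner κ + inner κ ≡ ∑ℕ λ i → ∑ℕ λ j → s i * (s j * ind (¬? (i ≟F j)))
    inner-double κ κ-inj = begin
      inner κ + inner κ
        ≡⟨ cong (inner κ +_) (∑ℕ-comm (λ i j → s i * (s j * ind (κ j <? κ i)))) ⟩
      inner κ + ∑ℕ (λ i → ∑ℕ λ j → s j * (s i * ind (κ i <? κ j)))
        ≡⟨ sym (∑ℕ-distrib-+ (λ i → ∑ℕ λ j → s i * (s j * ind (κ j <? κ i))) _) ⟩
      ∑ℕ (λ i → ∑ℕ (λ j → s i * (s j * ind (κ j <? κ i))) + ∑ℕ (λ j → s j * (s i * ind (κ i <? κ j))))
        ≡⟨ ∑ℕ-cong (λ i → trans (sym (∑ℕ-distrib-+ (λ j → s i * (s j * ind (κ j <? κ i))) _))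
             (∑ℕ-cong λ j → trans
               (solve 4 (λ a b c d → a :* (b :* c) :+ b :* (a :* d) := a :* (b :* (c :+ d))) refl
                  (s i) (s j) (ind (κ j <? κ i)) (ind (κ i <? κ j)))
               (cong (λ z → s i * (s j * z)) (comparable κ κ-inj i j)))) ⟩
      ∑ℕ (λ i → ∑ℕ λ j → s i * (s j * ind (¬? (i ≟F j)))) ∎

    double-cancel : ∀ {a b} → a + a ≡ b + b → a ≡ b
    double-cancel {a} {b} eq with <-cmp a b
    ... | tri< lt _ _ = contradiction eq (<⇒≢ (+-mono-< lt lt))
    ... | tri≈ _ e _  = e
    ... | tri> _ _ gt = contradiction (sym eq) (<⇒≢ (+-mono-< gt gt))

    outer-mono : ∀ (κ κ′ : Fin n → ℕ) → (∀ {i j} → S i → ¬ S j → κ′ j < κ′ i) → outer κ ≤ outer κ′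
    outer-mono κ κ′ top = ∑ℕ-mono λ i → ∑ℕ-mono λ j → term i j
      where
      term : ∀ i j → s i * (s̄ j * ind (κ j <? κ i)) ≤ s i * (s̄ j * ind (κ′ j <? κ′ i))
      term i j with S? i | S? j
      ... | no _   | _      = z≤n
      ... | yes _  | yes _  = z≤n
      ... | yes Si | no ¬Sj = +-monoˡ-≤ 0 (+-monoˡ-≤ 0
              (≤-trans (ind≤1 (κ j <? κ i)) (≤-reflexive (sym (ind-yes (κ′ j <? κ′ i) (top Si ¬Sj))))))

  ∑rank≤∑rank : ∀ κ κ′ → Injective _≡_ _≡_ κ → Injective _≡_ _≡_ κ′ →
    (∀ {i j} → S i → ¬ S j → κ′ j < κ′ i) →
    ∑ℕ (λ i → ind (S? i) * rank κ i) ≤ ∑ℕ (λ i → ind (S? i) * rank κ′ i)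
  ∑rank≤∑rank κ κ′ κ-inj κ′-inj top = subst₂ _≤_ (sym (split κ)) (sym (split κ′))
    (+-mono-≤ (≤-reflexive (double-cancel (trans (inner-double κ κ-inj) (sym (inner-double κ′ κ′-inj)))))
              (outer-mono κ κ′ top))

-- The lexicographic order by (w i , i).
key : ∀ {n} → Vector ℕ n → Fin n → ℕ
key {n} w i = w i * n + toℕ i

module _ {n} (w : Vector ℕ n) where

  key-mono : ∀ {i j} → w i < w j → key w i < key w j
  key-mono {i} {j} wi<wj = begin-strict
    w i * n + toℕ i <⟨ +-monoʳ-< (w i * n) (toℕ<n i) ⟩
    w i * n + n     ≡⟨ +-comm (w i * n) n ⟩
    suc (w i) * n   ≤⟨ *-monoˡ-≤ n wi<wj ⟩
    w j * n         ≤⟨ m≤m+n (w j * n) (toℕ j) ⟩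
    w j * n + toℕ j ∎
    where open ≤-Reasoning

  key-injective : Injective _≡_ _≡_ (key w)
  key-injective {i} {j} eq with <-cmp (w i) (w j)
  ... | tri< lt _ _ = contradiction eq (<⇒≢ (key-mono lt))
  ... | tri> _ _ gt = contradiction (sym eq) (<⇒≢ (key-mono gt))
  ... | tri≈ _ e _  = toℕ-injective (+-cancelˡ-≡ (w j * n) _ _ (subst (λ z → z * n + toℕ i ≡ key w j) e eq))

  position : Fin n → ℕ
  position = rank (key w)

  position-mono : ∀ {i j} → w i < w j → position i < position j
  position-mono = rank-mono-< (key w) ∘ key-mono

open IsParkingFunction

parking-positive : ∀ {n} {α : Vector ℕ n} → IsParkingFunction α → ∀ i → 1 ≤ α i
parking-positive p i = proj₁ (range p i)

-- In sorted order the bound is strictest at the first occurrence of a value, whose place is one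
-- more than the number of smaller entries. The sorting permutation comes from `key γ`, which breaks
-- ties by index.
parking-criterion : ∀ {n} (γ : Vector ℕ n) → (∀ i → 1 ≤ γ i) →
  (∀ i → γ i ≤ suc (count (λ j → γ j <? γ i))) → IsParkingFunction γ
parking-criterion {n} γ pos bound = record
  { range  = λ i → pos i , ≤-trans (bound i) (count<n (λ j → γ j <? γ i) i (<-irrefl refl))
  ; sorted = γ ∘ (π ⟨$⟩ˡ_) , (π , λ i → cong γ (Perm.inverseˡ π)) , monotone , below
  }
  where
  π = proj₁ (rankPermutation (key γ) (key-injective γ))
  π-rank : ∀ k → rank (key γ) (π ⟨$⟩ˡ k) ≡ toℕ k
  π-rank k = trans (sym (proj₂ (rankPermutation (key γ) (key-injective γ)) (π ⟨$⟩ˡ k)))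
                   (cong toℕ (Perm.inverseʳ π))
  monotone : ∀ j k → j Fin.≤ k → γ (π ⟨$⟩ˡ j) ≤ γ (π ⟨$⟩ˡ k)
  monotone j k j≤k = ≮⇒≥ λ gt → <⇒≱ (position-mono γ gt)
    (subst₂ _≤_ (sym (π-rank j)) (sym (π-rank k)) j≤k)
  below : ∀ k → γ (π ⟨$⟩ˡ k) ≤ suc (toℕ k)
  below k = begin
    γ i                                 ≤⟨ bound i ⟩
    suc (count (λ j → γ j <? γ i))      ≤⟨ s≤s (count-mono (λ j → γ j <? γ i) (λ j → key γ j <? key γ i) (λ _ → key-mono γ)) ⟩
    suc (rank (key γ) i)                ≡⟨ cong suc (π-rank k) ⟩
    suc (toℕ k)                         ∎
    where
    open ≤-Reasoning
    i = π ⟨$⟩ˡ k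

parking-permute : ∀ {n} {α : Vector ℕ n} (π : Permutation n n) →
                  IsParkingFunction α → IsParkingFunction (α ∘ (π ⟨$⟩ʳ_))
parking-permute π p =
  let (β , (ρ , β↭α) , mono , below) = sorted p in record
  { range  = range p ∘ (π ⟨$⟩ʳ_)
  ; sorted = β , (π ∘ₚ ρ , λ i → β↭α (π ⟨$⟩ʳ i)) , mono , below
  }

upper : ∀ {n} → Vector ℕ n → ℕ → Vector ℕ n → ℕ
upper w l α = ∑ℕ (λ i → ind (l ≤? w i) * α i)

-- The greedy vertex of the face described by w: the higher a block, the
-- larger its values.
base : ∀ {n} → Vector ℕ n → Vector ℕ n
base w i with w i ≤? 1
... | yes _ = 1
... | no  _ = suc (position w i)

module _ {n} (w : Vector ℕ n) where

  base-low : ∀ {i} → w i ≤ 1 → base w i ≡ 1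
  base-low {i} w≤1 with w i ≤? 1
  ... | yes _   = refl
  ... | no  w≰1 = contradiction w≤1 w≰1

  base-high : ∀ {i} → 2 ≤ w i → base w i ≡ suc (position w i)
  base-high {i} 2≤w with w i ≤? 1
  ... | yes w≤1 = contradiction w≤1 (<⇒≱ 2≤w)
  ... | no  _   = refl

  base-≤ : ∀ i → base w i ≤ suc (position w i)
  base-≤ i with w i ≤? 1
  ... | yes _ = s≤s z≤n
  ... | no  _ = ≤-refl

  base-positive : ∀ i → 1 ≤ base w i
  base-positive i with w i ≤? 1
  ... | yes _ = ≤-refl
  ... | no  _ = s≤s z≤n

  base-mono-key : ∀ {i j} → 2 ≤ w j → key w i < key w j → base w i < base w j
  base-mono-key {i} {j} 2≤wj lt = begin-strict
    base w i             ≤⟨ base-≤ i ⟩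
    suc (position w i)   <⟨ s≤s (rank-mono-< (key w) lt) ⟩
    suc (position w j)   ≡⟨ sym (base-high 2≤wj) ⟩
    base w j             ∎
    where open ≤-Reasoning

  base-mono : ∀ {i j} → 2 ≤ w j → w i < w j → base w i < base w j
  base-mono 2≤wj lt = base-mono-key 2≤wj (key-mono w lt)

  base-distinct : ∀ {i j} → 2 ≤ w i → 2 ≤ w j → base w i ≡ base w j → i ≡ j
  base-distinct 2≤wi 2≤wj eq = rank-injective (key w) (key-injective w)
    (suc-injective (trans (sym (base-high 2≤wi)) (trans eq (base-high 2≤wj))))

  base-parking : IsParkingFunction (base w)
  base-parking = parking-criterion (base w) base-positive bound
    where
    bound : ∀ i → base w i ≤ suc (count (λ j → base w j <? base w i))
    bound i with w i ≤? 1 in eq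
    ... | yes _   = s≤s z≤n
    ... | no  w≰1 = s≤s (count-mono (λ j → key w j <? key w i) (λ j → base w j <? suc (position w i))
      (λ j lt → subst (base w j <_) (base-high (≰⇒> w≰1)) (base-mono-key (≰⇒> w≰1) lt)))

  -- Sorting `α` bounds each entry by one plus its rank under a permutation. By `∑rank≤∑rank` these
  -- ranks have the largest sum over the upper set when that set lies on top, as it does for
  -- `key w`; there `base w` attains the bound.
  upper-parking-≤ : ∀ {α} → IsParkingFunction α → ∀ l → upper w (2 + l) α ≤ upper w (2 + l) (base w)
  upper-parking-≤ {α} p l = begin
    ∑ℕ (λ i → s i * α i)
      ≤⟨ ∑ℕ-mono (λ i → *-monoʳ-≤ (s i) (α≤ i)) ⟩
    ∑ℕ (λ i → s i * suc (rank κ i))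
      ≡⟨ trans (∑ℕ-cong λ i → *-suc (s i) (rank κ i)) (∑ℕ-distrib-+ s (λ i → s i * rank κ i)) ⟩
    ∑ℕ s + ∑ℕ (λ i → s i * rank κ i)
      ≤⟨ +-monoʳ-≤ (∑ℕ s) (∑rank≤∑rank (λ i → 2 + l ≤? w i) κ (key w)
           (π-injective ∘ toℕ-injective) (key-injective w)
           (λ Si ¬Sj → key-mono w (<-≤-trans (≰⇒> ¬Sj) Si))) ⟩
    ∑ℕ s + ∑ℕ (λ i → s i * position w i)
      ≡⟨ sym (trans (∑ℕ-cong λ i → *-suc (s i) (position w i)) (∑ℕ-distrib-+ s (λ i → s i * position w i))) ⟩
    ∑ℕ (λ i → s i * suc (position w i))
      ≡⟨ ∑ℕ-cong top ⟩
    ∑ℕ (λ i → s i * base w i) ∎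
    where
    open ≤-Reasoning
    s : Fin n → ℕ
    s i = ind (2 + l ≤? w i)
    β = proj₁ (sorted p)
    π = proj₁ (proj₁ (proj₂ (sorted p)))
    κ : Fin n → ℕ
    κ i = toℕ (π ⟨$⟩ʳ i)
    π-injective : Injective _≡_ _≡_ (π ⟨$⟩ʳ_)
    π-injective {i} {j} e = trans (sym (Perm.inverseˡ π)) (trans (cong (π ⟨$⟩ˡ_) e) (Perm.inverseˡ π))
    α≤ : ∀ i → α i ≤ suc (rank κ i)
    α≤ i = subst₂ (λ a b → a ≤ suc b) (proj₂ (proj₁ (proj₂ (sorted p))) i)
             (sym (rank-permutation π i)) (proj₂ (proj₂ (proj₂ (sorted p))) (π ⟨$⟩ʳ i))
    top : ∀ i → s i * suc (position w i) ≡ s i * base w i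
    top i = ind-*-cong (2 + l ≤? w i) (λ le → sym (base-high (≤-trans (s≤s (s≤s z≤n)) le)))

-- The equality cases of the inequalities behind the face of `w`. Above the highest label both sums
-- are empty, so `l` may range over all numbers and `r` is not an argument.
Tightℕ : ∀ {n} → Vector ℕ n → Vector ℕ n → Set
Tightℕ w α = (∀ i → w i ≡ 0 → α i ≡ 1) × (∀ l → upper w (2 + l) α ≡ upper w (2 + l) (base w))

-- Words are determined by their tight parking functions

module _ {A : Set} {n} (f : Fin n → A) (i j : Fin n) where

  transposed : Fin n → A
  transposed = f ∘ (Perm.transpose i j ⟨$⟩ʳ_)

  transposed-left : transposed i ≡ f j
  transposed-left with i ≟F i
  ... | yes _  = refl
  ... | no i≢i = contradiction refl i≢i

  transposed-right : transposed j ≡ f i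
  transposed-right with j ≟F i
  ... | yes refl = refl
  ... | no _ with j ≟F j
  ...   | yes _  = refl
  ...   | no j≢j = contradiction refl j≢j

  transposed-other : ∀ {k} → k ≢ i → k ≢ j → transposed k ≡ f k
  transposed-other {k} k≢i k≢j with k ≟F i
  ... | yes k≡i = contradiction k≡i k≢i
  ... | no _ with k ≟F j
  ...   | yes k≡j = contradiction k≡j k≢j
  ...   | no _    = refl

  transposed-invariant : f i ≡ f j → ∀ k → transposed k ≡ f k
  transposed-invariant fi≡fj k with k ≟F i
  ... | yes refl = sym fi≡fj
  ... | no _ with k ≟F j
  ...   | yes refl = fi≡fj
  ...   | no _     = refl

upper-< : ∀ {n} (w α β : Vector ℕ n) l i → l ≤ w i → α i < β i →
          (∀ k → k ≢ i → l ≤ w k → α k ≡ β k) → upper w l α < upper w l β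
upper-< w α β l i l≤wi lt same = ∑ℕ-mono-< (λ k → term k (k ≟F i) (l ≤? w k)) i strict
  where
  term : ∀ k → Dec (k ≡ i) → (d : Dec (l ≤ w k)) → ind d * α k ≤ ind d * β k
  term k _          (no _)     = z≤n
  term k (yes refl) (yes _)    = *-monoʳ-≤ 1 (<⇒≤ lt)
  term k (no k≢i)   (yes l≤wk) = *-monoʳ-≤ 1 (≤-reflexive (same k k≢i l≤wk))
  strict : ind (l ≤? w i) * α i < ind (l ≤? w i) * β i
  strict = subst (λ z → z * α i < z * β i) (sym (ind-yes (l ≤? w i) l≤wi)) (+-monoˡ-< 0 lt)

-- The size of Z ∪ R.
low : ∀ {n} → Vector ℕ n → ℕ
low w = count (λ i → w i ≤? 1)

-- `raised` and `swapped` are the moves away from `base w` within its face. They serve both as test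
-- points that tell words apart and as members of the affine basis.
raised : ∀ {n} → Vector ℕ n → Fin n → Vector ℕ n
raised w k i = ind (i ≟F k) + base w i

swapped : ∀ {n} → Vector ℕ n → Fin n → Fin n → Vector ℕ n
swapped w = transposed (base w)

module _ {n} (w : Vector ℕ n) where

  base-tight : Tightℕ w (base w)
  base-tight = (λ i w≡0 → base-low w (≤-trans (≤-reflexive w≡0) z≤n)) , λ l → refl

  raised-at : ∀ k → raised w k k ≡ suc (base w k)
  raised-at k = cong (_+ base w k) (ind-yes (k ≟F k) refl)

  raised-other : ∀ k {i} → i ≢ k → raised w k i ≡ base w i
  raised-other k {i} i≢k = cong (_+ base w i) (ind-no (i ≟F k) i≢k)

  raised-tight : ∀ {k} → w k ≡ 1 → Tightℕ w (raised w k)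
  raised-tight {k} wk≡1 =
    (λ i w≡0 → trans (raised-other k (λ { refl → contradiction (trans (sym w≡0) wk≡1) λ () }))
                     (proj₁ base-tight i w≡0)) ,
    λ l → ∑ℕ-cong (λ i → ind-*-cong (2 + l ≤? w i) (λ le → raised-other k
      (λ { refl → contradiction (subst (2 + l ≤_) wk≡1 le) λ { (s≤s ()) } })))

  -- A second low coordinate `k′` keeps the value 1, which admits the value 2 at `k`. The values at
  -- higher labels are not disturbed, since they are at least 3.
  raised-parking : low w ≢ 1 → ∀ {k} → w k ≡ 1 → IsParkingFunction (raised w k)
  raised-parking low≢1 {k} wk≡1 with count≢1 (λ i → w i ≤? 1) low≢1 k (≤-reflexive wk≡1)
  ... | k′ , k′≢k , wk′≤1 = parking-criterion γ (λ i → ≤-trans (base-positive w i) (m≤n+m _ _)) bound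
    where
    γ = raised w k
    wk≤1 = ≤-reflexive wk≡1
    -- Both `k` and `k′` lie below `i`, at different positions, so the larger of these positions is
    -- at least 1.
    two≤ : ∀ {i} → 2 ≤ w i → 2 ≤ position w i
    two≤ {i} 2≤wi with <-cmp (position w k) (position w k′)
    ... | tri< lt _ _ = ≤-trans (s≤s (≤-trans (s≤s z≤n) lt)) (position-mono w (≤-trans (s≤s wk′≤1) 2≤wi))
    ... | tri≈ _ e _  = contradiction (sym (rank-injective (key w) (key-injective w) e)) k′≢k
    ... | tri> _ _ gt = ≤-trans (s≤s (≤-trans (s≤s z≤n) gt)) (position-mono w (≤-trans (s≤s wk≤1) 2≤wi))
    γk≡2 : γ k ≡ 2
    γk≡2 = trans (raised-at k) (cong suc (base-low w wk≤1))
    high : ∀ {i} → 2 ≤ w i → γ i ≡ suc (position w i)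
    high {i} 2≤wi = trans (raised-other k λ { refl → contradiction (subst (2 ≤_) wk≡1 2≤wi) λ { (s≤s ()) } })
                          (base-high w 2≤wi)
    bound : ∀ i → γ i ≤ suc (count (λ j → γ j <? γ i))
    bound i with i ≟F k
    ... | yes refl = ≤-trans (≤-reflexive (cong suc (base-low w wk≤1))) (s≤s
            (count>0 (λ j → γ j <? suc (base w i)) k′ (subst₂ _<_
               (sym (trans (raised-other k k′≢k) (base-low w wk′≤1)))
               (sym (cong suc (base-low w wk≤1))) ≤-refl)))
    ... | no i≢k with w i ≤? 1
    ...   | yes wi≤1 = s≤s z≤n
    ...   | no wi≰1 = s≤s (count-mono (λ j → key w j <? key w i) (λ j → γ j <? suc (position w i))
              (λ j lt → below j lt (j ≟F k)))
      where
      2≤wi = ≰⇒> wi≰1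
      below : ∀ j → key w j < key w i → Dec (j ≡ k) → γ j < suc (position w i)
      below j lt (yes refl) = subst (_< suc (position w i)) (sym γk≡2) (s≤s (two≤ 2≤wi))
      below j lt (no j≢k)   = subst₂ _<_ (sym (raised-other k j≢k)) (base-high w 2≤wi)
                                (base-mono-key w 2≤wi lt)

  swapped-parking : ∀ i j → IsParkingFunction (swapped w i j)
  swapped-parking i j = parking-permute (Perm.transpose i j) (base-parking w)

  -- The transposition preserves `w`, hence merely permutes the terms of each upper sum.
  swapped-tight : ∀ {i j} → 2 ≤ w i → w i ≡ w j → Tightℕ w (swapped w i j)
  swapped-tight {i} {j} 2≤wi wi≡wj =
    (λ k wk≡0 → trans (transposed-other (base w) i j
        (λ { refl → contradiction (subst (2 ≤_) wk≡0 2≤wi) λ () })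
        (λ { refl → contradiction (subst (2 ≤_) (trans wi≡wj wk≡0) 2≤wi) λ () }))
      (proj₁ base-tight k wk≡0)) ,
    λ l → sym (trans
      (∑ℕ-permute (λ k → ind (2 + l ≤? w k) * base w k) (Perm.transpose i j))
      (∑ℕ-cong λ k → cong (λ z → ind (2 + l ≤? z) * swapped w i j k)
        (transposed-invariant w i j wi≡wj k)))

module Inclusion {n} (w w′ : Vector ℕ n)
  (sub : ∀ α → IsParkingFunction α → Tightℕ w α → Tightℕ w′ α) where

  base-tight′ : Tightℕ w′ (base w)
  base-tight′ = sub (base w) (base-parking w) (base-tight w)

  private
    tight-equal : ∀ {α β} l → Tightℕ w′ α → Tightℕ w′ β → upper w′ (2 + l) α ≡ upper w′ (2 + l) β
    tight-equal l (_ , tα) (_ , tβ) = trans (tα l) (sym (tβ l))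

  -- The test point is `raised w i`. It violates the equation at `i` if `w′ i` is 0, and it
  -- increases an upper sum by one if `w′ i` is at least 2.
  one-preserved : low w ≢ 1 → ∀ {i} → w i ≡ 1 → w′ i ≡ 1
  one-preserved low≢1 {i} wi≡1 = go (w′ i) refl
    where
    t : Tightℕ w′ (raised w i)
    t = sub (raised w i) (raised-parking w low≢1 wi≡1) (raised-tight w wi≡1)
    go : ∀ x → w′ i ≡ x → w′ i ≡ 1
    go 0 eq = contradiction
      (trans (sym (proj₁ t i eq)) (trans (raised-at w i) (cong suc (base-low w (≤-reflexive wi≡1))))) λ ()
    go 1 eq = eq
    go (suc (suc l)) eq = contradiction (tight-equal l base-tight′ t)
      (<⇒≢ (upper-< w′ (base w) (raised w i) (2 + l) i (≤-reflexive (sym eq))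
        (≤-reflexive (sym (raised-at w i))) (λ k k≢i _ → sym (raised-other w i k≢i))))

  -- Exchanging the distinct values of `base w` at `i` and `j` is tight for `w`. The upper sum for
  -- `w′` at the level `w′ j` contains `j` but not `i`, so it changes.
  block-≮ : (∀ {i} → w′ i ≡ 1 → w i ≡ 1) → ∀ {i j} → 2 ≤ w j → w i ≡ w j → ¬ w′ i < w′ j
  block-≮ one {i} {j} 2≤wj wi≡wj lt = go (w′ j) refl
    where
    i≢j : i ≢ j
    i≢j refl = <-irrefl refl lt
    2≤wi : 2 ≤ w i
    2≤wi = subst (2 ≤_) (sym wi≡wj) 2≤wj
    t : Tightℕ w′ (swapped w i j)
    t = sub (swapped w i j) (swapped-parking w i j) (swapped-tight w 2≤wi wi≡wj)
    go : ∀ x → w′ j ≢ x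
    go 0 eq = contradiction (subst (w′ i <_) eq lt) λ ()
    go 1 eq = contradiction (subst (2 ≤_) (one eq) 2≤wj) λ { (s≤s ()) }
    go (suc (suc l)) eq with <-cmp (base w i) (base w j)
    ... | tri≈ _ e _ = i≢j (base-distinct w 2≤wi 2≤wj e)
    ... | tri< b _ _ = contradiction (tight-equal l t base-tight′)
          (<⇒≢ (upper-< w′ (swapped w i j) (base w) (2 + l) j (≤-reflexive (sym eq))
            (subst (_< base w j) (sym (transposed-right (base w) i j)) b)
            (λ k k≢j le → transposed-other (base w) i j
              (λ { refl → <⇒≱ (subst (w′ i <_) eq lt) le }) k≢j)))
    ... | tri> _ _ b = contradiction (tight-equal l base-tight′ t)
          (<⇒≢ (upper-< w′ (base w) (swapped w i j) (2 + l) j (≤-reflexive (sym eq))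
            (subst (base w j <_) (sym (transposed-right (base w) i j)) b)
            (λ k k≢j le → sym (transposed-other (base w) i j
              (λ { refl → <⇒≱ (subst (w′ i <_) eq lt) le }) k≢j))))

  block-preserved : (∀ {i} → w′ i ≡ 1 → w i ≡ 1) → ∀ {i j} → 2 ≤ w j → w i ≡ w j → w′ i ≡ w′ j
  block-preserved one {i} {j} 2≤wj eq with <-cmp (w′ i) (w′ j)
  ... | tri< lt _ _ = contradiction lt (block-≮ one 2≤wj eq)
  ... | tri≈ _ e _  = e
  ... | tri> _ _ gt = contradiction gt (block-≮ one (subst (2 ≤_) (sym eq) 2≤wj) (sym eq))

  -- Otherwise exchanging the values at i and j would beat the maximum for w′.
  order-preserved : ∀ {i j} → 2 ≤ w j → w i < w j → w′ i ≤ w′ j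
  order-preserved {i} {j} 2≤wj lt = ≮⇒≥ λ gt → go (w′ i) refl gt
    where
    b : base w i < base w j
    b = base-mono w 2≤wj lt
    go : ∀ x → w′ i ≡ x → ¬ w′ j < w′ i
    go 0 eq gt = contradiction (subst (w′ j <_) eq gt) λ ()
    -- Here `w′ j` is 0, so `base w j` is 1, although it exceeds the positive `base w i`.
    go 1 eq gt = <⇒≱ b (subst (_≤ base w i)
      (sym (proj₁ base-tight′ j (n<1⇒n≡0 (subst (w′ j <_) eq gt)))) (base-positive w i))
    go (suc (suc l)) eq gt = <⇒≱
      (upper-< w′ (base w) (swapped w i j) (2 + l) i (≤-reflexive (sym eq))
        (subst (base w i <_) (sym (transposed-left (base w) i j)) b)
        (λ k k≢i le → sym (transposed-other (base w) i j k≢i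
          (λ { refl → <⇒≱ (subst (w′ j <_) eq gt) le }))))
      (≤-trans (upper-parking-≤ w′ (swapped-parking w i j) l) (≤-reflexive (sym (proj₂ base-tight′ l))))

-- Label 1 is ruled out by the reverse inclusion. If `w′ i` were at least 2, then `base w′ i ≡ 1`
-- would leave nothing below `i`. But `w` has a second low coordinate `k`: either `w′ k` is at most
-- 1, so `k` lies below `i`, or `k` and `i` share the value 1 at labels where the values of
-- `base w′` are distinct.
zero-preserved : ∀ {n} (w w′ : Vector ℕ n) →
  (∀ α → IsParkingFunction α → Tightℕ w α → Tightℕ w′ α) →
  (∀ α → IsParkingFunction α → Tightℕ w′ α → Tightℕ w α) →
  low w ≢ 1 → low w′ ≢ 1 → ∀ {i} → w i ≡ 0 → w′ i ≡ 0
zero-preserved w w′ sub sub′ low≢1 low′≢1 {i} wi≡0 = go (w′ i) refl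
  where
  open Inclusion
  go : ∀ x → w′ i ≡ x → w′ i ≡ 0
  go 0 eq = eq
  go 1 eq = contradiction (trans (sym wi≡0) (one-preserved w′ w sub′ low′≢1 eq)) λ ()
  go (suc (suc l)) eq =
    let (k , k≢i , wk≤1) = count≢1 (λ k → w k ≤? 1) low≢1 i (≤-trans (≤-reflexive wi≡0) z≤n) in
    contradiction (other k k≢i (w k) refl wk≤1) λ ()
    where
    2≤w′i : 2 ≤ w′ i
    2≤w′i = subst (2 ≤_) (sym eq) (s≤s (s≤s z≤n))
    base≡1 : ∀ k → w k ≡ 0 → base w′ k ≡ 1
    base≡1 = proj₁ (base-tight′ w′ w sub′)
    not-low : ∀ k → w′ k ≤ 1 → 0 ≡ 1
    not-low k le = contradiction
      (suc-injective (trans (sym (base-high w′ 2≤w′i)) (base≡1 i wi≡0)))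
      (λ e → contradiction (subst (position w′ k <_) e (position-mono w′ (<-≤-trans (s≤s le) 2≤w′i))) λ ())
    other : ∀ k → k ≢ i → ∀ x → w k ≡ x → w k ≤ 1 → 0 ≡ 1
    other k k≢i 0 wk≡0 _ with w′ k ≤? 1
    ... | yes le = not-low k le
    ... | no w′k≰1 = contradiction
          (base-distinct w′ (≰⇒> w′k≰1) 2≤w′i (trans (base≡1 k wk≡0) (sym (base≡1 i wi≡0)))) k≢i
    other k k≢i 1 wk≡1 _ = not-low k (≤-reflexive (one-preserved w w′ sub low≢1 wk≡1))
    other k k≢i (suc (suc _)) wk≡ le = contradiction (subst (_≤ 1) wk≡ le) λ { (s≤s ()) }

-- Words are determined by their weak order and the place of 0 and 1 in
-- it, since their labels form an initial segment.
word-rigid : ∀ {n m r m′ r′} {w w′ : Vector ℕ n} → IsWord m r w → IsWord m′ r′ w′ →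
  (∀ {i j} → w i < w j → w′ i < w′ j) → (∀ {i j} → w′ i < w′ j → w i < w j) →
  (∀ {i} → w i ≡ 0 → w′ i ≡ 0) → (∀ {i} → w′ i ≡ 0 → w i ≡ 0) →
  (∀ {i} → w i ≡ 1 → w′ i ≡ 1) → (∀ {i} → w′ i ≡ 1 → w i ≡ 1) → w ≗ w′
word-rigid {w = w} {w′} W W′ to from zero→ zero← one→ one← i =
  sym (<-rec (λ v → ∀ i → w i ≡ v → w′ i ≡ v) step (w i) i refl)
  where
  step : ∀ v → (∀ {u} → u < v → ∀ i → w i ≡ u → w′ i ≡ u) → ∀ i → w i ≡ v → w′ i ≡ v
  step 0 ih i eq = zero→ eq
  step 1 ih i eq = one→ eq
  step (suc (suc l)) ih i eq with <-cmp (w′ i) (2 + l)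
  ... | tri≈ _ e _ = e
  ... | tri< lt _ _ = contradiction refl (below (w′ i) refl lt)
    where
    -- A smaller positive level `u` of `w′ i` is attained by `w` at some `j`. By induction `w′ j` is
    -- `u` as well, whereas `w j < w i` demands `w′ j < w′ i`.
    below : ∀ u → w′ i ≡ u → u < 2 + l → w i ≢ w i
    below 0 e _ _ = contradiction (trans (sym eq) (zero← e)) λ ()
    below 1 e _ _ = contradiction (trans (sym eq) (one← e)) λ ()
    below (suc (suc k)) e u<v _ =
      let (j , wj) = hits W k (<⇒≤ (≤-pred (≤-trans u<v (subst (_≤ suc _) eq (bounded W i))))) in
      <⇒≢ (to {j} {i} (subst₂ _<_ (sym wj) (sym eq) u<v)) (trans (ih u<v j wj) (sym e))
  ... | tri> _ _ gt =
    -- Since `w′ i` is larger, `w′` attains `2 + l` at some `j`. Then `w j < w i`, so by induction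
    -- `w′ j` equals `w j`, which is too small.
    let (j , w′j) = hits W′ l (<⇒≤ (≤-pred (≤-trans gt (bounded W′ i))))
        wj<v = subst (w j <_) eq (from {j} {i} (subst (_< w′ i) (sym w′j) gt)) in
    contradiction (trans (sym (ih wj<v j refl)) w′j) (<⇒≢ wj<v)

word-unique : ∀ {n m r m′ r′} {w w′ : Vector ℕ n} → IsWord m r w → IsWord m′ r′ w′ →
  low w ≢ 1 → low w′ ≢ 1 →
  (∀ α → IsParkingFunction α → Tightℕ w α → Tightℕ w′ α) →
  (∀ α → IsParkingFunction α → Tightℕ w′ α → Tightℕ w α) → w ≗ w′
word-unique {w = w} {w′} W W′ low≢1 low′≢1 sub sub′ =
  word-rigid W W′ (order w w′ sub sub′ low≢1 low′≢1) (order w′ w sub′ sub low′≢1 low≢1)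
    (zero-preserved w w′ sub sub′ low≢1 low′≢1) (zero-preserved w′ w sub′ sub low′≢1 low≢1)
    (Inclusion.one-preserved w w′ sub low≢1) (Inclusion.one-preserved w′ w sub′ low′≢1)
  where
  order : ∀ (w w′ : Vector ℕ _) →
    (∀ α → IsParkingFunction α → Tightℕ w α → Tightℕ w′ α) →
    (∀ α → IsParkingFunction α → Tightℕ w′ α → Tightℕ w α) →
    low w ≢ 1 → low w′ ≢ 1 → ∀ {i j} → w i < w j → w′ i < w′ j
  order w w′ sub sub′ low≢1 low′≢1 {i} {j} lt = go (w j) refl
    where
    go : ∀ x → w j ≡ x → w′ i < w′ j
    go 0 eq = contradiction (subst (w i <_) eq lt) λ ()
    go 1 eq = subst₂ _<_
      (sym (zero-preserved w w′ sub sub′ low≢1 low′≢1 (n<1⇒n≡0 (subst (w i <_) eq lt))))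
      (sym (Inclusion.one-preserved w w′ sub low≢1 eq)) ≤-refl
    -- Strictness uses the reverse inclusion: equal levels in `w′` would be equal in `w`.
    go (suc (suc l)) eq = ≤∧≢⇒< (Inclusion.order-preserved w w′ sub 2≤wj lt) λ e →
      <⇒≢ lt (Inclusion.block-preserved w′ w sub′ (Inclusion.one-preserved w w′ sub low≢1) (high (w′ j) refl) e)
      where
      2≤wj : 2 ≤ w j
      2≤wj = subst (2 ≤_) (sym eq) (s≤s (s≤s z≤n))
      high : ∀ x → w′ j ≡ x → 2 ≤ w′ j
      high 0 e = contradiction (trans (sym eq) (zero-preserved w′ w sub′ sub low′≢1 low≢1 e)) λ ()
      high 1 e = contradiction (trans (sym eq) (Inclusion.one-preserved w′ w sub′ low′≢1 e)) λ ()
      high (suc (suc _)) e = subst (2 ≤_) (sym e) (s≤s (s≤s z≤n))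

-- Ordered fields

module OrderedFieldProperties {c ℓ₁ ℓ₂ : Level} (K : OrderedField c ℓ₁ ℓ₂) where

  open Geometry K
  module K = OrderedField K
  module ≤ᴷ = IsDecTotalOrder K.isDecTotalOrder
  open K public using (Carrier; _≈_; 0#; 1#; _+ᴷ_; _*ᴷ_; -_) renaming (_≤_ to _≤ᴷ_)
  open RingProperties K.ring using (-‿distribˡ-*; -‿involutive)
    renaming (+-cancelˡ to +ᴷ-cancelˡ; +-cancelʳ to +ᴷ-cancelʳ)
  open Sum K.semiring using (sum-cong-≋; sum-replicate-zero; *-distribˡ-sum; *-distribʳ-sum; ∑-comm)
  open SetoidReasoning K.setoid

  _>0 : Carrier → Set _
  x >0 = 0# ≤ᴷ x × ¬ (x ≈ 0#)

  _<0 : Carrier → Set _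
  x <0 = x ≤ᴷ 0# × ¬ (x ≈ 0#)

  ≤-resp : ∀ {x x′ y y′} → x ≈ x′ → y ≈ y′ → x ≤ᴷ y → x′ ≤ᴷ y′
  ≤-resp x≈ y≈ x≤y = ≤ᴷ.trans (≤ᴷ.reflexive (K.sym x≈)) (≤ᴷ.trans x≤y (≤ᴷ.reflexive y≈))

  +ᴷ-mono-≤ : ∀ {x y u v} → x ≤ᴷ y → u ≤ᴷ v → x +ᴷ u ≤ᴷ y +ᴷ v
  +ᴷ-mono-≤ {x} {y} {u} {v} x≤y u≤v = ≤ᴷ.trans (K.+-monoʳ-≤ x u≤v)
    (≤-resp (K.+-comm v x) (K.+-comm v y) (K.+-monoʳ-≤ v x≤y))

  +ᴷ-cancelˡ-≤ : ∀ z {x y} → z +ᴷ x ≤ᴷ z +ᴷ y → x ≤ᴷ y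
  +ᴷ-cancelˡ-≤ z z+x≤z+y = ≤-resp (undo _) (undo _) (K.+-monoʳ-≤ (- z) z+x≤z+y)
    where
    undo : ∀ x → - z +ᴷ (z +ᴷ x) ≈ x
    undo x = K.trans (K.sym (K.+-assoc (- z) z x))
               (K.trans (K.+-congʳ (K.-‿inverseˡ z)) (K.+-identityˡ x))

  x+[y-x]≈y : ∀ x y → x +ᴷ (y +ᴷ - x) ≈ y
  x+[y-x]≈y x y = begin
    x +ᴷ (y +ᴷ - x) ≈⟨ K.+-congˡ (K.+-comm y (- x)) ⟩
    x +ᴷ (- x +ᴷ y) ≈⟨ K.+-assoc x (- x) y ⟨
    x +ᴷ - x +ᴷ y   ≈⟨ K.+-congʳ (K.-‿inverseʳ x) ⟩
    0# +ᴷ y         ≈⟨ K.+-identityˡ y ⟩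
    y               ∎

  x≤y⇒0≤y-x : ∀ {x y} → x ≤ᴷ y → 0# ≤ᴷ y +ᴷ - x
  x≤y⇒0≤y-x {x} {y} x≤y = +ᴷ-cancelˡ-≤ x
    (≤-resp (K.sym (K.+-identityʳ x)) (K.sym (x+[y-x]≈y x y)) x≤y)

  x≤0⇒0≤-x : ∀ {x} → x ≤ᴷ 0# → 0# ≤ᴷ - x
  x≤0⇒0≤-x x≤0 = ≤-resp K.refl (K.+-identityˡ _) (x≤y⇒0≤y-x x≤0)

  y-x≈0⇒x≈y : ∀ {x y} → y +ᴷ - x ≈ 0# → x ≈ y
  y-x≈0⇒x≈y {x} {y} eq = K.trans (K.sym (K.+-identityʳ x)) (K.trans (K.+-congˡ (K.sym eq)) (x+[y-x]≈y x y))

  *ᴷ-monoˡ-≤ : ∀ {z x y} → 0# ≤ᴷ z → x ≤ᴷ y → z *ᴷ x ≤ᴷ z *ᴷ y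
  *ᴷ-monoˡ-≤ {z} {x} {y} 0≤z x≤y = ≤-resp (K.+-identityʳ _)
    (K.trans (K.sym (K.distribˡ z x _)) (K.*-congˡ (x+[y-x]≈y x y)))
    (K.+-monoʳ-≤ (z *ᴷ x) (K.*-nonneg 0≤z (x≤y⇒0≤y-x x≤y)))

  *ᴷ-antimonoˡ-≤ : ∀ {z x y} → z ≤ᴷ 0# → x ≤ᴷ y → z *ᴷ y ≤ᴷ z *ᴷ x
  *ᴷ-antimonoˡ-≤ {z} {x} {y} z≤0 x≤y = +ᴷ-cancelˡ-≤ (- z *ᴷ y) (+ᴷ-cancelˡ-≤ (- z *ᴷ x)
    (≤-resp (K.sym (K.trans (K.+-congˡ (cancel y)) (K.+-identityʳ _)))
            (K.sym (K.trans (x∙yz≈y∙xz _ _ _) (K.trans (K.+-congˡ (cancel x)) (K.+-identityʳ _))))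
            (*ᴷ-monoˡ-≤ (x≤0⇒0≤-x z≤0) x≤y)))
    where
    cancel : ∀ x → - z *ᴷ x +ᴷ z *ᴷ x ≈ 0#
    cancel x = K.trans (K.sym (K.distribʳ x (- z) z)) (K.trans (K.*-congʳ (K.-‿inverseˡ z)) (K.zeroˡ x))
    open CommutativeSemigroupProperties K.+-commutativeSemigroup using (x∙yz≈y∙xz)

  *ᴷ-cancelˡ : ∀ {z x y} → ¬ (z ≈ 0#) → z *ᴷ x ≈ z *ᴷ y → x ≈ y
  *ᴷ-cancelˡ {z} {x} {y} z≉0 eq = K.trans (K.sym (undo x)) (K.trans (K.*-congˡ eq) (undo y))
    where
    z⁻¹ = proj₁ (K.inverse z z≉0)
    undo : ∀ x → z⁻¹ *ᴷ (z *ᴷ x) ≈ x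
    undo x = begin
      z⁻¹ *ᴷ (z *ᴷ x) ≈⟨ K.*-assoc z⁻¹ z x ⟨
      z⁻¹ *ᴷ z *ᴷ x   ≈⟨ K.*-congʳ (K.trans (K.*-comm z⁻¹ z) (proj₂ (K.inverse z z≉0))) ⟩
      1# *ᴷ x         ≈⟨ K.*-identityˡ x ⟩
      x               ∎

  0≤1 : 0# ≤ᴷ 1#
  0≤1 with ≤ᴷ.total 0# 1#
  ... | inj₁ 0≤1 = 0≤1
  -- Then `- 1#` is nonnegative, and so is its square `1#`.
  ... | inj₂ 1≤0 = ≤-resp K.refl
    (K.trans (K.sym (-‿distribˡ-* 1# _)) (K.trans (K.-‿cong (K.*-identityˡ _)) (-‿involutive 1#)))
    (K.*-nonneg (x≤0⇒0≤-x 1≤0) (x≤0⇒0≤-x 1≤0))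

  >0-+ : ∀ {x y} → x >0 → 0# ≤ᴷ y → (x +ᴷ y) >0
  >0-+ {x} {y} (0≤x , x≉0) 0≤y =
    ≤-resp (K.+-identityʳ 0#) K.refl (+ᴷ-mono-≤ 0≤x 0≤y) ,
    λ x+y≈0 → x≉0 (≤ᴷ.antisym (≤-resp (K.+-identityʳ x) x+y≈0 (K.+-monoʳ-≤ x 0≤y)) 0≤x)

  1>0 : 1# >0
  1>0 = 0≤1 , K.0≉1 ∘ K.sym

  +ᴷ-pinch : ∀ {x y u v} → x ≤ᴷ y → u ≤ᴷ v → x +ᴷ u ≈ y +ᴷ v → x ≈ y × u ≈ v
  +ᴷ-pinch {x} {y} {u} {v} x≤y u≤v eq = x≈y , +ᴷ-cancelˡ x u v (K.trans eq (K.+-congʳ (K.sym x≈y)))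
    where
    x≈y : x ≈ y
    x≈y = ≤ᴷ.antisym x≤y (+ᴷ-cancelˡ-≤ v (≤-resp
      (K.trans eq (K.+-comm y v)) (K.+-comm x v) (K.+-monoʳ-≤ x u≤v)))

  ∑-mono : ∀ {n} {f g : Vector Carrier n} → (∀ i → f i ≤ᴷ g i) → ∑ f ≤ᴷ ∑ g
  ∑-mono {zero}  f≤g = ≤ᴷ.reflexive K.refl
  ∑-mono {suc n} f≤g = +ᴷ-mono-≤ (f≤g zero) (∑-mono (f≤g ∘ suc))

  -- The source of tightness: maximality is equality in a sum of inequalities, and this makes every
  -- single one an equality.
  ∑-pinch : ∀ {n} {f g : Vector Carrier n} → (∀ i → f i ≤ᴷ g i) → ∑ f ≈ ∑ g → ∀ i → f i ≈ g i
  ∑-pinch f≤g eq zero    = proj₁ (+ᴷ-pinch (f≤g zero) (∑-mono (f≤g ∘ suc)) eq)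
  ∑-pinch f≤g eq (suc i) = ∑-pinch (f≤g ∘ suc) (proj₂ (+ᴷ-pinch (f≤g zero) (∑-mono (f≤g ∘ suc)) eq)) i

  ∑-cong : ∀ {n} {f g : Vector Carrier n} → (∀ i → f i ≈ g i) → ∑ f ≈ ∑ g
  ∑-cong = sum-cong-≋

  ∑-zero : ∀ {n} {f : Vector Carrier n} → (∀ i → f i ≈ 0#) → ∑ f ≈ 0#
  ∑-zero {n} f≈0 = K.trans (∑-cong f≈0) (sum-replicate-zero n)

  ∑-single : ∀ {n} {f : Vector Carrier n} i → (∀ k → k ≢ i → f k ≈ 0#) → ∑ f ≈ f i
  ∑-single zero    f≈0 = K.trans (K.+-congˡ (∑-zero λ k → f≈0 (suc k) λ ())) (K.+-identityʳ _)
  ∑-single (suc i) f≈0 = K.trans (K.+-cong (f≈0 zero λ ())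
    (∑-single i (λ k k≢i → f≈0 (suc k) λ { refl → k≢i refl }))) (K.+-identityˡ _)

  ∑-cancel : ∀ {n} {f g : Vector Carrier n} i → (∀ k → k ≢ i → f k ≈ g k) → ∑ f ≈ ∑ g → f i ≈ g i
  ∑-cancel zero f≈g eq =
    +ᴷ-cancelʳ _ _ _ (K.trans eq (K.+-congˡ (K.sym (∑-cong λ k → f≈g (suc k) λ ()))))
  ∑-cancel (suc i) f≈g eq = ∑-cancel i (λ k k≢i → f≈g (suc k) λ { refl → k≢i refl })
    (+ᴷ-cancelˡ _ _ _ (K.trans eq (K.+-congʳ (K.sym (f≈g zero λ ())))))

  ι : ℕ → Carrier
  ι k = k ×ᴷ 1#

  ι-homo-+ : ∀ k l → ι (k + l) ≈ ι k +ᴷ ι l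
  ι-homo-+ = Mult.×-homo-+ K.+-monoid 1#

  ι-nonneg : ∀ k → 0# ≤ᴷ ι k
  ι-nonneg zero    = ≤ᴷ.reflexive K.refl
  ι-nonneg (suc k) = proj₁ (>0-+ 1>0 (ι-nonneg k))

  ι-mono : ∀ {k l} → k ≤ l → ι k ≤ᴷ ι l
  ι-mono {l = l} z≤n = ι-nonneg l
  ι-mono (s≤s k≤l) = K.+-monoʳ-≤ 1# (ι-mono k≤l)

  -- An ordered field has characteristic 0, because `1#` plus a nonnegative element is positive.
  ι-injective : ∀ {k l} → ι k ≈ ι l → k ≡ l
  ι-injective {zero}  {zero}  eq = refl
  ι-injective {zero}  {suc l} eq = contradiction (K.sym eq) (proj₂ (>0-+ 1>0 (ι-nonneg l)))
  ι-injective {suc k} {zero}  eq = contradiction eq (proj₂ (>0-+ 1>0 (ι-nonneg k)))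
  ι-injective {suc k} {suc l} eq = cong suc (ι-injective (+ᴷ-cancelˡ 1# _ _ eq))

  ι-one : ι 1 ≈ 1#
  ι-one = K.+-identityʳ 1#

  ι-∑ : ∀ {n} (f : Vector ℕ n) → ι (∑ℕ f) ≈ ∑ (ι ∘ f)
  ι-∑ {zero}  f = K.refl
  ι-∑ {suc n} f = K.trans (ι-homo-+ (f zero) _) (K.+-congˡ (ι-∑ (f ∘ suc)))

  mask : ∀ {p} {P : Set p} → Dec P → Carrier → Carrier
  mask d x = if does d then x else 0#

  module _ {p} {P : Set p} where

    mask-yes : ∀ (d : Dec P) {x} → P → mask d x ≈ x
    mask-yes (yes _) p = K.refl
    mask-yes (no ¬p) p = contradiction p ¬p

    mask-no : ∀ (d : Dec P) {x} → ¬ P → mask d x ≈ 0#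
    mask-no (yes p) ¬p = contradiction p ¬p
    mask-no (no _)  ¬p = K.refl

    mask-cong : ∀ (d : Dec P) {x y} → (P → x ≈ y) → mask d x ≈ mask d y
    mask-cong (yes p) x≈y = x≈y p
    mask-cong (no _)  x≈y = K.refl

    mask-mono : ∀ (d : Dec P) {x y} → (P → x ≤ᴷ y) → mask d x ≤ᴷ mask d y
    mask-mono (yes p) x≤y = x≤y p
    mask-mono (no _)  x≤y = ≤ᴷ.reflexive K.refl

    mask-nonneg : ∀ (d : Dec P) {x} → 0# ≤ᴷ x → 0# ≤ᴷ mask d x
    mask-nonneg (yes _) 0≤x = 0≤x
    mask-nonneg (no _)  0≤x = ≤ᴷ.reflexive K.refl

    mask-∑ : ∀ (d : Dec P) {m} (t x : Vector Carrier m) →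
             mask d (∑ (λ i → t i *ᴷ x i)) ≈ ∑ (λ i → t i *ᴷ mask d (x i))
    mask-∑ (yes _) t x = K.refl
    mask-∑ (no _)  t x = K.sym (∑-zero λ i → K.zeroʳ (t i))

    mask-ι : ∀ (d : Dec P) k → ι (ind d * k) ≈ mask d (ι k)
    mask-ι (yes _) k = K.reflexive (cong ι (+-identityʳ k))
    mask-ι (no _)  k = K.refl

    mask-* : ∀ (d : Dec P) x y → mask d x *ᴷ y ≈ x *ᴷ mask d y
    mask-* (yes _) x y = K.refl
    mask-* (no _)  x y = K.trans (K.zeroˡ y) (K.sym (K.zeroʳ x))

  -- Linearity in terms of `combination`, the form in which points of both kinds of hull are given.
  record IsLinear {n} (L : Point n → Carrier) : Set (c Level.⊔ ℓ₁) where
    field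
      congruent : ∀ {x y} → x ≋ y → L x ≈ L y
      linear    : ∀ {m} (t : Vector Carrier m) (p : Vector (Point n) m) →
                  L (combination t p) ≈ ∑ (λ i → t i *ᴷ L (p i))

  open IsLinear public

  coordinate-linear : ∀ {n} (i : Fin n) → IsLinear (λ x → x i)
  coordinate-linear i = record { congruent = λ x≋y → x≋y i ; linear = λ t p → K.refl }

  ∑-linear : ∀ {n k} {L : Fin k → Point n → Carrier} → (∀ j → IsLinear (L j)) →
             IsLinear (λ x → ∑ (λ j → L j x))
  ∑-linear {L = L} lin = record
    { congruent = λ x≋y → ∑-cong λ j → congruent (lin j) x≋y
    ; linear    = λ t p → begin
        ∑ (λ j → L j (combination t p))           ≈⟨ ∑-cong (λ j → linear (lin j) t p) ⟩
        ∑ (λ j → ∑ (λ i → t i *ᴷ L j (p i)))      ≈⟨ ∑-comm (λ j i → t i *ᴷ L j (p i)) ⟩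
        ∑ (λ i → ∑ (λ j → t i *ᴷ L j (p i)))      ≈⟨ ∑-cong (λ i → K.sym (*-distribˡ-sum (t i) (λ j → L j (p i)))) ⟩
        ∑ (λ i → t i *ᴷ ∑ (λ j → L j (p i)))      ∎
    }

  mask-linear : ∀ {n p} {P : Set p} (d : Dec P) (i : Fin n) → IsLinear (λ x → mask d (x i))
  mask-linear d i = record
    { congruent = λ x≋y → mask-cong d λ _ → x≋y i ; linear = λ t p → mask-∑ d t (λ j → p j i) }

  module _ {n} {L : Point n → Carrier} (lin : IsLinear L) {s} {S : Pred (Point n) s} {d : Carrier} where

    private
      constant : ∀ {m} (t : Vector Carrier m) → ∑ t ≈ 1# → ∑ (λ i → t i *ᴷ d) ≈ d
      constant t ∑t≈1 = K.trans (K.sym (*-distribʳ-sum d t)) (K.trans (K.*-congʳ ∑t≈1) (K.*-identityˡ d))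

    convexHull-≤ : (∀ p → S p → L p ≤ᴷ d) → ∀ x → convexHull S x → L x ≤ᴷ d
    convexHull-≤ bound x (m , p , t , p∈S , t≥0 , ∑t≈1 , x≋) = ≤-resp
      (K.sym (K.trans (congruent lin x≋) (linear lin t p))) (constant t ∑t≈1)
      (∑-mono λ i → *ᴷ-monoˡ-≤ (t≥0 i) (bound (p i) (p∈S i)))

    convexHull-≥ : (∀ p → S p → d ≤ᴷ L p) → ∀ x → convexHull S x → d ≤ᴷ L x
    convexHull-≥ bound x (m , p , t , p∈S , t≥0 , ∑t≈1 , x≋) = ≤-resp
      (constant t ∑t≈1) (K.sym (K.trans (congruent lin x≋) (linear lin t p)))
      (∑-mono λ i → *ᴷ-monoˡ-≤ (t≥0 i) (bound (p i) (p∈S i)))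

    affineHull-≈ : (∀ p → S p → L p ≈ d) → ∀ x → affineHull S x → L x ≈ d
    affineHull-≈ eq x (m , p , t , p∈S , ∑t≈1 , x≋) = K.trans (congruent lin x≋) (K.trans (linear lin t p)
      (K.trans (∑-cong λ i → K.*-congˡ (eq (p i) (p∈S i))) (constant t ∑t≈1)))

  singleton-hull : ∀ {n s} {S : Pred (Point n) s} {x y} → S y → x ≋ y → convexHull S x
  singleton-hull {y = y} Sy x≋y =
    1 , (λ _ → y) , (λ _ → 1#) , (λ _ → Sy) , (λ _ → 0≤1) , K.+-identityʳ 1# ,
    λ j → K.trans (x≋y j) (K.sym (K.trans (K.+-identityʳ _) (K.*-identityˡ _)))

-- Maximal faces

module MaximalFaces {c ℓ₁ ℓ₂ : Level} (K : OrderedField c ℓ₁ ℓ₂) where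

  open Geometry K
  open OrderedFieldProperties K
  open RingProperties K.ring using ()
    renaming (+-cancelˡ to +ᴷ-cancelˡ)
  open Sum K.semiring using (*-distribˡ-sum; *-distribʳ-sum; ∑-distrib-+; ∑-comm)
  open SetoidReasoning K.setoid

  upperᴷ : ∀ {n} → Vector ℕ n → ℕ → Point n → Carrier
  upperᴷ w l x = ∑ (λ i → mask (l ≤? w i) (x i))

  upperᴷ-linear : ∀ {n} (w : Vector ℕ n) l → IsLinear (upperᴷ w l)
  upperᴷ-linear w l = ∑-linear λ i → mask-linear (l ≤? w i) i

  upperᴷ-ι : ∀ {n} (w : Vector ℕ n) l α → ι (upper w l α) ≈ upperᴷ w l (ι ∘ α)
  upperᴷ-ι w l α = K.trans (ι-∑ (λ i → ind (l ≤? w i) * α i)) (∑-cong λ i → mask-ι (l ≤? w i) (α i))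

  Tight : ∀ {n} → Vector ℕ n → Pred (Point n) ℓ₁
  Tight w x = (∀ i → w i ≡ 0 → x i ≈ 1#) × (∀ l → upperᴷ w (2 + l) x ≈ upperᴷ w (2 + l) (ι ∘ base w))

  module _ {n} {w : Vector ℕ n} where

    Tightℕ⇒Tight : ∀ {α} → Tightℕ w α → Tight w (ι ∘ α)
    Tightℕ⇒Tight {α} (ones , levels) =
      (λ i w≡0 → K.trans (K.reflexive (cong ι (ones i w≡0))) ι-one) ,
      λ l → K.trans (K.sym (upperᴷ-ι w (2 + l) α))
              (K.trans (K.reflexive (cong ι (levels l))) (upperᴷ-ι w (2 + l) (base w)))

    Tight⇒Tightℕ : ∀ {α} → Tight w (ι ∘ α) → Tightℕ w α
    Tight⇒Tightℕ {α} (ones , levels) =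
      (λ i w≡0 → ι-injective (K.trans (ones i w≡0) (K.sym ι-one))) ,
      λ l → ι-injective (K.trans (upperᴷ-ι w (2 + l) α)
              (K.trans (levels l) (K.sym (upperᴷ-ι w (2 + l) (base w)))))

    Tight-≋ : ∀ {x y} → x ≋ y → Tight w x → Tight w y
    Tight-≋ x≋y (ones , levels) =
      (λ i w≡0 → K.trans (K.sym (x≋y i)) (ones i w≡0)) ,
      λ l → K.trans (K.sym (congruent (upperᴷ-linear w (2 + l)) x≋y)) (levels l)

    Tight-affineHull : ∀ {s} {S : Pred (Point n) s} → (∀ p → S p → Tight w p) →
                       ∀ x → affineHull S x → Tight w x
    Tight-affineHull tight x x∈ =
      (λ i w≡0 → affineHull-≈ (coordinate-linear i) (λ p Sp → proj₁ (tight p Sp) i w≡0) x x∈) ,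
      λ l → affineHull-≈ (upperᴷ-linear w (2 + l)) (λ p Sp → proj₂ (tight p Sp) l) x x∈

  module _ {n : ℕ} where

    private
      P = parkingPolytope n

    parking∈P : ∀ {α : Vector ℕ n} → IsParkingFunction α → P (ι ∘ α)
    parking∈P {α} p = singleton-hull {S = ParkingPoint n} (α , p , λ _ → K.refl) (λ _ → K.refl)

    1≤coordinate : ∀ {x} → P x → ∀ i → 1# ≤ᴷ x i
    1≤coordinate {x} Px i = convexHull-≥ (coordinate-linear i) {S = ParkingPoint n}
      (λ { p (α , park , p≋) → ≤-resp ι-one (K.sym (p≋ i)) (ι-mono (parking-positive park i)) }) x Px

    upperᴷ-≤ : ∀ (w : Vector ℕ n) {x} → P x → ∀ l → upperᴷ w (2 + l) x ≤ᴷ upperᴷ w (2 + l) (ι ∘ base w)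
    upperᴷ-≤ w {x} Px l = convexHull-≤ (upperᴷ-linear w (2 + l)) {S = ParkingPoint n}
      (λ { p (α , park , p≋) → ≤-resp
             (K.trans (upperᴷ-ι w (2 + l) α) (congruent (upperᴷ-linear w (2 + l)) (K.sym ∘ p≋)))
             (upperᴷ-ι w (2 + l) (base w))
             (ι-mono (upper-parking-≤ w park l)) }) x Px

  -- w records the signs of the coefficients of a and the order of the
  -- positive ones, whose successive differences are the gaps.
  record Pattern {n} (a : Point n) (r : ℕ) (w : Vector ℕ n) : Set (c Level.⊔ ℓ₁ Level.⊔ ℓ₂) where
    field
      gap      : Fin r → Carrier
      gap>0    : ∀ j → gap j >0
      negative : ∀ i → w i ≡ 0 → a i <0
      value    : ∀ i → 1 ≤ w i → a i ≈ ∑ (λ j → mask (2 + toℕ j ≤? w i) (gap j))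

  module Maximum {n r} {a : Point n} {w : Vector ℕ n} (bound : ∀ i → w i ≤ suc r) (pattern′ : Pattern a r w) where

    open Pattern pattern′

    private
      β : Point n
      β = ι ∘ base w

      N : Point n → Fin n → Carrier
      N x i = mask (w i ≟ 0) (a i *ᴷ x i)

      T : Point n → Fin r → Carrier
      T x j = gap j *ᴷ upperᴷ w (2 + toℕ j) x

      term : ∀ x i → a i *ᴷ x i ≈ N x i +ᴷ ∑ (λ j → gap j *ᴷ mask (2 + toℕ j ≤? w i) (x i))
      term x i = go (w i) refl
        where
        go : ∀ k → w i ≡ k → a i *ᴷ x i ≈ N x i +ᴷ ∑ (λ j → gap j *ᴷ mask (2 + toℕ j ≤? w i) (x i))
        go zero w≡0 = K.sym (K.trans
          (K.+-cong (mask-yes (w i ≟ 0) w≡0)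
             (∑-zero λ (j : Fin r) → K.trans (K.*-congˡ (mask-no (2 + toℕ j ≤? w i)
                (λ le → contradiction (subst (2 + toℕ j ≤_) w≡0 le) λ ()))) (K.zeroʳ (gap j))))
          (K.+-identityʳ _))
        go (suc k) w≡ = begin
          a i *ᴷ x i
            ≈⟨ K.*-congʳ (value i (subst (1 ≤_) (sym w≡) (s≤s z≤n))) ⟩
          ∑ (λ j → mask (2 + toℕ j ≤? w i) (gap j)) *ᴷ x i
            ≈⟨ *-distribʳ-sum (x i) (λ j → mask (2 + toℕ j ≤? w i) (gap j)) ⟩
          ∑ (λ j → mask (2 + toℕ j ≤? w i) (gap j) *ᴷ x i)
            ≈⟨ ∑-cong (λ j → mask-* (2 + toℕ j ≤? w i) (gap j) (x i)) ⟩
          ∑ (λ j → gap j *ᴷ mask (2 + toℕ j ≤? w i) (x i))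
            ≈⟨ K.+-identityˡ _ ⟨
          0# +ᴷ ∑ (λ j → gap j *ᴷ mask (2 + toℕ j ≤? w i) (x i))
            ≈⟨ K.+-congʳ (mask-no (w i ≟ 0) (λ e → contradiction (trans (sym e) w≡) λ ())) ⟨
          N x i +ᴷ ∑ (λ j → gap j *ᴷ mask (2 + toℕ j ≤? w i) (x i)) ∎

      -- Abel summation: a nonnegative coefficient is the sum of the gaps up to its label, so
      -- exchanging the sums collects, for each gap, the coordinates at or above its level.
      decomposition : ∀ x → a · x ≈ ∑ (N x) +ᴷ ∑ (T x)
      decomposition x = begin
        ∑ (λ i → a i *ᴷ x i)
          ≈⟨ ∑-cong (term x) ⟩
        ∑ (λ i → N x i +ᴷ ∑ (λ j → gap j *ᴷ mask (2 + toℕ j ≤? w i) (x i)))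
          ≈⟨ ∑-distrib-+ (N x) _ ⟩
        ∑ (N x) +ᴷ ∑ (λ i → ∑ (λ j → gap j *ᴷ mask (2 + toℕ j ≤? w i) (x i)))
          ≈⟨ K.+-congˡ (∑-comm (λ i j → gap j *ᴷ mask (2 + toℕ j ≤? w i) (x i))) ⟩
        ∑ (N x) +ᴷ ∑ (λ j → ∑ (λ i → gap j *ᴷ mask (2 + toℕ j ≤? w i) (x i)))
          ≈⟨ K.+-congˡ (∑-cong λ j → K.sym (*-distribˡ-sum (gap j) (λ i → mask (2 + toℕ j ≤? w i) (x i)))) ⟩
        ∑ (N x) +ᴷ ∑ (T x) ∎

      β≈1 : ∀ {i} → w i ≡ 0 → β i ≈ 1#
      β≈1 w≡0 = proj₁ (Tightℕ⇒Tight (base-tight w)) _ w≡0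

      module _ {x} (Px : parkingPolytope n x) where

        N-≤ : ∀ i → N x i ≤ᴷ N β i
        N-≤ i = mask-mono (w i ≟ 0) λ w≡0 → *ᴷ-antimonoˡ-≤ (proj₁ (negative i w≡0))
          (≤-resp (K.sym (β≈1 w≡0)) K.refl (1≤coordinate Px i))

        T-≤ : ∀ j → T x j ≤ᴷ T β j
        T-≤ j = *ᴷ-monoˡ-≤ (proj₁ (gap>0 j)) (upperᴷ-≤ w Px (toℕ j))

    maximum : ∀ {x} → parkingPolytope n x → a · x ≤ᴷ a · β
    maximum {x} Px = ≤-resp (K.sym (decomposition x)) (K.sym (decomposition β))
      (+ᴷ-mono-≤ (∑-mono (N-≤ Px)) (∑-mono (T-≤ Px)))

    maximal⇒tight : ∀ {x} → parkingPolytope n x → a · x ≈ a · β → Tight w x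
    maximal⇒tight {x} Px eq = ones , levels
      where
      both = +ᴷ-pinch (∑-mono (N-≤ Px)) (∑-mono (T-≤ Px))
               (K.trans (K.sym (decomposition x)) (K.trans eq (decomposition β)))
      ones : ∀ i → w i ≡ 0 → x i ≈ 1#
      ones i w≡0 = K.trans
        (*ᴷ-cancelˡ (proj₂ (negative i w≡0))
          (K.trans (K.sym (mask-yes (w i ≟ 0) w≡0))
             (K.trans (∑-pinch (N-≤ Px) (proj₁ both) i) (mask-yes (w i ≟ 0) w≡0))))
        (β≈1 w≡0)
      levels : ∀ l → upperᴷ w (2 + l) x ≈ upperᴷ w (2 + l) β
      levels l with l <? r
      ... | yes l<r = subst (λ k → upperᴷ w (2 + k) x ≈ upperᴷ w (2 + k) β) (toℕ-fromℕ< l<r)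
            (*ᴷ-cancelˡ (proj₂ (gap>0 j)) (∑-pinch (T-≤ Px) (proj₂ both) j))
        where j = fromℕ< l<r
      -- There is no gap for such a level, but no label reaches it either, so both sums are empty.
      ... | no l≮r = K.trans (∑-zero (λ i → mask-no (2 + l ≤? w i) (high i)))
                       (K.sym (∑-zero (λ i → mask-no (2 + l ≤? w i) (high i))))
        where
        high : ∀ i → ¬ 2 + l ≤ w i
        high i le = l≮r (≤-pred (≤-trans le (bound i)))

    tight⇒maximal : ∀ {x} → Tight w x → a · x ≈ a · β
    tight⇒maximal {x} (ones , levels) = K.trans (decomposition x) (K.trans
      (K.+-cong
        (∑-cong λ i → mask-cong (w i ≟ 0) λ w≡0 → K.*-congˡ (K.trans (ones i w≡0) (K.sym (β≈1 w≡0))))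
        (∑-cong {f = T x} λ j → K.*-congˡ (levels (toℕ j))))
      (K.sym (decomposition β)))

  _>0? : ∀ x → Dec (x >0)
  x >0? = (0# ≤ᴷ.≤? x) ×-dec ¬? (x ≤ᴷ.≟ 0#)

  ≯0⇒≤0 : ∀ {x} → ¬ (x >0) → x ≤ᴷ 0#
  ≯0⇒≤0 {x} x≯0 with ≤ᴷ.total x 0# | x ≤ᴷ.≟ 0#
  ... | inj₁ x≤0 | _       = x≤0
  ... | inj₂ 0≤x | yes x≈0 = ≤ᴷ.reflexive x≈0
  ... | inj₂ 0≤x | no x≉0  = contradiction (0≤x , x≉0) x≯0

  argmin : ∀ {n} (a : Point n) {p} {P : Pred (Fin n) p} → Decidable P → ∀ i → P i →
           ∃[ k ] P k × (∀ j → P j → a k ≤ᴷ a j)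
  argmin {suc n} a {P = P} P? i Pi with any? (P? ∘ suc)
  argmin {suc n} a P? zero    Pi | no none = zero , Pi , λ
    { zero _ → ≤ᴷ.reflexive K.refl ; (suc j) Pj → contradiction (j , Pj) none }
  argmin {suc n} a P? (suc i) Pi | no none = contradiction (i , Pi) none
  argmin {suc n} a P? i       Pi | yes (j , Pj) with argmin (a ∘ suc) (P? ∘ suc) j Pj | P? zero
  ... | k , Pk , min | no ¬Pz = suc k , Pk , λ
    { zero Pz → contradiction Pz ¬Pz ; (suc j) Pj → min j Pj }
  ... | k , Pk , min | yes Pz with ≤ᴷ.total (a zero) (a (suc k))
  ...   | inj₁ le = zero , Pz , λ { zero _ → ≤ᴷ.reflexive K.refl ; (suc j) Pj → ≤ᴷ.trans le (min j Pj) }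
  ...   | inj₂ ge = suc k , Pk , λ { zero _ → ge ; (suc j) Pj → min j Pj }

  module _ {n r} {a : Point n} {w : Vector ℕ n} (pattern′ : Pattern a r w) where

    open Pattern pattern′

    0≤⇒1≤label : ∀ {i} → 0# ≤ᴷ a i → 1 ≤ w i
    0≤⇒1≤label {i} 0≤a = n≢0⇒n>0 λ w≡0 →
      proj₂ (negative i w≡0) (≤ᴷ.antisym (proj₁ (negative i w≡0)) 0≤a)

    label≡1⇒≈0 : ∀ {i} → w i ≡ 1 → a i ≈ 0#
    label≡1⇒≈0 {i} w≡1 = K.trans (value i (≤-reflexive (sym w≡1)))
      (∑-zero λ (j : Fin r) → mask-no (2 + toℕ j ≤? w i) λ le → contradiction (subst (2 + toℕ j ≤_) w≡1 le) λ { (s≤s ()) })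

    -- The lowest gap occurs in the sum for `a i`. A vanishing sum of nonnegative terms would make
    -- it zero.
    2≤label⇒>0 : (∀ i → w i ≤ suc r) → ∀ {i} → 2 ≤ w i → a i >0
    2≤label⇒>0 bound {i} 2≤w = 0≤a , λ a≈0 → proj₂ (gap>0 j)
      (K.trans (K.sym (mask-yes (2 + toℕ j ≤? w i) (subst (λ k → 2 + k ≤ w i) (sym (toℕ-fromℕ< 0<r)) 2≤w)))
        (K.sym (∑-pinch mask≥0 (K.trans (∑-zero λ (_ : Fin r) → K.refl) (K.trans (K.sym a≈0) a≈∑)) j)))
      where
      0<r : 0 < r
      0<r = ≤-pred (≤-trans 2≤w (bound i))
      j = fromℕ< 0<r
      a≈∑ = value i (≤-trans (s≤s z≤n) 2≤w)
      mask≥0 : ∀ j → 0# ≤ᴷ mask (2 + toℕ j ≤? w i) (gap j)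
      mask≥0 j = mask-nonneg (2 + toℕ j ≤? w i) (proj₁ (gap>0 j))
      0≤a : 0# ≤ᴷ a i
      0≤a = ≤-resp (∑-zero {f = λ (_ : Fin r) → 0#} λ _ → K.refl) (K.sym a≈∑) (∑-mono mask≥0)

  record Labelling {n} (a : Point n) : Set (c Level.⊔ ℓ₁ Level.⊔ ℓ₂) where
    field
      {zeros′ rank′} : ℕ
      labels         : Vector ℕ n
      isWord         : IsWord zeros′ rank′ labels
      hasPattern     : Pattern a rank′ labels

  -- Lower all positive coefficients by the smallest of them, until none is left.
  labelling : ∀ {n} (a : Point n) → Labelling a
  labelling {n} a = go (count (_>0? ∘ a)) a ≤-refl
    where
    go : ∀ k (a : Point n) → count (_>0? ∘ a) ≤ k → Labelling a
    go k a le with any? (_>0? ∘ a)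
    go k a le | no none = record
      { labels = w
      ; isWord = record { bounded = λ i → ind≤1 (0# ≤ᴷ.≤? a i) ; hits = λ _ () ; zeros = refl }
      ; hasPattern = record
        { gap = λ () ; gap>0 = λ () ; negative = negative ; value = value }
      }
      where
      w : Vector ℕ n
      -- No coefficient is positive here, so a nonnegative one is zero and receives label 1.
      w i = ind (0# ≤ᴷ.≤? a i)
      negative : ∀ i → w i ≡ 0 → a i <0
      negative i w≡0 = ≯0⇒≤0 (λ pos → none (i , pos)) , λ a≈0 →
        contradiction (trans (sym w≡0) (ind-yes (0# ≤ᴷ.≤? a i) (≤ᴷ.reflexive (K.sym a≈0)))) λ ()
      value : ∀ i → 1 ≤ w i → a i ≈ 0#
      value i 1≤w with 0# ≤ᴷ.≤? a i
      ... | yes 0≤a = ≤ᴷ.antisym (≯0⇒≤0 (λ pos → none (i , pos))) 0≤a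
      ... | no  _ with () ← 1≤w
    go zero a le | yes (i , pos) = contradiction le (<⇒≱ (count>0 (_>0? ∘ a) i pos))
    go (suc k) a le | yes (i , pos) = record
      { labels = w
      ; isWord = record { bounded = w-bound ; hits = hit ; zeros = refl }
      ; hasPattern = record { gap = gap′ ; gap>0 = gap′>0 ; negative = negative′ ; value = value′ }
      }
      where
      i₀  = proj₁ (argmin a (_>0? ∘ a) i pos)
      v   = a i₀
      v>0 : v >0
      v>0 = proj₁ (proj₂ (argmin a (_>0? ∘ a) i pos))
      v-min : ∀ j → a j >0 → v ≤ᴷ a j
      v-min = proj₂ (proj₂ (argmin a (_>0? ∘ a) i pos))
      b : Point n
      b i = a i +ᴷ - mask (a i >0?) v
      a≈ : ∀ i → a i ≈ mask (a i >0?) v +ᴷ b i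
      a≈ i = K.sym (x+[y-x]≈y _ (a i))
      a≈b : ∀ {i} → ¬ (a i >0) → a i ≈ b i
      a≈b {i} a≯0 = K.trans (a≈ i) (K.trans (K.+-congʳ (mask-no (a i >0?) a≯0)) (K.+-identityˡ _))
      a≈v+b : ∀ {i} → a i >0 → a i ≈ v +ᴷ b i
      a≈v+b {i} a>0 = K.trans (a≈ i) (K.+-congʳ (mask-yes (a i >0?) a>0))
      0≤b : ∀ {i} → a i >0 → 0# ≤ᴷ b i
      0≤b {i} a>0 = +ᴷ-cancelˡ-≤ v (≤-resp (K.sym (K.+-identityʳ v)) (a≈v+b a>0) (v-min i a>0))
      b₀≈0 : b i₀ ≈ 0#
      b₀≈0 = +ᴷ-cancelˡ v _ _ (K.trans (K.sym (a≈v+b v>0)) (K.sym (K.+-identityʳ v)))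
      b>0⇒a>0 : ∀ i → b i >0 → a i >0
      b>0⇒a>0 i b>0 = by-sign (a i >0?)
        where
        by-sign : Dec (a i >0) → a i >0
        by-sign (yes a>0) = a>0
        by-sign (no a≯0)  = ≤-resp K.refl (K.sym (a≈b a≯0)) (proj₁ b>0) ,
                            λ a≈0 → proj₂ b>0 (K.trans (K.sym (a≈b a≯0)) a≈0)
      rec : Labelling b
      rec = go k b (≤-pred (≤-trans (count-mono-< (_>0? ∘ b) (_>0? ∘ a) b>0⇒a>0 i₀ (λ b>0 → proj₂ b>0 b₀≈0) v>0) le))
      open Labelling rec renaming (labels to w′; rank′ to r; isWord to W; hasPattern to pat)
      open Pattern pat
      w : Vector ℕ n
      -- The smallest positive coefficients have become zero and carry label 1 in `w′`. Shifting all
      -- formerly positive coefficients by one puts these into the new lowest level 2, apart from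
      -- the original zeros.
      w i = ind (a i >0?) + w′ i
      w-pos : ∀ {i} → a i >0 → w i ≡ suc (w′ i)
      w-pos {i} a>0 = cong (_+ w′ i) (ind-yes (a i >0?) a>0)
      w-nonpos : ∀ {i} → ¬ (a i >0) → w i ≡ w′ i
      w-nonpos {i} a≯0 = cong (_+ w′ i) (ind-no (a i >0?) a≯0)
      w-bound : ∀ i → w i ≤ suc (suc r)
      w-bound i = +-mono-≤ (ind≤1 (a i >0?)) (bounded W i)
      hit : ∀ j → j < suc r → ∃[ i ] w i ≡ 2 + j
      hit zero    _   = i₀ , trans (w-pos v>0) (cong suc (≤-antisym
        (≮⇒≥ λ 2≤w → proj₂ (2≤label⇒>0 pat (bounded W) 2≤w) b₀≈0)
        (0≤⇒1≤label pat (≤ᴷ.reflexive (K.sym b₀≈0)))))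
      hit (suc j) j<r =
        let (i , w′i) = hits W j (≤-pred j<r) in
        i , trans (w-pos (b>0⇒a>0 i (2≤label⇒>0 pat (bounded W) (subst (2 ≤_) (sym w′i) (s≤s (s≤s z≤n))))))
                  (cong suc w′i)
      gap′ : Fin (suc r) → Carrier
      gap′ zero    = v
      gap′ (suc j) = gap j
      gap′>0 : ∀ j → gap′ j >0
      gap′>0 zero    = v>0
      gap′>0 (suc j) = gap>0 j
      negative′ : ∀ i → w i ≡ 0 → a i <0
      negative′ i w≡0 = ≤-resp (K.sym (a≈b a≯0)) K.refl (proj₁ b<0) ,
                        λ a≈0 → proj₂ b<0 (K.trans (K.sym (a≈b a≯0)) a≈0)
        where
        a≯0 : ¬ (a i >0)
        a≯0 a>0 = contradiction (trans (sym w≡0) (w-pos a>0)) λ ()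
        b<0 : b i <0
        b<0 = negative i (trans (sym (w-nonpos a≯0)) w≡0)
      levels : Fin n → ℕ → Carrier
      levels i x = ∑ (λ j → mask (2 + toℕ j ≤? x) (gap′ j))
      value′ : ∀ i → 1 ≤ w i → a i ≈ levels i (w i)
      value′ i 1≤w = by-sign (a i >0?)
        where
        by-sign : Dec (a i >0) → a i ≈ levels i (w i)
        by-sign (yes a>0) = K.trans (a≈v+b a>0) (K.trans
          (K.+-cong (K.sym (mask-yes (2 ≤? suc (w′ i)) (s≤s 1≤w′))) (value i 1≤w′))
          (K.reflexive (cong (levels i) (sym (w-pos a>0)))))
          where 1≤w′ = 0≤⇒1≤label pat (0≤b a>0)
        by-sign (no a≯0) = K.trans (a≈b a≯0) (K.trans (label≡1⇒≈0 pat w′≡1) (K.sym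
          (∑-zero λ (j : Fin (suc r)) → mask-no (2 + toℕ j ≤? w i) {gap′ j}
             λ le → contradiction (subst (2 + toℕ j ≤_) (trans (w-nonpos a≯0) w′≡1) le) λ { (s≤s ()) })))
          where
          w′≡1 : w′ i ≡ 1
          w′≡1 = ≤-antisym (≮⇒≥ λ 2≤w′ → a≯0 (b>0⇒a>0 i (2≤label⇒>0 pat (bounded W) 2≤w′)))
                           (subst (1 ≤_) (w-nonpos a≯0) 1≤w)

  -- The simplest functional with the pattern `w`: all gaps are `1#`, and the coefficient at label 0
  -- is `- 1#`.
  functional : ∀ {n} → ℕ → Vector ℕ n → Point n
  functional r w i = if-zero (w i ≟ 0) (∑ (λ (j : Fin r) → mask (2 + toℕ j ≤? w i) 1#))
    where
    if-zero : ∀ {p} {P : Set p} → Dec P → Carrier → Carrier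
    if-zero (yes _) x = - 1#
    if-zero (no _)  x = x

  functional-pattern : ∀ {n} r (w : Vector ℕ n) → Pattern (functional r w) r w
  functional-pattern r w = record
    { gap = λ _ → 1# ; gap>0 = λ _ → 1>0 ; negative = negative ; value = value }
    where
    negative : ∀ i → w i ≡ 0 → functional r w i <0
    negative i w≡0 with w i ≟ 0
    ... | yes _   = +ᴷ-cancelˡ-≤ 1# (≤-resp (K.sym (K.-‿inverseʳ 1#)) (K.sym (K.+-identityʳ 1#)) 0≤1) ,
                    λ -1≈0 → K.0≉1 (K.trans (K.sym (K.-‿inverseʳ 1#)) (K.trans (K.+-congˡ -1≈0) (K.+-identityʳ 1#)))
    ... | no  w≢0 = contradiction w≡0 w≢0
    value : ∀ i → 1 ≤ w i → functional r w i ≈ ∑ (λ (j : Fin r) → mask (2 + toℕ j ≤? w i) 1#)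
    value i 1≤w with w i ≟ 0
    ... | yes w≡0 = contradiction (subst (1 ≤_) w≡0 1≤w) λ ()
    ... | no  _   = K.refl

-- Dimension

record Enumeration {n p} (P : Pred (Fin n) p) (k : ℕ) : Set p where
  field
    at        : Fin k → Fin n
    holds     : ∀ f → P (at f)
    index     : ∀ i → P i → ∃[ f ] at f ≡ i
    injective : Injective _≡_ _≡_ at

enumerate : ∀ {n p} {P : Pred (Fin n) p} (P? : Decidable P) → Enumeration P (count P?)
enumerate {zero} P? = record { at = λ () ; holds = λ () ; index = λ () ; injective = λ { {()} } }
enumerate {suc n} {P = P} P? = extend (P? zero) (enumerate (P? ∘ suc))
  where
  extend : ∀ {k} (d : Dec (P zero)) → Enumeration (P ∘ suc) k → Enumeration P (ind d + k)
  extend (yes Pz) E = record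
    { at        = λ { zero → zero ; (suc f) → suc (at f) }
    ; holds     = λ { zero → Pz ; (suc f) → holds f }
    ; index     = λ { zero _ → zero , refl ; (suc i) Pi → let (f , e) = index i Pi in suc f , cong suc e }
    ; injective = λ { {zero} {zero} _ → refl ; {suc f} {suc g} e → cong suc (injective (sucF-injective e)) }
    } where open Enumeration E
  extend (no ¬Pz) E = record
    { at        = suc ∘ at
    ; holds     = holds
    ; index     = λ { zero Pz → contradiction Pz ¬Pz ; (suc i) Pi → let (f , e) = index i Pi in f , cong suc e }
    ; injective = injective ∘ sucF-injective
    } where open Enumeration E

count-image : ∀ {n r} (h : Fin r → Fin n) → Injective _≡_ _≡_ h →
              count (λ i → any? (λ j → i ≟F h j)) ≡ r
count-image {n} {r} h h-inj = begin
  ∑ℕ (λ i → ind (any? (λ j → i ≟F h j)))        ≡⟨ ∑ℕ-cong (λ i → preimages i (any? (λ j → i ≟F h j))) ⟩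
  ∑ℕ (λ i → ∑ℕ (λ j → ind (i ≟F h j)))          ≡⟨ ∑ℕ-comm (λ i j → ind (i ≟F h j)) ⟩
  ∑ℕ (λ j → ∑ℕ (λ i → ind (i ≟F h j)))          ≡⟨ ∑ℕ-cong (λ j → count-≡ (h j)) ⟩
  ∑ℕ {r} (λ _ → 1)                              ≡⟨ ∑ℕ-ones r ⟩
  r                                             ∎
  where
  open ≡-Reasoning
  preimages : ∀ i (d : Dec (∃[ j ] i ≡ h j)) → ind d ≡ ∑ℕ (λ j → ind (i ≟F h j))
  preimages i (yes (j , refl)) = sym (trans
    (count-cong (λ k → h j ≟F h k) (_≟F j) (λ _ e → sym (h-inj e)) (λ { _ refl → refl })) (count-≡ j))
  preimages i (no none) = sym (count≡0 (λ j → i ≟F h j) λ j e → none (j , e))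

module FreeCoordinates {n m r} {w : Vector ℕ n} (W : IsWord m r w) where

  -- The coordinate of each level set that its level equation expresses through the others.
  pivot : Fin r → Fin n
  pivot j = proj₁ (hits W (toℕ j) (toℕ<n j))

  pivot-label : ∀ j → w (pivot j) ≡ 2 + toℕ j
  pivot-label j = proj₂ (hits W (toℕ j) (toℕ<n j))

  pivot-injective : Injective _≡_ _≡_ pivot
  pivot-injective {j} {k} e = toℕ-injective (suc-injective (suc-injective
    (trans (sym (pivot-label j)) (trans (cong w e) (pivot-label k)))))

  Free : Pred (Fin n) _
  Free i = ¬ (w i ≡ 0) × ¬ (∃[ j ] i ≡ pivot j)

  free? : Decidable Free
  free? i = ¬? (w i ≟ 0) ×-dec ¬? (any? (λ j → i ≟F pivot j))

  count-free : count free? + (m + r) ≡ n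
  count-free = begin
    count free? + (m + r)
      ≡⟨ cong₂ (λ a b → count free? + (a + b)) (sym (zeros W)) (sym (count-image pivot pivot-injective)) ⟩
    count free? + (count (λ i → w i ≟ 0) + count (λ i → any? (λ j → i ≟F pivot j)))
      ≡⟨ cong (count free? +_) (sym (∑ℕ-distrib-+ (λ i → ind (w i ≟ 0)) _)) ⟩
    count free? + ∑ℕ (λ i → ind (w i ≟ 0) + ind (any? (λ j → i ≟F pivot j)))
      ≡⟨ sym (∑ℕ-distrib-+ (λ i → ind (free? i)) _) ⟩
    ∑ℕ (λ i → ind (free? i) + (ind (w i ≟ 0) + ind (any? (λ j → i ≟F pivot j))))
      ≡⟨ ∑ℕ-cong (λ i → once i (w i ≟ 0) (any? (λ j → i ≟F pivot j))) ⟩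
    ∑ℕ {n} (λ _ → 1)
      ≡⟨ ∑ℕ-ones n ⟩
    n ∎
    where
    open ≡-Reasoning
    once : ∀ i (d : Dec (w i ≡ 0)) (e : Dec (∃[ j ] i ≡ pivot j)) →
           ind (¬? d ×-dec ¬? e) + (ind d + ind e) ≡ 1
    once i (yes w≡0) (yes (j , refl)) = contradiction (trans (sym w≡0) (pivot-label j)) λ ()
    once i (yes _)   (no _)           = refl
    once i (no _)    (yes _)          = refl
    once i (no _)    (no _)           = refl

  -- Among the free coordinates only `i` may move, so the differences from `base w` form a diagonal
  -- matrix there. Pivots may change as well.
  record Variation (i : Fin n) : Set where
    field
      point   : Vector ℕ n
      parking : IsParkingFunction point
      tight   : Tightℕ w point
      differs : point i ≢ base w i
      agrees  : ∀ k → Free k → k ≢ i → point k ≡ base w k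

  -- For label 1 the coordinate is raised, which needs a second low one. For a higher label its
  -- value is exchanged with that of the pivot of the same level set, and the pivot is not free.
  variation : low w ≢ 1 → ∀ i → Free i → Variation i
  variation low≢1 i (w≢0 , ¬pivot) = by-label (w i) refl
    where
    by-label : ∀ x → w i ≡ x → Variation i
    by-label 0 eq = contradiction eq w≢0
    by-label 1 eq = record
      { point   = raised w i
      ; parking = raised-parking w low≢1 eq
      ; tight   = raised-tight w eq
      ; differs = λ e → 1+n≢n (trans (sym (raised-at w i)) e)
      ; agrees  = λ k _ k≢i → raised-other w i k≢i
      }
    by-label (suc (suc l)) eq = record
      { point   = swapped w p i
      ; parking = swapped-parking w p i
      ; tight   = swapped-tight w 2≤wp wp≡wi
      ; differs = λ e → p≢i (base-distinct w 2≤wp (subst (2 ≤_) wp≡wi 2≤wp)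
                               (trans (sym (transposed-right (base w) p i)) e))
      ; agrees  = λ k free k≢i → transposed-other (base w) p i (λ e → proj₂ free (j , e)) k≢i
      }
      where
      l<r : l < r
      l<r = ≤-pred (subst (_≤ suc r) eq (bounded W i))
      j = fromℕ< l<r
      p = pivot j
      wp≡ : w p ≡ 2 + l
      wp≡ = trans (pivot-label j) (cong (2 +_) (toℕ-fromℕ< l<r))
      wp≡wi : w p ≡ w i
      wp≡wi = trans wp≡ (sym eq)
      2≤wp : 2 ≤ w p
      2≤wp = subst (2 ≤_) (sym wp≡) (s≤s (s≤s z≤n))
      p≢i : p ≢ i
      p≢i e = ¬pivot (j , sym e)

module Dimension {c ℓ₁ ℓ₂ : Level} (K : OrderedField c ℓ₁ ℓ₂) where

  open Geometry K
  open OrderedFieldProperties K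
  open MaximalFaces K
  open RingProperties K.ring using (-‿distribˡ-*)
    renaming (+-cancelʳ to +ᴷ-cancelʳ)
  open Sum K.semiring using (*-distribˡ-sum; *-distribʳ-sum; ∑-distrib-+; ∑-comm)
  open SetoidReasoning K.setoid

  -- Gaussian elimination. A zero first vector is a dependence by itself; otherwise a nonzero entry
  -- of it clears one column of the other vectors, and one coordinate is dropped.
  linear-dependence : ∀ k m (A : Fin (suc m) → Fin k → Carrier) → k ≤ m →
    Σ (Vector Carrier (suc m)) λ t → (∃[ i ] ¬ (t i ≈ 0#)) × (∀ j → ∑ (λ i → t i *ᴷ A i j) ≈ 0#)
  linear-dependence zero    m       A k≤m = (λ _ → 1#) , (zero , proj₂ 1>0) , λ ()
  linear-dependence (suc k) (suc m) A (s≤s k≤m) with any? (λ j → ¬? (A zero j ≤ᴷ.≟ 0#))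
  ... | no none = t , (zero , proj₂ 1>0) , λ j → K.trans
      (∑-single {f = λ i → t i *ᴷ A i j} zero
         (λ { zero 0≢0 → contradiction refl 0≢0 ; (suc i) _ → K.zeroˡ (A (suc i) j) }))
      (K.trans (K.*-identityˡ _) (zero-row j (A zero j ≤ᴷ.≟ 0#)))
    where
    t : Vector Carrier (suc (suc m))
    t zero    = 1#
    t (suc _) = 0#
    zero-row : ∀ j → Dec (A zero j ≈ 0#) → A zero j ≈ 0#
    zero-row j (yes e) = e
    zero-row j (no ≉0) = contradiction (j , ≉0) none
  ... | yes (j₀ , ≉0) = t , (suc (proj₁ t′≉0) , proj₂ t′≉0) , λ j → vanishes j (j₀ ≟F j)
    where
    z = proj₁ (K.inverse (A zero j₀) ≉0)
    q : Fin (suc m) → Carrier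
    q i = A (suc i) j₀ *ᴷ z
    A′ : Fin (suc m) → Fin k → Carrier
    A′ i j = A (suc i) (punchIn j₀ j) +ᴷ - (q i *ᴷ A zero (punchIn j₀ j))
    rec  = linear-dependence k m A′ k≤m
    t′   = proj₁ rec
    t′≉0 = proj₁ (proj₂ rec)
    Q    = ∑ (λ i → t′ i *ᴷ q i)
    t : Vector Carrier (suc (suc m))
    -- This undoes the multiples of the first vector that were subtracted from the others.
    t zero    = - Q
    t (suc i) = t′ i
    column : ∀ j → ∑ (λ i → t′ i *ᴷ A (suc i) j) ≈ ∑ (λ i → t′ i *ᴷ (q i *ᴷ A zero j)) →
             ∑ (λ i → t i *ᴷ A i j) ≈ 0#
    column j eq = begin
      - Q *ᴷ A zero j +ᴷ ∑ (λ i → t′ i *ᴷ A (suc i) j)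
        ≈⟨ K.+-cong (K.sym (-‿distribˡ-* Q (A zero j))) eq ⟩
      - (Q *ᴷ A zero j) +ᴷ ∑ (λ i → t′ i *ᴷ (q i *ᴷ A zero j))
        ≈⟨ K.+-congˡ (∑-cong λ i → K.sym (K.*-assoc (t′ i) (q i) (A zero j))) ⟩
      - (Q *ᴷ A zero j) +ᴷ ∑ (λ i → t′ i *ᴷ q i *ᴷ A zero j)
        ≈⟨ K.+-congˡ (K.sym (*-distribʳ-sum (A zero j) (λ i → t′ i *ᴷ q i))) ⟩
      - (Q *ᴷ A zero j) +ᴷ Q *ᴷ A zero j
        ≈⟨ K.-‿inverseˡ _ ⟩
      0# ∎
    vanishes : ∀ j → Dec (j₀ ≡ j) → ∑ (λ i → t i *ᴷ A i j) ≈ 0#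
    vanishes j (yes refl) = column j₀ (∑-cong λ i → K.*-congˡ {t′ i} (K.sym (begin
      A (suc i) j₀ *ᴷ z *ᴷ A zero j₀   ≈⟨ K.*-assoc (A (suc i) j₀) z (A zero j₀) ⟩
      A (suc i) j₀ *ᴷ (z *ᴷ A zero j₀) ≈⟨ K.*-congˡ (K.trans (K.*-comm z (A zero j₀)) (proj₂ (K.inverse (A zero j₀) ≉0))) ⟩
      A (suc i) j₀ *ᴷ 1#               ≈⟨ K.*-identityʳ _ ⟩
      A (suc i) j₀                     ∎)))
    vanishes j (no j₀≢j) = subst (λ j → ∑ (λ i → t i *ᴷ A i j) ≈ 0#) (punchIn-punchOut j₀≢j) (column j′ (begin
      ∑ (λ i → t′ i *ᴷ A (suc i) j′)
        ≈⟨ ∑-cong (λ i → K.trans (K.*-congˡ (K.sym (x+[y-x]≈y (q i *ᴷ A zero j′) (A (suc i) j′)))) (K.distribˡ (t′ i) _ _)) ⟩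
      ∑ (λ i → t′ i *ᴷ (q i *ᴷ A zero j′) +ᴷ t′ i *ᴷ A′ i (punchOut j₀≢j))
        ≈⟨ ∑-distrib-+ (λ i → t′ i *ᴷ (q i *ᴷ A zero j′)) (λ i → t′ i *ᴷ A′ i (punchOut j₀≢j)) ⟩
      ∑ (λ i → t′ i *ᴷ (q i *ᴷ A zero j′)) +ᴷ ∑ (λ i → t′ i *ᴷ A′ i (punchOut j₀≢j))
        ≈⟨ K.+-congˡ (proj₂ (proj₂ rec) (punchOut j₀≢j)) ⟩
      ∑ (λ i → t′ i *ᴷ (q i *ᴷ A zero j′)) +ᴷ 0#
        ≈⟨ K.+-identityʳ _ ⟩
      ∑ (λ i → t′ i *ᴷ (q i *ᴷ A zero j′)) ∎))
      where j′ = punchIn j₀ (punchOut j₀≢j)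

  -- A hull element may use the same `b i` several times; the weights of equal indices are added up.
  affine-coordinates : ∀ {n m} (b : Vector (Point n) m) x → affineHull (Range b) x →
    Σ (Vector Carrier m) λ t → ∑ t ≈ 1# × x ≋ combination t b
  affine-coordinates {n} {m} b x (k , p , t , p∈b , ∑t≈1 , x≋) = u , ∑u≈1 , x≋u
    where
    j : Fin k → Fin m
    j l = proj₁ (p∈b l)
    u : Vector Carrier m
    u i = ∑ (λ l → mask (j l ≟F i) (t l))
    spread : ∀ l (y : Vector Carrier m) → ∑ (λ i → mask (j l ≟F i) (t l) *ᴷ y i) ≈ t l *ᴷ y (j l)
    spread l y = K.trans
      (∑-single (j l) (λ i i≢ → K.trans (K.*-congʳ (mask-no (j l ≟F i) (i≢ ∘ sym))) (K.zeroˡ (y i))))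
      (K.*-congʳ (mask-yes (j l ≟F j l) refl))
    regroup : ∀ (y : Vector Carrier m) → ∑ (λ i → u i *ᴷ y i) ≈ ∑ (λ l → t l *ᴷ y (j l))
    regroup y = begin
      ∑ (λ i → u i *ᴷ y i)
        ≈⟨ ∑-cong (λ i → *-distribʳ-sum (y i) (λ l → mask (j l ≟F i) (t l))) ⟩
      ∑ (λ i → ∑ (λ l → mask (j l ≟F i) (t l) *ᴷ y i))
        ≈⟨ ∑-comm (λ i l → mask (j l ≟F i) (t l) *ᴷ y i) ⟩
      ∑ (λ l → ∑ (λ i → mask (j l ≟F i) (t l) *ᴷ y i))
        ≈⟨ ∑-cong (λ l → spread l y) ⟩
      ∑ (λ l → t l *ᴷ y (j l)) ∎
    ∑u≈1 : ∑ u ≈ 1#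
    ∑u≈1 = begin
      ∑ u                      ≈⟨ ∑-cong (λ i → K.sym (K.*-identityʳ (u i))) ⟩
      ∑ (λ i → u i *ᴷ 1#)      ≈⟨ regroup (λ _ → 1#) ⟩
      ∑ (λ l → t l *ᴷ 1#)      ≈⟨ ∑-cong (λ l → K.*-identityʳ (t l)) ⟩
      ∑ t                      ≈⟨ ∑t≈1 ⟩
      1#                       ∎
    x≋u : x ≋ combination u b
    x≋u h = begin
      x h                              ≈⟨ x≋ h ⟩
      ∑ (λ l → t l *ᴷ p l h)           ≈⟨ ∑-cong (λ l → K.*-congˡ (proj₂ (p∈b l) h)) ⟩
      ∑ (λ l → t l *ᴷ b (j l) h)       ≈⟨ regroup (λ i → b i h) ⟨
      ∑ (λ i → u i *ᴷ b i h)           ∎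

  point∈affineHull : ∀ {n s} {S : Pred (Point n) s} {x} → S x → affineHull S x
  point∈affineHull {x = x} Sx = 1 , (λ _ → x) , (λ _ → 1#) , (λ _ → Sx) , K.+-identityʳ 1# ,
    λ j → K.sym (K.trans (K.+-identityʳ _) (K.*-identityˡ _))

  -- If `k` exceeded `l`, the coordinate vectors of the `b i` with respect to `d` would be
  -- dependent. The same weights annihilate the points themselves, and their sum is 0 because each
  -- coordinate vector has sum 1.
  independent-≤ : ∀ {n k l} {b : Vector (Point n) (suc k)} {d : Vector (Point n) (suc l)} →
    AffinelyIndependent b → (∀ i → affineHull (Range d) (b i)) → k ≤ l
  independent-≤ {n} {k} {l} {b} {d} independent b∈d = ≮⇒≥ λ l<k →
    let (t , (i , t≉0) , kernel) = linear-dependence (suc l) k A l<k in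
    t≉0 (independent t (∑t≈0 t kernel) (combination≈0 t kernel) i)
    where
    A : Fin (suc k) → Fin (suc l) → Carrier
    A i = proj₁ (affine-coordinates d (b i) (b∈d i))
    module _ (t : Vector Carrier (suc k)) (kernel : ∀ j → ∑ (λ i → t i *ᴷ A i j) ≈ 0#) where
      weighted : ∀ (y : Fin (suc l) → Carrier) → ∑ (λ i → t i *ᴷ ∑ (λ j → A i j *ᴷ y j)) ≈ 0#
      weighted y = begin
        ∑ (λ i → t i *ᴷ ∑ (λ j → A i j *ᴷ y j))
          ≈⟨ ∑-cong (λ i → K.trans (*-distribˡ-sum (t i) (λ j → A i j *ᴷ y j))
                             (∑-cong λ j → K.sym (K.*-assoc (t i) (A i j) (y j)))) ⟩
        ∑ (λ i → ∑ (λ j → t i *ᴷ A i j *ᴷ y j))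
          ≈⟨ ∑-comm (λ i j → t i *ᴷ A i j *ᴷ y j) ⟩
        ∑ (λ j → ∑ (λ i → t i *ᴷ A i j *ᴷ y j))
          ≈⟨ ∑-zero (λ j → K.trans (K.sym (*-distribʳ-sum (y j) (λ i → t i *ᴷ A i j)))
                             (K.trans (K.*-congʳ (kernel j)) (K.zeroˡ (y j)))) ⟩
        0# ∎
      ∑t≈0 : ∑ t ≈ 0#
      ∑t≈0 = K.trans (∑-cong λ i → K.trans (K.sym (K.*-identityʳ (t i))) (K.*-congˡ (K.sym (K.trans
          (∑-cong λ j → K.*-identityʳ (A i j)) (proj₁ (proj₂ (affine-coordinates d (b i) (b∈d i))))))))
        (weighted (λ _ → 1#))
      combination≈0 : combination t b ≋ (λ _ → 0#)
      combination≈0 h = K.trans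
        (∑-cong λ i → K.*-congˡ {t i} (proj₂ (proj₂ (affine-coordinates d (b i) (b∈d i))) h))
        (weighted (λ j → d j h))

  dimension-unique : ∀ {n f} {F : Pred (Point n) f} {k l} → HasDimension F k → HasDimension F l → k ≡ l
  dimension-unique (b , b-ind , F⊆b , b⊆F) (d , d-ind , F⊆d , d⊆F) = ≤-antisym
    (independent-≤ {b = b} {d} b-ind λ i → F⊆d (b⊆F (point∈affineHull {S = Range b} (i , λ _ → K.refl))))
    (independent-≤ {b = d} {b} d-ind λ i → F⊆b (d⊆F (point∈affineHull {S = Range d} (i , λ _ → K.refl))))

  face : ∀ {n} → Vector ℕ n → Pred (Point n) _
  face {n} w = parkingPolytope n ∩ Tight w

  module _ {n m r} {w : Vector ℕ n} (W : IsWord m r w) (low≢1 : low w ≢ 1) where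

    open FreeCoordinates W
    open Enumeration (enumerate free?)
    open Variation

    private
      k : ℕ
      k = count free?

      β : Point n
      β = ι ∘ base w

      V : ∀ f → Variation (at f)
      V f = variation low≢1 (at f) (holds f)

      b : Vector (Point n) (suc k)
      b zero    = β
      b (suc f) = ι ∘ point (V f)

      Δ : Fin k → Point n
      Δ f i = b (suc f) i +ᴷ - β i

      Δ-other : ∀ f g → g ≢ f → Δ g (at f) ≈ 0#
      Δ-other f g g≢f = K.trans
        (K.+-congʳ (K.reflexive (cong ι (agrees (V g) (at f) (holds f) λ e → g≢f (sym (injective e))))))
        (K.-‿inverseʳ (β (at f)))

      Δ-same : ∀ f → ¬ (Δ f (at f) ≈ 0#)
      Δ-same f e = differs (V f) (ι-injective (K.sym (y-x≈0⇒x≈y e)))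

      combination-Δ : ∀ t i → combination t b i ≈ ∑ t *ᴷ β i +ᴷ ∑ (λ f → t (suc f) *ᴷ Δ f i)
      combination-Δ t i = begin
        t zero *ᴷ β i +ᴷ ∑ (λ f → t (suc f) *ᴷ b (suc f) i)
          ≈⟨ K.+-congˡ (∑-cong λ f → K.trans (K.*-congˡ (K.sym (x+[y-x]≈y (β i) (b (suc f) i)))) (K.distribˡ (t (suc f)) _ _)) ⟩
        t zero *ᴷ β i +ᴷ ∑ (λ f → t (suc f) *ᴷ β i +ᴷ t (suc f) *ᴷ Δ f i)
          ≈⟨ K.+-congˡ (∑-distrib-+ (λ f → t (suc f) *ᴷ β i) _) ⟩
        t zero *ᴷ β i +ᴷ (∑ (λ f → t (suc f) *ᴷ β i) +ᴷ ∑ (λ f → t (suc f) *ᴷ Δ f i))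
          ≈⟨ K.+-assoc _ _ _ ⟨
        t zero *ᴷ β i +ᴷ ∑ (λ f → t (suc f) *ᴷ β i) +ᴷ ∑ (λ f → t (suc f) *ᴷ Δ f i)
          ≈⟨ K.+-congʳ (K.+-congˡ (K.sym (*-distribʳ-sum (β i) (t ∘ suc)))) ⟩
        t zero *ᴷ β i +ᴷ ∑ (t ∘ suc) *ᴷ β i +ᴷ ∑ (λ f → t (suc f) *ᴷ Δ f i)
          ≈⟨ K.+-congʳ (K.sym (K.distribʳ (β i) (t zero) _)) ⟩
        ∑ t *ᴷ β i +ᴷ ∑ (λ f → t (suc f) *ᴷ Δ f i) ∎

      combination-at : ∀ t f → combination t b (at f) ≈ ∑ t *ᴷ β (at f) +ᴷ t (suc f) *ᴷ Δ f (at f)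
      combination-at t f = K.trans (combination-Δ t (at f)) (K.+-congˡ
        (∑-single f λ g g≢f → K.trans (K.*-congˡ (Δ-other f g g≢f)) (K.zeroʳ (t (suc g)))))

      independent : AffinelyIndependent b
      independent t ∑t≈0 comb≈0 = λ { zero → t₀≈0 ; (suc f) → t≈0 f }
        where
        t≈0 : ∀ f → t (suc f) ≈ 0#
        t≈0 f = *ᴷ-cancelˡ (Δ-same f) (begin
          Δ f (at f) *ᴷ t (suc f)                        ≈⟨ K.*-comm _ _ ⟩
          t (suc f) *ᴷ Δ f (at f)                        ≈⟨ K.+-identityˡ _ ⟨
          0# +ᴷ t (suc f) *ᴷ Δ f (at f)                  ≈⟨ K.+-congʳ (K.trans (K.*-congʳ ∑t≈0) (K.zeroˡ _)) ⟨
          ∑ t *ᴷ β (at f) +ᴷ t (suc f) *ᴷ Δ f (at f)     ≈⟨ combination-at t f ⟨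
          combination t b (at f)                         ≈⟨ comb≈0 (at f) ⟩
          0#                                             ≈⟨ K.zeroʳ _ ⟨
          Δ f (at f) *ᴷ 0#                               ∎)
        t₀≈0 : t zero ≈ 0#
        t₀≈0 = K.trans (K.sym (∑-single {f = t} zero
          λ { zero 0≢0 → contradiction refl 0≢0 ; (suc f) _ → t≈0 f })) ∑t≈0

      b∈face : ∀ {x} → Range b x → face w x
      b∈face (zero , x≋) =
        singleton-hull {S = ParkingPoint n} (base w , base-parking w , λ _ → K.refl) x≋ ,
        Tight-≋ (K.sym ∘ x≋) (Tightℕ⇒Tight (base-tight w))
      b∈face (suc f , x≋) =
        singleton-hull {S = ParkingPoint n} (point (V f) , parking (V f) , λ _ → K.refl) x≋ ,
        Tight-≋ (K.sym ∘ x≋) (Tightℕ⇒Tight (tight (V f)))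

      label-split : ∀ l x → upperᴷ w (2 + l) x ≈ ∑ (λ i → mask (w i ≟ 2 + l) (x i)) +ᴷ upperᴷ w (3 + l) x
      label-split l x = K.trans (∑-cong λ i → by-label i (<-cmp (w i) (2 + l)))
                                (∑-distrib-+ (λ i → mask (w i ≟ 2 + l) (x i)) _)
        where
        by-label : ∀ i → Tri (w i < 2 + l) (w i ≡ 2 + l) (w i > 2 + l) →
          mask (2 + l ≤? w i) (x i) ≈ mask (w i ≟ 2 + l) (x i) +ᴷ mask (3 + l ≤? w i) (x i)
        by-label i (tri< lt ≢ ≯) = K.trans (mask-no (2 + l ≤? w i) (<⇒≱ lt)) (K.sym (K.trans
          (K.+-cong (mask-no (w i ≟ 2 + l) ≢) (mask-no (3 + l ≤? w i) ≯)) (K.+-identityʳ 0#)))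
        by-label i (tri≈ ≮ ≡ ≯) = K.trans (mask-yes (2 + l ≤? w i) (≮⇒≥ ≮)) (K.sym (K.trans
          (K.+-cong (mask-yes (w i ≟ 2 + l) ≡) (mask-no (3 + l ≤? w i) ≯)) (K.+-identityʳ (x i))))
        by-label i (tri> ≮ ≢ gt) = K.trans (mask-yes (2 + l ≤? w i) (≮⇒≥ ≮)) (K.sym (K.trans
          (K.+-cong (mask-no (w i ≟ 2 + l) ≢) (mask-yes (3 + l ≤? w i) gt)) (K.+-identityˡ (x i))))

      -- Two consecutive level equations fix the sum over one level set. All its members except the
      -- pivot are free, so the pivot is fixed too; a coordinate with label 0 is 1.
      tight-determined : ∀ {x y} → Tight w x → Tight w y → (∀ i → Free i → x i ≈ y i) → x ≋ y
      tight-determined {x} {y} (ones-x , levels-x) (ones-y , levels-y) eq i =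
        by-kind (w i ≟ 0) (any? (λ j → i ≟F pivot j))
        where
        by-kind : Dec (w i ≡ 0) → Dec (∃[ j ] i ≡ pivot j) → x i ≈ y i
        by-kind (yes w≡0) _ = K.trans (ones-x i w≡0) (K.sym (ones-y i w≡0))
        by-kind (no w≢0) (no ¬pivot) = eq i (w≢0 , ¬pivot)
        by-kind (no w≢0) (yes (j , refl)) = K.trans (K.sym (mask-yes (w i ≟ 2 + l) (pivot-label j)))
          (K.trans (∑-cancel (pivot j) others block) (mask-yes (w i ≟ 2 + l) (pivot-label j)))
          where
          l = toℕ j
          block : ∑ (λ i → mask (w i ≟ 2 + l) (x i)) ≈ ∑ (λ i → mask (w i ≟ 2 + l) (y i))
          block = +ᴷ-cancelʳ (upperᴷ w (3 + l) x) _ _ (begin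
            ∑ (λ i → mask (w i ≟ 2 + l) (x i)) +ᴷ upperᴷ w (3 + l) x ≈⟨ label-split l x ⟨
            upperᴷ w (2 + l) x                                       ≈⟨ levels-x l ⟩
            upperᴷ w (2 + l) β                                       ≈⟨ levels-y l ⟨
            upperᴷ w (2 + l) y                                       ≈⟨ label-split l y ⟩
            ∑ (λ i → mask (w i ≟ 2 + l) (y i)) +ᴷ upperᴷ w (3 + l) y ≈⟨ K.+-congˡ (K.trans (levels-y (suc l)) (K.sym (levels-x (suc l)))) ⟩
            ∑ (λ i → mask (w i ≟ 2 + l) (y i)) +ᴷ upperᴷ w (3 + l) x ∎)
          others : ∀ k → k ≢ pivot j → mask (w k ≟ 2 + l) (x k) ≈ mask (w k ≟ 2 + l) (y k)
          others k k≢p = mask-cong (w k ≟ 2 + l) λ wk≡ → eq k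
            ( (λ wk≡0 → contradiction (trans (sym wk≡0) wk≡) λ ())
            , λ { (j′ , refl) → k≢p (cong pivot (toℕ-injective
                    (suc-injective (suc-injective (trans (sym (pivot-label j′)) wk≡))))) })

      -- The weights are read off at the free coordinates, where the differences are diagonal. The
      -- other coordinates agree by `tight-determined`, as tightness is inherited by affine
      -- combinations.
      spanned : ∀ {x} → Tight w x → affineHull (Range b) x
      spanned {x} tight-x = suc k , b , t , (λ i → i , λ _ → K.refl) , ∑t≈1 , x≋
        where
        Δ⁻¹ : ∀ f → ∃[ y ] Δ f (at f) *ᴷ y ≈ 1#
        Δ⁻¹ f = K.inverse (Δ f (at f)) (Δ-same f)
        t : Vector Carrier (suc k)
        t⁺ : Vector Carrier k
        t⁺ f = (x (at f) +ᴷ - β (at f)) *ᴷ proj₁ (Δ⁻¹ f)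
        -- The weight of `β` brings the total to `1#`; it does not affect the displacement from `β`.
        t zero    = 1# +ᴷ - ∑ t⁺
        t (suc f) = t⁺ f
        ∑t≈1 : ∑ t ≈ 1#
        ∑t≈1 = K.trans (K.+-comm _ _) (x+[y-x]≈y (∑ t⁺) 1#)
        y : Point n
        y = combination t b
        tight-y : Tight w y
        tight-y = Tight-affineHull (λ p p∈b → proj₂ (b∈face p∈b)) y
          (suc k , b , t , (λ i → i , λ _ → K.refl) , ∑t≈1 , λ _ → K.refl)
        x≋y-at : ∀ f → x (at f) ≈ y (at f)
        x≋y-at f = K.sym (begin
          y (at f)
            ≈⟨ combination-at t f ⟩
          ∑ t *ᴷ β (at f) +ᴷ (x (at f) +ᴷ - β (at f)) *ᴷ proj₁ (Δ⁻¹ f) *ᴷ Δ f (at f)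
            ≈⟨ K.+-cong (K.trans (K.*-congʳ ∑t≈1) (K.*-identityˡ _))
                 (K.trans (K.*-assoc _ _ _) (K.trans
                   (K.*-congˡ (K.trans (K.*-comm _ _) (proj₂ (Δ⁻¹ f)))) (K.*-identityʳ _))) ⟩
          β (at f) +ᴷ (x (at f) +ᴷ - β (at f))
            ≈⟨ x+[y-x]≈y (β (at f)) (x (at f)) ⟩
          x (at f) ∎)
        x≋ : x ≋ y
        x≋ = tight-determined tight-x tight-y λ i free →
          let (f , e) = index i free in subst (λ i → x i ≈ y i) e (x≋y-at f)

    face-dimension : HasDimension (face w) (n ∸ (m + r))
    face-dimension = subst (HasDimension (face w)) k≡
      (b , independent ,
       (λ {x} x∈ → spanned (Tight-affineHull {S = face w} (λ p → proj₂) x x∈)) ,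
       λ { (l , p , t , p∈b , rest) → l , p , t , (λ i → b∈face (p∈b i)) , rest })
      where
      k≡ : k ≡ n ∸ (m + r)
      k≡ = trans (sym (m+n∸n≡m k (m + r))) (cong (_∸ (m + r)) count-free)

-- Face words

module _ {n p} {P : Pred (Fin n) p} (P? : Decidable P) where

  count≡1⇒unique : count P? ≡ 1 → ∀ {i j} → P i → P j → i ≡ j
  count≡1⇒unique ≡1 {i} {j} Pi Pj with i ≟F j
  ... | yes i≡j = i≡j
  ... | no i≢j  = contradiction (trans (count-≡ i) (sym ≡1))
    (<⇒≢ (count-mono-< (_≟F i) P? (λ { _ refl → Pi }) j (i≢j ∘ sym) Pj))

  count≡1⇒exists : count P? ≡ 1 → ∃[ i ] P i
  count≡1⇒exists ≡1 with any? P?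
  ... | yes found = found
  ... | no none   = contradiction (trans (sym (count≡0 P? λ i Pi → none (i , Pi))) ≡1) λ ()

-- If only i₀ has a label below 2, then x i₀ = 1 on the whole face, and
-- {i₀} is also the lowest block of a word for the same face.
promote : ∀ {n} → Vector ℕ n → Vector ℕ n
promote w i = suc (w i ⊔ 1)

module _ {n} {w : Vector ℕ n} (low≡1 : low w ≡ 1) where

  private
    w⁺ : Vector ℕ n
    w⁺ = promote w

    i₀ : Fin n
    i₀ = proj₁ (count≡1⇒exists (λ i → w i ≤? 1) low≡1)

    w₀≤1 : w i₀ ≤ 1
    w₀≤1 = proj₂ (count≡1⇒exists (λ i → w i ≤? 1) low≡1)

    only-i₀ : ∀ {i} → w i ≤ 1 → i ≡ i₀
    only-i₀ le = count≡1⇒unique (λ i → w i ≤? 1) low≡1 le w₀≤1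

  2≤promote : ∀ i → 2 ≤ w⁺ i
  2≤promote i = s≤s (m≤n⊔m (w i) 1)

  promote-high : ∀ {i} → 1 ≤ w i → w⁺ i ≡ suc (w i)
  promote-high 1≤w = cong suc (m≥n⇒m⊔n≡m 1≤w)

  promote-low : ∀ {i} → w i ≤ 1 → w⁺ i ≡ 2
  promote-low w≤1 = cong suc (m≤n⇒m⊔n≡n w≤1)

  promote-isWord : ∀ {m r} → IsWord m r w → IsWord 0 (suc r) w⁺
  promote-isWord {r = r} W = record
    { bounded = λ i → s≤s (⊔-lub (bounded W i) (s≤s z≤n))
    ; hits    = λ
      { zero    _         → i₀ , promote-low w₀≤1
      ; (suc j) (s≤s j<r) → let (i , eq) = hits W j j<r in
          i , trans (promote-high (≤-trans (s≤s z≤n) (≤-reflexive (sym eq)))) (cong suc eq)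
      }
    ; zeros   = count≡0 (λ i → w⁺ i ≟ 0) λ i ()
    }

  promote-low≢1 : low w⁺ ≢ 1
  promote-low≢1 eq = contradiction
    (trans (sym (count≡0 (λ i → w⁺ i ≤? 1) λ i le → <⇒≱ (2≤promote i) le)) eq) λ ()

  private
    level⇔ : ∀ i l → (3 + l ≤ w⁺ i → 2 + l ≤ w i) × (2 + l ≤ w i → 3 + l ≤ w⁺ i)
    level⇔ i l = to , from
      where
      to : 3 + l ≤ w⁺ i → 2 + l ≤ w i
      to (s≤s le) with ≤-total (w i) 1
      ... | inj₁ w≤1 = contradiction (subst (2 + l ≤_) (m≤n⇒m⊔n≡n w≤1) le) λ { (s≤s ()) }
      ... | inj₂ 1≤w = subst (2 + l ≤_) (m≥n⇒m⊔n≡m 1≤w) le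
      from : 2 + l ≤ w i → 3 + l ≤ w⁺ i
      from le = s≤s (≤-trans le (m≤m⊔n (w i) 1))

    upper-promote : ∀ l α → upper w⁺ (3 + l) α ≡ upper w (2 + l) α
    upper-promote l α = ∑ℕ-cong λ i → cong (_* α i)
      (ind-cong (3 + l ≤? w⁺ i) (2 + l ≤? w i) (proj₁ (level⇔ i l)) (proj₂ (level⇔ i l)))

    -- Both greedy parking functions maximise the same sum, so each is bounded by the other.
    upper-base : ∀ l → upper w (2 + l) (base w⁺) ≡ upper w (2 + l) (base w)
    upper-base l = ≤-antisym (upper-parking-≤ w (base-parking w⁺) l)
      (subst₂ _≤_ (upper-promote l (base w)) (upper-promote l (base w⁺))
        (upper-parking-≤ w⁺ (base-parking w) (suc l)))

    base₀≡1 : base w⁺ i₀ ≡ 1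
    base₀≡1 = trans (base-high w⁺ (2≤promote i₀)) (cong suc
      (count≡0 (λ j → key w⁺ j <? key w⁺ i₀) λ j lt → not-below j lt (j ≟F i₀)))
      where
      not-below : ∀ j → key w⁺ j < key w⁺ i₀ → Dec (j ≡ i₀) → _
      not-below j lt (yes refl) = <-irrefl refl lt
      not-below j lt (no j≢i₀) = <⇒≯ lt (key-mono w⁺ (subst (_< w⁺ j) (sym (promote-low w₀≤1))
        (s≤s (<-≤-trans (≰⇒> (j≢i₀ ∘ only-i₀)) (m≤m⊔n (w j) 1)))))

  module Promotion {c ℓ₁ ℓ₂ : Level} (K : OrderedField c ℓ₁ ℓ₂) where

    open Geometry K
    open OrderedFieldProperties K
    open MaximalFaces K
    open Dimension K
    open RingProperties K.ring using ()
      renaming (+-cancelʳ to +ᴷ-cancelʳ)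
    open SetoidReasoning K.setoid
    open Sum K.semiring using (∑-distrib-+)

    private
      β⁺ : Point n
      β⁺ = ι ∘ base w⁺

      upperᴷ-promote : ∀ l x → upperᴷ w⁺ (3 + l) x ≈ upperᴷ w (2 + l) x
      upperᴷ-promote l x = ∑-cong λ i → same i (2 + l ≤? w i)
        where
        same : ∀ i → Dec (2 + l ≤ w i) → mask (3 + l ≤? w⁺ i) (x i) ≈ mask (2 + l ≤? w i) (x i)
        same i (yes le) = K.trans (mask-yes (3 + l ≤? w⁺ i) (proj₂ (level⇔ i l) le)) (K.sym (mask-yes (2 + l ≤? w i) le))
        same i (no ≰)   = K.trans (mask-no (3 + l ≤? w⁺ i) (≰ ∘ proj₁ (level⇔ i l))) (K.sym (mask-no (2 + l ≤? w i) ≰))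

      upperᴷ-base : ∀ l → upperᴷ w⁺ (3 + l) β⁺ ≈ upperᴷ w (2 + l) (ι ∘ base w)
      upperᴷ-base l = begin
        upperᴷ w⁺ (3 + l) β⁺             ≈⟨ upperᴷ-promote l β⁺ ⟩
        upperᴷ w (2 + l) β⁺              ≈⟨ upperᴷ-ι w (2 + l) (base w⁺) ⟨
        ι (upper w (2 + l) (base w⁺))    ≈⟨ K.reflexive (cong ι (upper-base l)) ⟩
        ι (upper w (2 + l) (base w))     ≈⟨ upperᴷ-ι w (2 + l) (base w) ⟩
        upperᴷ w (2 + l) (ι ∘ base w)    ∎

      total : ∀ x → upperᴷ w⁺ 2 x ≈ x i₀ +ᴷ upperᴷ w⁺ 3 x
      total x = begin
        ∑ (λ i → mask (2 ≤? w⁺ i) (x i))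
          ≈⟨ ∑-cong (λ i → split i (i ≟F i₀)) ⟩
        ∑ (λ i → mask (i ≟F i₀) (x i) +ᴷ mask (3 ≤? w⁺ i) (x i))
          ≈⟨ ∑-distrib-+ (λ i → mask (i ≟F i₀) (x i)) (λ i → mask (3 ≤? w⁺ i) (x i)) ⟩
        ∑ (λ i → mask (i ≟F i₀) (x i)) +ᴷ upperᴷ w⁺ 3 x
          ≈⟨ K.+-congʳ (K.trans (∑-single i₀ (λ i i≢ → mask-no (i ≟F i₀) i≢)) (mask-yes (i₀ ≟F i₀) refl)) ⟩
        x i₀ +ᴷ upperᴷ w⁺ 3 x ∎
        where
        split : ∀ i → Dec (i ≡ i₀) →
                mask (2 ≤? w⁺ i) (x i) ≈ mask (i ≟F i₀) (x i) +ᴷ mask (3 ≤? w⁺ i) (x i)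
        split i d = K.trans (mask-yes (2 ≤? w⁺ i) (2≤promote i)) (K.sym (by-index d))
          where
          by-index : Dec (i ≡ i₀) → mask (i ≟F i₀) (x i) +ᴷ mask (3 ≤? w⁺ i) (x i) ≈ x i
          by-index (yes refl) = K.trans (K.+-cong (mask-yes (i₀ ≟F i₀) refl)
            (mask-no (3 ≤? w⁺ i₀) λ le → contradiction (subst (3 ≤_) (promote-low w₀≤1) le) λ { (s≤s (s≤s ())) }))
            (K.+-identityʳ _)
          by-index (no i≢i₀) = K.trans (K.+-cong (mask-no (i ≟F i₀) i≢i₀)
            (mask-yes (3 ≤? w⁺ i) (proj₂ (level⇔ i 0) (≰⇒> (i≢i₀ ∘ only-i₀)))))
            (K.+-identityˡ _)

      β⁺₀≈1 : β⁺ i₀ ≈ 1#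
      β⁺₀≈1 = K.trans (K.reflexive (cong ι base₀≡1)) ι-one

    -- Level 2 of `w⁺` contains all coordinates, and level 3 all but `i₀`. Once the level 3 sum is
    -- maximal, the level 2 equation amounts to `x i₀ ≈ 1#`. On the face of `w` it holds because
    -- `x i₀` is at least `1#` while the total cannot exceed its maximum.
    face-promote : face w ≐ face w⁺
    face-promote = to , from
      where
      to : face w ⊆ face w⁺
      to {x} (Px , ones , levels) = Px , (λ i ()) , λ { zero → level₂ ; (suc l) → above l }
        where
        above : ∀ l → upperᴷ w⁺ (3 + l) x ≈ upperᴷ w⁺ (3 + l) β⁺
        above l = K.trans (upperᴷ-promote l x) (K.trans (levels l) (K.sym (upperᴷ-base l)))
        level₂ : upperᴷ w⁺ 2 x ≈ upperᴷ w⁺ 2 β⁺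
        level₂ = ≤ᴷ.antisym (upperᴷ-≤ w⁺ Px 0) (≤-resp
          (K.sym (K.trans (total β⁺) (K.+-congʳ β⁺₀≈1))) (K.sym (total x))
          (+ᴷ-mono-≤ (1≤coordinate Px i₀) (≤ᴷ.reflexive (K.sym (above 0)))))
      from : face w⁺ ⊆ face w
      from {x} (Px , _ , levels) =
        Px ,
        (λ i w≡0 → K.trans (K.reflexive (cong x (only-i₀ (≤-trans (≤-reflexive w≡0) z≤n)))) x₀≈1) ,
        λ l → K.trans (K.sym (upperᴷ-promote l x)) (K.trans (levels (suc l)) (upperᴷ-base l))
        where
        x₀≈1 : x i₀ ≈ 1#
        x₀≈1 = K.trans (+ᴷ-cancelʳ (upperᴷ w⁺ 3 x) _ _ (begin
          x i₀ +ᴷ upperᴷ w⁺ 3 x    ≈⟨ total x ⟨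
          upperᴷ w⁺ 2 x            ≈⟨ levels 0 ⟩
          upperᴷ w⁺ 2 β⁺           ≈⟨ total β⁺ ⟩
          β⁺ i₀ +ᴷ upperᴷ w⁺ 3 β⁺  ≈⟨ K.+-congˡ (levels 1) ⟨
          β⁺ i₀ +ᴷ upperᴷ w⁺ 3 x   ∎)) β⁺₀≈1

-- The words with m + r = s and low w ≢ 1 index the faces of codimension s.
record IsFaceWord {n} (s : ℕ) (w : Vector ℕ n) : Set where
  field
    {negatives levels} : ℕ
    isWord : IsWord negatives levels w
    codim  : negatives + levels ≡ s
    low≢1  : low w ≢ 1

low-cong : ∀ {n} {w w′ : Vector ℕ n} → w ≗ w′ → low w ≡ low w′
low-cong {w = w} {w′} eq = count-cong (λ i → w i ≤? 1) (λ i → w′ i ≤? 1)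
  (λ i → subst (_≤ 1) (eq i)) (λ i → subst (_≤ 1) (sym (eq i)))

zeros-cong : ∀ {n} {w w′ : Vector ℕ n} → w ≗ w′ → count (λ i → w i ≟ 0) ≡ count (λ i → w′ i ≟ 0)
zeros-cong {w = w} {w′} eq = count-cong (λ i → w i ≟ 0) (λ i → w′ i ≟ 0)
  (λ i → trans (sym (eq i))) (λ i → trans (eq i))

zeros-unique : ∀ {n m m′ r r′} {w w′ : Vector ℕ n} → IsWord m r w → IsWord m′ r′ w′ → w ≗ w′ → m ≡ m′
zeros-unique W W′ eq = trans (sym (zeros W)) (trans (zeros-cong eq) (zeros W′))

-- The summation range m ≠ 1 matches words with m ≠ 1 rather than those
-- with low w ≢ 1.  The former with a single low label, which is then 1,
-- become the latter with m ≡ 1 when all labels are lowered by one.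
demote : ∀ {n} (w : Vector ℕ n) → Dec (low w ≡ 1) → Vector ℕ n
demote w (yes _) = pred ∘ w
demote w (no _)  = w

module _ {n s : ℕ} where

  Coded : ℕ → Set
  Coded m = Code n m (s ∸ m)

  decodeAny : ∀ {ms} → Any Coded ms → Vector ℕ n
  decodeAny c = decode (proj₂ (proj₂ (find c)))

  decodeAny-isWord : ∀ {ms} (c : Any Coded ms) → IsWord (proj₁ (find c)) (s ∸ proj₁ (find c)) (decodeAny c)
  decodeAny-isWord c = decode-isWord (proj₂ (proj₂ (find c)))

  decodeAny-injective : ∀ {ms} → Unique ms → (c d : Any Coded ms) → decodeAny c ≗ decodeAny d → c ≡ d
  decodeAny-injective _ (here c) (here d) eq = cong here (decode-injective c d eq)
  decodeAny-injective (m∉ms ∷ _) (here c) (there d) eq = contradiction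
    (zeros-unique (decode-isWord c) (decodeAny-isWord d) eq) (All.lookup m∉ms (proj₁ (proj₂ (find d))))
  decodeAny-injective (m∉ms ∷ _) (there c) (here d) eq = contradiction
    (sym (zeros-unique (decodeAny-isWord c) (decode-isWord d) eq)) (All.lookup m∉ms (proj₁ (proj₂ (find c))))
  decodeAny-injective (_ ∷ u) (there c) (there d) eq = cong there (decodeAny-injective u c d eq)

  encodeAny : ∀ {ms m} → m ∈ ms → ∀ {w} → IsWord m (s ∸ m) w → ∃[ c ] decodeAny {ms} c ≗ w
  encodeAny (here refl) W = let (c , eq) = encode _ W in here c , eq
  encodeAny (there m∈)  W = let (c , eq) = encodeAny m∈ W in there c , eq

module Demotion {n s m : ℕ} (excluded : ¬ (n ≡ 1 × s ≡ 0)) (m≢1 : m ≢ 1) (m≤s : m ≤ s)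
                {w : Vector ℕ n} (W : IsWord m (s ∸ m) w) where

  single-low⇒m≡0 : low w ≡ 1 → m ≡ 0
  single-low⇒m≡0 low≡1 = n<1⇒n≡0 (≤∧≢⇒< (≤-trans (≤-reflexive (sym (zeros W)))
    (≤-trans (count-mono (λ i → w i ≟ 0) (λ i → w i ≤? 1) (λ i w≡0 → ≤-trans (≤-reflexive w≡0) z≤n))
             (≤-reflexive low≡1))) m≢1)

  single-low⇒positive : low w ≡ 1 → ∀ i → 1 ≤ w i
  single-low⇒positive low≡1 i = n≢0⇒n>0 λ w≡0 → contradiction
    (count>0 (λ i → w i ≟ 0) i w≡0) (≤⇒≯ (≤-reflexive (trans (zeros W) (single-low⇒m≡0 low≡1))))

  pred-zeros : low w ≡ 1 → count (λ i → pred (w i) ≟ 0) ≡ 1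
  pred-zeros low≡1 = trans (count-cong (λ i → pred (w i) ≟ 0) (λ i → w i ≤? 1)
    (λ i eq → pred≡0⇒≤1 (w i) eq) (λ i le → n≤0⇒n≡0 (pred-mono-≤ le))) low≡1
    where
    pred≡0⇒≤1 : ∀ k → pred k ≡ 0 → k ≤ 1
    pred≡0⇒≤1 zero       _ = z≤n
    pred≡0⇒≤1 (suc zero) _ = s≤s z≤n

  demote-isFaceWord : (d : Dec (low w ≡ 1)) → IsFaceWord s (demote w d)
  demote-isFaceWord (no low≢1)  = record { isWord = W ; codim = m+[n∸m]≡n m≤s ; low≢1 = low≢1 }
  demote-isFaceWord (yes low≡1) = demoted s (subst (λ m → IsWord m (s ∸ m) w) (single-low⇒m≡0 low≡1) W) refl
    where
    demoted : ∀ s′ → IsWord 0 s′ w → s ≡ s′ → IsFaceWord s (pred ∘ w)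
    -- Without positive levels every label is low, so a single low label means `n ≡ 1`, and `s` is
    -- 0: the excluded case.
    demoted zero W₀ s≡0 = contradiction
      (trans (sym (∑ℕ-ones n)) (trans (∑ℕ-cong λ i → sym (ind-yes (w i ≤? 1) (bounded W₀ i))) low≡1) , s≡0)
      excluded
    demoted (suc s′) W₀ s≡ = record
      { isWord = record
        { bounded = λ i → pred-mono-≤ (bounded W₀ i)
        ; hits    = λ j j<s′ → let (i , eq) = hits W₀ (suc j) (s≤s j<s′) in i , cong pred eq
        ; zeros   = pred-zeros low≡1
        }
      ; codim  = sym s≡
      -- The single low coordinate drops to 0 and one with label 2 drops to 1, so at least two
      -- labels are now low.
      ; low≢1  = λ low≡1′ →
          let (i , wi) = count≡1⇒exists (λ i → w i ≤? 1) low≡1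
              (j , wj) = hits W₀ 0 z<s
              i≡j = count≡1⇒unique (λ i → pred (w i) ≤? 1) low≡1′ {i} {j}
                      (≤-trans (pred-mono-≤ wi) z≤n) (≤-reflexive (cong pred wj))
          in contradiction (subst (_≤ 1) (trans (cong w i≡j) wj) wi) λ { (s≤s ()) }
      }

-- The number of zeros reveals which branch of `demote` was taken: exactly one after lowering, and
-- `m ≢ 1` without it. No information is lost by `pred`, since the lowered words have no label 0.
demote-injective : ∀ {n s m m′} → ¬ (n ≡ 1 × s ≡ 0) → m ≢ 1 → m ≤ s → m′ ≢ 1 → m′ ≤ s →
  {w w′ : Vector ℕ n} → IsWord m (s ∸ m) w → IsWord m′ (s ∸ m′) w′ →
  (d : Dec (low w ≡ 1)) (d′ : Dec (low w′ ≡ 1)) → demote w d ≗ demote w′ d′ → w ≗ w′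
demote-injective ns m≢1 m≤s m′≢1 m′≤s {w} {w′} W W′ (no _) (no _) eq = eq
demote-injective ns m≢1 m≤s m′≢1 m′≤s {w} {w′} W W′ (no _) (yes l′) eq =
  contradiction (trans (sym (zeros W)) (trans (zeros-cong eq) (Demotion.pred-zeros ns m′≢1 m′≤s W′ l′))) m≢1
demote-injective ns m≢1 m≤s m′≢1 m′≤s {w} {w′} W W′ (yes l) (no _) eq =
  contradiction (trans (sym (zeros W′)) (trans (zeros-cong (sym ∘ eq)) (Demotion.pred-zeros ns m≢1 m≤s W l))) m′≢1
demote-injective ns m≢1 m≤s m′≢1 m′≤s {w} {w′} W W′ (yes l) (yes l′) eq i =
  unpred (w i) (w′ i) (Demotion.single-low⇒positive ns m≢1 m≤s W l i)
                      (Demotion.single-low⇒positive ns m′≢1 m′≤s W′ l′ i) (eq i)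
  where
  unpred : ∀ a b → 1 ≤ a → 1 ≤ b → pred a ≡ pred b → a ≡ b
  unpred (suc a) (suc b) _ _ e = cong suc e

-- Only a face word with exactly one label 0 needs a new preimage, obtained by adding one to all
-- labels. It attains level 2, because `low w ≢ 1` supplies a coordinate of label 1 in `w`.
demote-surjective : ∀ {n s} {w : Vector ℕ n} → IsFaceWord s w →
  ∃[ m ] Σ (Vector ℕ n) λ w′ → m ≢ 1 × m ≤ s × IsWord m (s ∸ m) w′ × (∀ d → demote w′ d ≗ w)
demote-surjective {n} {s} {w} F = go (negatives ≟ 1)
  where
  open IsFaceWord F
  go : Dec (negatives ≡ 1) → _
  go (no m≢1) = negatives , w , m≢1 , subst (negatives ≤_) codim (m≤m+n negatives levels) ,
    subst (λ r → IsWord negatives r w) (trans (sym (m+n∸m≡n negatives levels)) (cong (_∸ negatives) codim)) isWord ,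
    λ { (yes low≡1) → contradiction low≡1 low≢1 ; (no _) i → refl }
  go (yes m≡1) = 0 , suc ∘ w , (λ ()) , z≤n , record
      { bounded = λ i → subst (suc (w i) ≤_) (cong suc s≡) (s≤s (bounded isWord i))
      ; hits    = λ { zero _ → one , cong suc one≡1
                    ; (suc j) j<s → let (i , eq) = hits isWord j (≤-pred (subst (suc j <_) (sym s≡) j<s)) in
                        i , cong suc eq }
      ; zeros   = count≡0 (λ i → suc (w i) ≟ 0) λ i ()
      } ,
    λ { (yes _) i → refl ; (no low≢1′) → contradiction suc-low≡1 low≢1′ }
    where
    s≡ : suc levels ≡ s
    s≡ = trans (cong (_+ levels) (sym m≡1)) codim
    zeros≡1 : count (λ i → w i ≟ 0) ≡ 1
    zeros≡1 = trans (zeros isWord) m≡1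
    suc-low≡1 : low (suc ∘ w) ≡ 1
    suc-low≡1 = trans (count-cong (λ i → suc (w i) ≤? 1) (λ i → w i ≟ 0)
      (λ i le → n≤0⇒n≡0 (≤-pred le)) (λ i eq → s≤s (≤-reflexive eq))) zeros≡1
    zero₀ = count≡1⇒exists (λ i → w i ≟ 0) zeros≡1
    another = count≢1 (λ i → w i ≤? 1) low≢1 (proj₁ zero₀) (≤-trans (≤-reflexive (proj₂ zero₀)) z≤n)
    one : Fin n
    one = proj₁ another
    one≡1 : w one ≡ 1
    one≡1 = ≤-antisym (proj₂ (proj₂ another)) (n≢0⇒n>0 λ w≡0 → proj₁ (proj₂ another)
      (count≡1⇒unique (λ i → w i ≟ 0) zeros≡1 w≡0 (proj₂ zero₀)))

-- Classification of the nonempty faces by words.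

module FaceLattice {c ℓ₁ ℓ₂ : Level} (K : OrderedField c ℓ₁ ℓ₂) where

  open Geometry K
  open OrderedFieldProperties K
  open MaximalFaces K
  open Dimension K

  affineHull-mono : ∀ {n s t} {S : Pred (Point n) s} {T : Pred (Point n) t} →
                    S ⊆ T → affineHull S ⊆ affineHull T
  affineHull-mono S⊆T (m , p , t , p∈S , rest) = m , p , t , (λ i → S⊆T (p∈S i)) , rest

  HasDimension-resp-≐ : ∀ {n s t} {S : Pred (Point n) s} {T : Pred (Point n) t} {k} →
                        S ≐ T → HasDimension S k → HasDimension T k
  HasDimension-resp-≐ {S = S} {T} (S⊆T , T⊆S) (b , b-ind , S⊆b , b⊆S) =
    b , b-ind , (λ x∈ → S⊆b (affineHull-mono {S = T} {S} T⊆S x∈)) ,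
                (λ x∈ → affineHull-mono {S = S} {T} S⊆T (b⊆S x∈))

  -- A combination of no points has total weight 0, not 1. This is how the empty face, cut out by a
  -- bound that is never attained, is kept out of the count.
  HasDimension⇒inhabited : ∀ {n s} {S : Pred (Point n) s} {k} → HasDimension S k → Σ (Point n) S
  HasDimension⇒inhabited (b , _ , _ , b⊆S)
    with b⊆S (point∈affineHull {S = Range b} (zero , λ _ → K.refl))
  ... | zero  , p , t , p∈S , ∑t≈1 , _ = contradiction ∑t≈1 K.0≉1
  ... | suc m , p , t , p∈S , _        = p zero , p∈S zero

  module _ {n : ℕ} where

    private
      P = parkingPolytope n

    face-isFace : ∀ {m r} {w : Vector ℕ n} → IsWord m r w → IsFace P (face w)
    face-isFace {r = r} {w} W = functional r w , functional r w · (ι ∘ base w) ,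
      (λ x → maximum) ,
      (λ { (Px , tight) → Px , tight⇒maximal tight }) ,
      (λ { (Px , eq) → Px , maximal⇒tight Px eq })
      where open Maximum (bounded W) (functional-pattern r w)

    Pattern-cong : ∀ {a : Point n} {r} {w w′ : Vector ℕ n} → w ≗ w′ → Pattern a r w → Pattern a r w′
    Pattern-cong {a} {w = w} {w′} eq pat = record
      { gap      = gap
      ; gap>0    = gap>0
      ; negative = λ i w′≡0 → negative i (trans (eq i) w′≡0)
      ; value    = λ i → subst (λ k → 1 ≤ k → a i ≈ ∑ (λ j → mask (2 + toℕ j ≤? k) (gap j))) (eq i) (value i)
      } where open Pattern pat

    -- Pointwise equality does not yield `w ≡ w′`. Instead, one functional has both patterns, and
    -- `base w` and `base w′` give it the same maximum.
    face-⊆ : ∀ {m r} {w w′ : Vector ℕ n} → IsWord m r w → w ≗ w′ → face w ⊆ face w′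
    face-⊆ {r = r} {w} {w′} W eq (Px , tight) = Px , M′.maximal⇒tight Px (K.trans (M.tight⇒maximal tight)
      (≤ᴷ.antisym (M′.maximum (parking∈P (base-parking w))) (M.maximum (parking∈P (base-parking w′)))))
      where
      pat = functional-pattern r w
      module M  = Maximum (bounded W) pat
      module M′ = Maximum (λ i → subst (_≤ suc r) (eq i) (bounded W i)) (Pattern-cong eq pat)

    face-cong : ∀ {m r m′ r′} {w w′ : Vector ℕ n} → IsWord m r w → IsWord m′ r′ w′ → w ≗ w′ → face w ≐ face w′
    face-cong W W′ eq = face-⊆ W eq , face-⊆ W′ (sym ∘ eq)

    face-injective : ∀ {m r m′ r′} {w w′ : Vector ℕ n} → IsWord m r w → IsWord m′ r′ w′ →
                     low w ≢ 1 → low w′ ≢ 1 → face w ≐ face w′ → w ≗ w′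
    face-injective {w = w} {w′} W W′ low≢1 low′≢1 (to , from) = word-unique W W′ low≢1 low′≢1
      (λ α park tight → Tight⇒Tightℕ {w = w′} (proj₂ (to   (parking∈P park , Tightℕ⇒Tight {w = w} tight))))
      (λ α park tight → Tight⇒Tightℕ {w = w} (proj₂ (from (parking∈P park , Tightℕ⇒Tight {w = w′} tight))))

    record FaceOfWord {f} (F : Pred (Point n) f) : Set (f Level.⊔ c Level.⊔ ℓ₁ Level.⊔ ℓ₂) where
      field
        {negatives levels} : ℕ
        word   : Vector ℕ n
        isWord : IsWord negatives levels word
        low≢1  : low word ≢ 1
        same   : F ≐ face word

    faceOfWord : ∀ {f} {F : Pred (Point n) f} → IsFace P F → Σ (Point n) F → FaceOfWord F
    faceOfWord {F = F} (a , d , valid , F⊆ , ⊆F) (x₀ , Fx₀) = by-low (low w ≟ 1)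
      where
      open Labelling (labelling a) renaming (labels to w)
      open Maximum (bounded isWord) hasPattern
      -- The point `x₀` of the face makes the bound `d` sharp.
      d≈max : a · (ι ∘ base w) ≈ d
      d≈max = ≤ᴷ.antisym (valid _ (parking∈P (base-parking w)))
        (≤-resp (proj₂ (F⊆ Fx₀)) K.refl (maximum (proj₁ (F⊆ Fx₀))))
      F≐face : F ≐ face w
      F≐face =
        (λ Fx → let (Px , eq) = F⊆ Fx in Px , maximal⇒tight Px (K.trans eq (K.sym d≈max))) ,
        (λ { (Px , tight) → ⊆F (Px , K.trans (tight⇒maximal tight) d≈max) })
      by-low : Dec (low w ≡ 1) → FaceOfWord F
      by-low (no low≢1) = record { word = w ; isWord = isWord ; low≢1 = low≢1 ; same = F≐face }
      by-low (yes low≡1) = record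
        { word = promote w ; isWord = promote-isWord {w = w} low≡1 isWord ; low≢1 = promote-low≢1 {w = w} low≡1
        ; same = proj₁ face-promote ∘ proj₁ F≐face , proj₂ F≐face ∘ proj₂ face-promote }
        where open Promotion {w = w} low≡1 K

    negatives+levels≤n : ∀ {m r} {w : Vector ℕ n} → IsWord m r w → m + r ≤ n
    negatives+levels≤n {m} {r} W = subst (m + r ≤_) (FreeCoordinates.count-free W) (m≤n+m (m + r) (count (FreeCoordinates.free? W)))

-- The bijection between codes and faces of a given codimension.

theorem3p1 : ∀ {c ℓ₁ ℓ₂ : Level} (K : OrderedField c ℓ₁ ℓ₂) →
    let open Geometry K in
    (n s : ℕ) → 1 ≤ n → s ≤ n → ¬ (n ≡ 1 × s ≡ 0) →
    HasCardinality (Faces (parkingPolytope n) (n ∸ s))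
    (sum (map (λ m → (n C m) * (s ∸ m) ! * stirling₂ (n ∸ m + 1) (s ∸ m + 1))
    (filter (λ m → ¬? (m ≟ 1)) (upTo (suc s)))))
theorem3p1 K n s 1≤n s≤n ns = record
  { to        = toFace
  ; cong      = λ { refl → (λ x∈ → x∈) , λ x∈ → x∈ }
  ; bijective = toFace-injective , toFace-surjective
  }
  where
  open Geometry K
  open Dimension K
  open FaceLattice K

  ms : List ℕ
  ms = filter (λ m → ¬? (m ≟ 1)) (upTo (suc s))

  N : ℕ
  N = sum (map (λ m → (n C m) * (s ∸ m) ! * stirling₂ (n ∸ m + 1) (s ∸ m + 1)) ms)

  codes : Inverse (setoid (Fin N)) (setoid (Any (λ m → Code n m (s ∸ m)) ms))
  codes = Fin↔Codes n s ms

  code : Fin N → Any (λ m → Code n m (s ∸ m)) ms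
  code = Inverse.to codes

  in-range : (c : Any (λ m → Code n m (s ∸ m)) ms) → proj₁ (find c) ≢ 1 × proj₁ (find c) ≤ s
  in-range c with ∈-filter⁻ (λ m → ¬? (m ≟ 1)) {xs = upTo (suc s)} (proj₁ (proj₂ (find c)))
  ... | m∈ , m≢1 = m≢1 , ≤-pred (∈-upTo⁻ m∈)

  word : Fin N → Vector ℕ n
  word k = demote (decodeAny {n} {s} (code k)) (low (decodeAny {n} {s} (code k)) ≟ 1)

  word-isFaceWord : ∀ k → IsFaceWord s (word k)
  word-isFaceWord k = Demotion.demote-isFaceWord ns (proj₁ (in-range (code k))) (proj₂ (in-range (code k)))
    (decodeAny-isWord (code k)) (low (decodeAny {n} {s} (code k)) ≟ 1)

  toFace : Fin N → Σ (Pred (Point n) _) λ F → IsFace (parkingPolytope n) F × HasDimension F (n ∸ s)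
  toFace k = face (word k) , face-isFace isWord ,
    subst (λ d → HasDimension (face (word k)) (n ∸ d)) codim (face-dimension isWord low≢1)
    where open IsFaceWord (word-isFaceWord k)

  toFace-injective : ∀ {k l} → face (word k) ≐ face (word l) → k ≡ l
  toFace-injective {k} {l} eq = trans (sym (Inverse.strictlyInverseʳ codes k))
    (trans (cong (Inverse.from codes) codes-equal) (Inverse.strictlyInverseʳ codes l))
    where
    open IsFaceWord
    F = word-isFaceWord k
    G = word-isFaceWord l
    codes-equal : code k ≡ code l
    codes-equal = decodeAny-injective {n} {s} (filter⁺ (λ m → ¬? (m ≟ 1)) (upTo⁺ (suc s))) (code k) (code l)
      (demote-injective ns (proj₁ (in-range (code k))) (proj₂ (in-range (code k)))
        (proj₁ (in-range (code l))) (proj₂ (in-range (code l)))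
        (decodeAny-isWord (code k)) (decodeAny-isWord (code l))
        (low (decodeAny {n} {s} (code k)) ≟ 1) (low (decodeAny {n} {s} (code l)) ≟ 1)
        (face-injective (isWord F) (isWord G) (low≢1 F) (low≢1 G) eq))

  word-surjective : ∀ {w : Vector ℕ n} → IsFaceWord s w → ∃[ k ] word k ≗ w
  word-surjective F =
    let (m , w′ , m≢1 , m≤s , W′ , demoted) = demote-surjective F
        (c , c≗w′) = encodeAny {n} {s} (∈-filter⁺ (λ m → ¬? (m ≟ 1)) (∈-upTo⁺ (s≤s m≤s)) m≢1) W′
        k = Inverse.from codes c
        k≗w′ = λ i → trans (cong (λ c → decodeAny {n} {s} c i) (Inverse.strictlyInverseˡ codes c)) (c≗w′ i)
    in k , λ i → trans (demote-cong k≗w′ (low (decodeAny {n} {s} (code k)) ≟ 1) (low w′ ≟ 1) i)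
                       (demoted (low w′ ≟ 1) i)
    where
    demote-cong : ∀ {w w′ : Vector ℕ n} → w ≗ w′ → ∀ d d′ → demote w d ≗ demote w′ d′
    demote-cong eq (yes _) (yes _) i = cong pred (eq i)
    demote-cong eq (yes l) (no ¬l) i = contradiction (trans (sym (low-cong eq)) l) ¬l
    demote-cong eq (no ¬l) (yes l) i = contradiction (trans (low-cong eq) l) ¬l
    demote-cong eq (no _)  (no _)  i = eq i

  toFace-surjective : ∀ (F : Σ (Pred (Point n) _) λ F → IsFace (parkingPolytope n) F × HasDimension F (n ∸ s)) →
    ∃[ k ] ∀ {l} → l ≡ k → face (word l) ≐ proj₁ F
  toFace-surjective (F , isFace , dim) = proj₁ found , λ { refl →
      proj₂ same ∘ proj₁ faces-equal , proj₂ faces-equal ∘ proj₁ same }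
    where
    open FaceOfWord (faceOfWord isFace (HasDimension⇒inhabited {S = F} dim)) renaming (word to w)
    codim : negatives + levels ≡ s
    -- Truncated subtraction from `n` is injective only on numbers up to `n`, so both codimensions
    -- are bounded first.
    codim = ∸-cancelˡ-≡ (negatives+levels≤n isWord) s≤n
      (dimension-unique {F = F} (HasDimension-resp-≐ {S = face w} {F} (proj₂ same , proj₁ same) (face-dimension isWord low≢1)) dim)
    found : ∃[ k ] word k ≗ w
    found = word-surjective record { isWord = isWord ; codim = codim ; low≢1 = low≢1 }
    faces-equal : face (word (proj₁ found)) ≐ face w
    faces-equal = face-cong (IsFaceWord.isWord (word-isFaceWord (proj₁ found))) isWord (proj₂ found)
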